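{- Let $\mathbb{F}_q$ be a finite field of odd characteristic with $q\equiv 1\pmod 6$, let $T$ be a generator of the group of multiplicative characters of $\mathbb{F}_q$, and let $a,b,c\in\mathbb{F}_q^\times$ be all distinct. If $h\in\mathbb{F}_q^\times$ satisfies $3h^2+2(a+b+c)h+ab+bc+ca=0$, then $$\psi_{(1,1,1)}(a,b,c)=q\,\varphi(-3d)\;{_2}F_1\left(\begin{array}{cc}T^{\frac{q-1}{6}},&T^{\frac{5(q-1)}{6}}\\ &\varepsilon\end{array}\Big|\ -\frac{3^3e}{2^2d^3}\right),$$ where $d=3h+a+b+c$ and $e=h^3+(a+b+c)h^2+(ab+bc+ca)h+abc$.
   Context: Multiplicative characters $\chi:\mathbb{F}_q^\times\to\mathbb{C}^\times$ are extended to $\mathbb{F}_q$ by $\chi(0):=0$, including the trivial character $\varepsilon$; $\overline{\chi}$ is the inverse of $\chi$. $\varphi$ is the quadratic character and $\varepsilon$ the trivial character of $\mathbb{F}_q$. $\psi_{(1,1,1)}(a,b,c):=\sum_{x\in\mathbb{F}_q}\varphi(x+a)\varphi(x+b)\varphi(x+c)$. For characters $A,B,C$ and $x\in\mathbb{F}_q$, Greene's finite field hypergeometric series is $${_2}F_1\left(\begin{array}{cc}A,&B\\ &C\end{array}\Big|\ x\right):=\varepsilon(x)\frac{BC(-1)}{q}\sum_{y\in\mathbb{F}_q}B(y)\,\overline{B}C(1-y)\,\overline{A}(1-xy).$$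
   Formalization: The condition d ≠ 0 is added: the argument −3³e/(2²d³) is undefined when d = 0, which can occur (q = 7, (a,b,c) = (5,6,1), h = 3, where ψ = 4 but φ(−3d) = 0). -}

module Defs where

open import Level using (Level; _⊔_; suc)
open import Data.Nat.Base as ℕ using (ℕ; NonZero)
open import Data.Nat.Divisibility using (_∣_)
open import Data.Integer.Base using (ℤ; +_; -[1+_])
open import Data.Fin.Base using (Fin; toℕ)
import Data.Fin.Properties as Fin
open import Data.Product using (Σ-syntax; ∃; ∃-syntax; _×_; _,_; proj₁; proj₂)
open import Relation.Nullary using (¬_; Dec; yes; no)
open import Relation.Nullary.Decidable using (via-injection)
open import Relation.Binary.Definitions using (Decidable)
open import Relation.Binary.PropositionalEquality as ≡ using (_≡_)
open import Function.Bundles using (Inverse; Injection; _⇔_)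
open import Function.Properties.Inverse using (Inverse⇒Injection)
open import Algebra.Bundles using (Semiring; CommutativeRing; AbelianGroup)
open import Algebra.Morphism.Bundles using (GroupHomomorphism)
open import Algebra.Apartness.Bundles using (HeytingField; HeytingCommutativeRing)
import Algebra.Definitions.RawMonoid as RawMonoidDefs
import Algebra.Definitions.RawSemiring as RawSemiringDefs
import Algebra.Properties.AbelianGroup as AbelianGroupProperties
import Algebra.Properties.CommutativeSemigroup as CommutativeSemigroupProperties
import Relation.Binary.Reasoning.Setoid as SetoidReasoning

record FiniteField (c ℓ : Level) : Set (suc (c ⊔ ℓ)) where
  field
    commutativeRing : CommutativeRing c ℓ

  open CommutativeRing commutativeRing public

  field
    0≉1         : ¬ (0# ≈ 1#)
    reciprocal  : ∀ x → ¬ (x ≈ 0#) → ∃[ y ] x * y ≈ 1#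
    order       : ℕ
    enumeration : Inverse setoid (≡.setoid (Fin order))

  open Inverse enumeration public using () renaming (to to index; from to element)

  open RawSemiringDefs (Semiring.rawSemiring (CommutativeRing.semiring commutativeRing)) public
    using (_^_; sum) renaming (_×_ to _·_)

  infix 4 _≟_
  _≟_ : Decidable _≈_
  _≟_ = via-injection (Inverse⇒Injection enumeration) Fin._≟_

  order-nonZero : NonZero order
  order-nonZero = Fin.nonZeroIndex (index 0#)

  -- Total division: x ÷ y is 0# when y ≈ 0#, so it only has its usual
  -- meaning for y ≉ 0#.
  infixl 7 _÷_
  _÷_ : Carrier → Carrier → Carrier
  x ÷ y with y ≟ 0#
  ... | yes _  = 0#
  ... | no y≉0 = x * proj₁ (reciprocal y y≉0)

  HasCharacteristic : ℕ → Set ℓ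
  HasCharacteristic p = ∀ n → (n · 1# ≈ 0#) ⇔ p ∣ n

-- The value field of the characters.  The standard library has no complex
-- numbers, so ℂ is replaced by an arbitrary algebraically closed field of
-- characteristic zero.  The field is a Heyting field because equality of
-- complex numbers is not decidable constructively; classically this is an
-- ordinary field with # the negation of ≈.
record AlgebraicallyClosedField₀ (c ℓ₁ ℓ₂ : Level) : Set (suc (c ⊔ ℓ₁ ⊔ ℓ₂)) where
  field
    heytingField : HeytingField c ℓ₁ ℓ₂

  open HeytingField heytingField public

  commutativeRing : CommutativeRing c ℓ₁
  commutativeRing = HeytingCommutativeRing.commutativeRing heytingCommutativeRing

  open RawSemiringDefs (Semiring.rawSemiring (CommutativeRing.semiring commutativeRing)) public
    using (_^_; sum) renaming (_×_ to _·_)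

  field
    characteristicZero : ∀ n → .{{NonZero n}} → (n · 1#) # 0#
    -- x ^ (n + 1) + Σ_{i ≤ n} aᵢ x ^ i has a root
    algebraicallyClosed :
      ∀ n (a : Fin (ℕ.suc n) → Carrier) →
      ∃[ x ] x ^ ℕ.suc n + sum (λ i → a i * x ^ toℕ i) ≈ 0#

  1/ℕ : ∀ n → .{{NonZero n}} → Carrier
  1/ℕ n = proj₁ (#⇒invertible (characteristicZero n))

module _ {c ℓ} (R : CommutativeRing c ℓ) where
  open CommutativeRing R

  record Unit : Set (c ⊔ ℓ) where
    field
      value        : Carrier
      value⁻¹      : Carrier
      isReciprocal : value * value⁻¹ ≈ 1#

  unitGroup : AbelianGroup (c ⊔ ℓ) ℓ
  unitGroup = record
    { Carrier = Unit
    ; _≈_     = λ u v → value u ≈ value v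
    ; _∙_     = λ u v → record
        { value        = value u * value v
        ; value⁻¹      = value⁻¹ u * value⁻¹ v
        ; isReciprocal = trans (interchange _ _ _ _)
            (trans (*-cong (isReciprocal u) (isReciprocal v)) (*-identityˡ 1#))
        }
    ; ε       = record { value = 1# ; value⁻¹ = 1# ; isReciprocal = *-identityˡ 1# }
    ; _⁻¹     = λ u → record
        { value        = value⁻¹ u
        ; value⁻¹      = value u
        ; isReciprocal = trans (*-comm _ _) (isReciprocal u)
        }
    ; isAbelianGroup = record
        { isGroup = record
            { isMonoid = record
                { isSemigroup = record
                    { isMagma = record
                        { isEquivalence = record { refl = refl ; sym = sym ; trans = trans }
                        ; ∙-cong        = *-cong
                        }
                    ; assoc = λ _ _ _ → *-assoc _ _ _
                    }
                ; identity = (λ _ → *-identityˡ _) , (λ _ → *-identityʳ _)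
                }
            ; inverse = (λ u → trans (*-comm _ _) (isReciprocal u)) , isReciprocal
            ; ⁻¹-cong = λ {u} {v} → reciprocal-cong u v
            }
        ; comm = λ _ _ → *-comm _ _
        }
    }
    where
    open Unit
    open CommutativeSemigroupProperties *-commutativeSemigroup using (interchange)
    open SetoidReasoning setoid

    reciprocal-cong : ∀ u v → value u ≈ value v → value⁻¹ u ≈ value⁻¹ v
    reciprocal-cong u v u≈v = begin
      value⁻¹ u                           ≈⟨ *-identityʳ _ ⟨
      value⁻¹ u * 1#                      ≈⟨ *-congˡ (isReciprocal v) ⟨
      value⁻¹ u * (value v * value⁻¹ v)   ≈⟨ *-assoc _ _ _ ⟨
      (value⁻¹ u * value v) * value⁻¹ v   ≈⟨ *-congʳ (*-congˡ u≈v) ⟨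
      (value⁻¹ u * value u) * value⁻¹ v   ≈⟨ *-congʳ (*-comm _ _) ⟩
      (value u * value⁻¹ u) * value⁻¹ v   ≈⟨ *-congʳ (isReciprocal u) ⟩
      1# * value⁻¹ v                      ≈⟨ *-identityˡ _ ⟩
      value⁻¹ v                           ∎

-- Homomorphisms G → H under pointwise multiplication.
module _ {a ℓa b ℓb} (G : AbelianGroup a ℓa) (H : AbelianGroup b ℓb) where
  private
    module G = AbelianGroup G
    module H = AbelianGroup H
  open AbelianGroupProperties H using (⁻¹-∙-comm; ε⁻¹≈ε)
  open CommutativeSemigroupProperties H.commutativeSemigroup using (interchange)

  private
    Hom : Set (a ⊔ ℓa ⊔ b ⊔ ℓb)
    Hom = GroupHomomorphism G.rawGroup H.rawGroup
    open GroupHomomorphism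

    hom : (f : G.Carrier → H.Carrier) →
          (∀ {x y} → x G.≈ y → f x H.≈ f y) →
          (∀ x y → f (x G.∙ y) H.≈ f x H.∙ f y) →
          f G.ε H.≈ H.ε →
          (∀ x → f (x G.⁻¹) H.≈ f x H.⁻¹) → Hom
    hom f f-cong f-∙ f-ε f-⁻¹ = record
      { ⟦_⟧ = f
      ; isGroupHomomorphism = record
          { isMonoidHomomorphism = record
              { isMagmaHomomorphism = record
                  { isRelHomomorphism = record { cong = f-cong }
                  ; homo = f-∙
                  }
              ; ε-homo = f-ε
              }
          ; ⁻¹-homo = f-⁻¹
          }
      }

  homGroup : AbelianGroup (a ⊔ ℓa ⊔ b ⊔ ℓb) (a ⊔ ℓb)
  homGroup = record
    { Carrier = Hom
    ; _≈_     = λ f g → ∀ x → ⟦ f ⟧ x H.≈ ⟦ g ⟧ x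
    ; _∙_     = λ f g → hom (λ x → ⟦ f ⟧ x H.∙ ⟦ g ⟧ x)
        (λ x≈y → H.∙-cong (⟦⟧-cong f x≈y) (⟦⟧-cong g x≈y))
        (λ x y → H.trans (H.∙-cong (homo f x y) (homo g x y)) (interchange _ _ _ _))
        (H.trans (H.∙-cong (ε-homo f) (ε-homo g)) (H.identityˡ H.ε))
        (λ x → H.trans (H.∙-cong (⁻¹-homo f x) (⁻¹-homo g x)) (⁻¹-∙-comm _ _))
    ; ε       = hom (λ _ → H.ε) (λ _ → H.refl)
        (λ _ _ → H.sym (H.identityˡ H.ε)) H.refl (λ _ → H.sym ε⁻¹≈ε)
    ; _⁻¹     = λ f → hom (λ x → ⟦ f ⟧ x H.⁻¹)
        (λ x≈y → H.⁻¹-cong (⟦⟧-cong f x≈y))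
        (λ x y → H.trans (H.⁻¹-cong (homo f x y)) (H.sym (⁻¹-∙-comm _ _)))
        (H.trans (H.⁻¹-cong (ε-homo f)) ε⁻¹≈ε)
        (λ x → H.⁻¹-cong (⁻¹-homo f x))
    ; isAbelianGroup = record
        { isGroup = record
            { isMonoid = record
                { isSemigroup = record
                    { isMagma = record
                        { isEquivalence = record
                            { refl  = λ _ → H.refl
                            ; sym   = λ f≈g x → H.sym (f≈g x)
                            ; trans = λ f≈g g≈h x → H.trans (f≈g x) (g≈h x)
                            }
                        ; ∙-cong = λ f≈f′ g≈g′ x → H.∙-cong (f≈f′ x) (g≈g′ x)
                        }
                    ; assoc = λ _ _ _ _ → H.assoc _ _ _
                    }
                ; identity = (λ _ _ → H.identityˡ _) , (λ _ _ → H.identityʳ _)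
                }
            ; inverse = (λ _ _ → H.inverseˡ _) , (λ _ _ → H.inverseʳ _)
            ; ⁻¹-cong = λ f≈g x → H.⁻¹-cong (f≈g x)
            }
        ; comm = λ _ _ _ → H.comm _ _
        }
    }

module Characters {c ℓ k ℓ₁ ℓ₂} (𝔽 : FiniteField c ℓ)
                  (K : AlgebraicallyClosedField₀ k ℓ₁ ℓ₂) where
  private
    module F = FiniteField 𝔽
    module K = AlgebraicallyClosedField₀ K

  characterGroup : AbelianGroup (c ⊔ ℓ ⊔ k ⊔ ℓ₁) (c ⊔ ℓ ⊔ ℓ₁)
  characterGroup = homGroup (unitGroup F.commutativeRing) (unitGroup K.commutativeRing)

  open AbelianGroup characterGroup public using ()
    renaming (Carrier to Character; _≈_ to _≈χ_; _∙_ to _∙χ_; ε to ε; _⁻¹ to _⁻¹χ)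

  infixr 8 _^χ_
  _^χ_ : Character → ℕ → Character
  χ ^χ n = RawMonoidDefs._×_ (AbelianGroup.rawMonoid characterGroup) n χ

  _^ℤ_ : Character → ℤ → Character
  χ ^ℤ (+ n)    = χ ^χ n
  χ ^ℤ -[1+ n ] = (χ ^χ ℕ.suc n) ⁻¹χ

  IsGenerator : Character → Set (c ⊔ ℓ ⊔ k ⊔ ℓ₁)
  IsGenerator T = ∀ χ → ∃[ n ] χ ≈χ (T ^ℤ n)

  -- The quadratic character is the unique character of order 2.
  IsQuadratic : Character → Set (c ⊔ ℓ ⊔ ℓ₁)
  IsQuadratic φ = ¬ (φ ≈χ ε) × (φ ∙χ φ) ≈χ ε

  -- The value χ(x) of the extension of χ to all of the field, χ(0) = 0.
  -- This applies to the trivial character as well.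
  infix 9 _⟨_⟩
  _⟨_⟩ : Character → F.Carrier → K.Carrier
  χ ⟨ x ⟩ with x F.≟ F.0#
  ... | yes _  = K.0#
  ... | no x≉0 = Unit.value (GroupHomomorphism.⟦_⟧ χ (record
    { value        = x
    ; value⁻¹      = proj₁ (F.reciprocal x x≉0)
    ; isReciprocal = proj₂ (F.reciprocal x x≉0)
    }))

  sumOver𝔽 : (F.Carrier → K.Carrier) → K.Carrier
  sumOver𝔽 f = K.sum (λ i → f (F.element i))

  syntax sumOver𝔽 (λ x → t) = ∑[ x ∈𝔽] t

  ψ₁₁₁ : Character → F.Carrier → F.Carrier → F.Carrier → K.Carrier
  ψ₁₁₁ φ a b c = ∑[ x ∈𝔽] (φ ⟨ x F.+ a ⟩ K.* φ ⟨ x F.+ b ⟩ K.* φ ⟨ x F.+ c ⟩)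

  -- Greene's ₂F₁ with upper parameters A, B and lower parameter C.
  ₂F₁ : (A B C : Character) → F.Carrier → K.Carrier
  ₂F₁ A B C x =
    ε ⟨ x ⟩ K.* ((B ∙χ C) ⟨ F.- F.1# ⟩ K.* K.1/ℕ F.order {{F.order-nonZero}}) K.*
    (∑[ y ∈𝔽] (B ⟨ y ⟩ K.* ((B ⁻¹χ) ∙χ C) ⟨ F.1# F.- y ⟩ K.* (A ⁻¹χ) ⟨ F.1# F.- x F.* y ⟩))

-- Put φ = α³ and ω = α⁴ for the character α = T^((q-1)/6), and D(w) = w³ - 3w.  Centring
-- at the critical point h and rescaling turns x ↦ (x+a)(x+b)(x+c) into D(w) + 2 - 4X up
-- to a square times d/3, where X is the argument of the hypergeometric series.
--
-- Replacing y by 1/y, the hypergeometric sum becomes Σ α(R(y)) with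
-- R(y) = y(y-1)/(y-X), and R(y) = u is a quadratic equation for y; counting its roots
-- gives Σ ω(u) G(u + 1/u) with G(z) = φ(z + 2 - 4X).
--
-- Since 1 + ω(u) + ω(u)² counts the cube roots v of u, v³ + 1/v³ = D(v + 1/v), and
-- 1 + φ(w²-4) counts the v with v + 1/v = w, twice that sum equals
-- Σ (1 + φ(w²-4)) (G(D(w)) - G(w)).  As -3 is a square, D permutes the w for which
-- w²-4 is a nonsquare, and D fixes ±2, so Σ (1 - φ(w²-4)) (G(D(w)) - G(w)) = 0.  Adding
-- the two and using Σ G(w) = 0 leaves Σ ω(u) G(u + 1/u) = Σ G(D(w)).
--
-- That α(g) is a primitive sixth root of unity for a generator g of the unit group uses
-- that the unit group is cyclic: then some character takes at g a value whose
-- ((q-1)/6)th power is a primitive sixth root of unity, and it is a power of T.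
module Submission where

import Algebra.Apartness.Properties.HeytingCommutativeRing
open import Algebra.Bundles using (CommutativeRing; AbelianGroup)
open import Algebra.Morphism.Bundles using (GroupHomomorphism)
import Algebra.Properties.AbelianGroup
import Algebra.Properties.CommutativeSemiring.Exp
import Algebra.Properties.Group
import Algebra.Properties.Ring
import Algebra.Properties.Semiring.Mult
import Algebra.Properties.Semiring.Sum
import Algebra.Solver.Ring
open import Algebra.Solver.Ring.AlmostCommutativeRing using (fromCommutativeRing; _-Raw-AlmostCommutative⟶_)
open import Data.Fin.Base as Fin using (Fin; toℕ; zero; suc)
open import Data.Fin.Permutation using (Permutation′; permutation)
import Data.Fin.Properties as Fin
open import Data.Integer.Base as ℤ using (ℤ; +_; -[1+_]; _⊖_)
import Data.Integer.Properties as ℤ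
open import Data.List.Base using ([]; _∷_)
open import Data.List.Relation.Unary.All using (All; []; _∷_)
open import Data.Maybe.Base using (Maybe; just; nothing)
open import Data.Nat.Base as ℕ using (ℕ; zero; suc; NonZero; _!)
open import Data.Nat.Coprimality using (Coprime; coprime-Bézout; prime⇒coprime)
open import Data.Nat.DivMod as ℕ using (_/_; _%_)
open import Data.Nat.Divisibility as ℕ using (_∣_; _∤_; _∣?_; divides)
open import Data.Nat.GCD using (module Bézout)
open import Data.Nat.ListAction using (product)
open import Data.Nat.Primality using (Prime; prime⇒irreducible; prime⇒nonZero)
open import Data.Nat.Primality.Factorisation using (factorise)
import Data.Nat.Properties as ℕ
open import Data.Nat.Tactic.RingSolver using (solve-∀)
open import Data.Product using (∃; ∃-syntax; _×_; _,_; proj₁; proj₂; ∃₂)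
open import Data.Sum using (_⊎_; inj₁; inj₂)
open import Data.Vec.Base using (Vec; []; _∷_; replicate)
open import Defs
open import Function.Base using (_∘_)
open import Function.Bundles using (Inverse)
open import Function.Definitions using (Injective)
open import Level using (_⊔_)
open import Relation.Binary.Core using (_Preserves_⟶_)
open import Relation.Binary.Definitions using (tri<; tri≈; tri>; _Respects_)
open import Relation.Binary.PropositionalEquality as ≡ using (_≡_; _≢_)
import Relation.Binary.Reasoning.Setoid
open import Relation.Nullary using (¬_; Dec; yes; no; contradiction)
open import Relation.Nullary.Decidable using (map′; ¬?; _×-dec_)
open import Relation.Unary using (Pred; Decidable)

-- The constants come from `D(w) + 2 = (w-1)²(w+2)`: placing the critical point `h` at `w = 1`
-- absorbs the quadratic term into the scale `d/3` and leaves only the value `e` of the cubic at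
-- `h`, which is `-4X` after division by `(d/3)³`. On the hypergeometric side, the same `2 - 4X` is
-- what remains of the discriminant of the quadratic for `y` once a factor `u` is taken out. The
-- prefactors agree because `α(-1)` is its own inverse: `BC(-1) = α(-1) = φ(-1)` cancels the sign in
-- `φ(-3d)`, and `φ(3d) = φ(d/3)`. Distinctness of `a`, `b`, `c` enters through `X ≠ 0` and `X ≠ 1`,
-- the two values at which `R` degenerates. The obstacle is the value field, where equality is not
-- decidable. Everything about `α` is therefore derived from the single equation `t² - t + 1 = 0`
-- for `t = α(g)`; case distinctions are made in the finite field, or in the value field by
-- cotransitivity of apartness.

-- Integer constants for polynomial identities in a commutative ring.

module IntegerCoefficients {c ℓ} (R : CommutativeRing c ℓ) where
  open CommutativeRing R
  open Algebra.Properties.Ring ring using (-‿distribˡ-*; -‿distribʳ-*; -0#≈0#; -‿involutive)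
  open Algebra.Properties.AbelianGroup +-abelianGroup using (⁻¹-∙-comm)
  open Algebra.Properties.Semiring.Mult semiring using (×-homo-+; ×1-homo-*) renaming (_×_ to _·_)
  open Relation.Binary.Reasoning.Setoid setoid

  -- Unlike _· 1#, this sends 1 to 1# definitionally, so that the constant 1 of the
  -- solver is 1#.
  fromℕ : ℕ → Carrier
  fromℕ zero          = 0#
  fromℕ (suc zero)    = 1#
  fromℕ (suc (suc n)) = 1# + fromℕ (suc n)

  fromℤ : ℤ → Carrier
  fromℤ (+ n)    = fromℕ n
  fromℤ -[1+ n ] = - fromℕ (suc n)

  fromℕ≈· : ∀ n → fromℕ n ≈ n · 1#
  fromℕ≈· zero          = refl
  fromℕ≈· (suc zero)    = sym (+-identityʳ 1#)
  fromℕ≈· (suc (suc n)) = +-congˡ (fromℕ≈· (suc n))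

  fromℕ-suc : ∀ n → fromℕ (suc n) ≈ 1# + fromℕ n
  fromℕ-suc zero    = sym (+-identityʳ 1#)
  fromℕ-suc (suc n) = refl

  fromℕ-+ : ∀ m n → fromℕ (m ℕ.+ n) ≈ fromℕ m + fromℕ n
  fromℕ-+ m n = begin
    fromℕ (m ℕ.+ n)   ≈⟨ fromℕ≈· (m ℕ.+ n) ⟩
    (m ℕ.+ n) · 1#    ≈⟨ ×-homo-+ 1# m n ⟩
    m · 1# + n · 1#   ≈⟨ +-cong (fromℕ≈· m) (fromℕ≈· n) ⟨
    fromℕ m + fromℕ n ∎

  fromℕ-* : ∀ m n → fromℕ (m ℕ.* n) ≈ fromℕ m * fromℕ n
  fromℕ-* m n = begin
    fromℕ (m ℕ.* n)       ≈⟨ fromℕ≈· (m ℕ.* n) ⟩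
    (m ℕ.* n) · 1#        ≈⟨ ×1-homo-* m n ⟩
    (m · 1#) * (n · 1#)   ≈⟨ *-cong (fromℕ≈· m) (fromℕ≈· n) ⟨
    fromℕ m * fromℕ n     ∎

  fromℤ-⊖ : ∀ m n → fromℤ (m ⊖ n) ≈ fromℕ m - fromℕ n
  fromℤ-⊖ m zero = sym (trans (+-congˡ -0#≈0#) (+-identityʳ _))
  fromℤ-⊖ zero (suc n) = sym (+-identityˡ _)
  fromℤ-⊖ (suc m) (suc n) = begin
    fromℤ (suc m ⊖ suc n)                   ≡⟨ ≡.cong fromℤ (ℤ.[1+m]⊖[1+n]≡m⊖n m n) ⟩
    fromℤ (m ⊖ n)                           ≈⟨ fromℤ-⊖ m n ⟩
    fromℕ m - fromℕ n                       ≈⟨ +-congˡ (+-identityˡ _) ⟨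
    fromℕ m + (0# - fromℕ n)                ≈⟨ +-congˡ (+-congʳ (-‿inverseʳ 1#)) ⟨
    fromℕ m + ((1# - 1#) - fromℕ n)         ≈⟨ +-congˡ (+-assoc _ _ _) ⟩
    fromℕ m + (1# + (- 1# - fromℕ n))       ≈⟨ +-assoc _ _ _ ⟨
    (fromℕ m + 1#) + (- 1# - fromℕ n)       ≈⟨ +-cong (+-comm _ _) (⁻¹-∙-comm _ _) ⟩
    (1# + fromℕ m) - (1# + fromℕ n)         ≈⟨ +-cong (fromℕ-suc m) (-‿cong (fromℕ-suc n)) ⟨
    fromℕ (suc m) - fromℕ (suc n)           ∎

  fromℤ-+ : ∀ i j → fromℤ (i ℤ.+ j) ≈ fromℤ i + fromℤ j
  fromℤ-+ (+ m)    (+ n)    = fromℕ-+ m n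
  fromℤ-+ (+ m)    -[1+ n ] = fromℤ-⊖ m (suc n)
  fromℤ-+ -[1+ m ] (+ n)    = trans (fromℤ-⊖ n (suc m)) (+-comm _ _)
  fromℤ-+ -[1+ m ] -[1+ n ] = begin
    - fromℕ (suc (suc (m ℕ.+ n)))     ≡⟨ ≡.cong (λ k → - fromℕ k) (≡.cong suc (ℕ.+-suc m n)) ⟨
    - fromℕ (suc m ℕ.+ suc n)         ≈⟨ -‿cong (fromℕ-+ (suc m) (suc n)) ⟩
    - (fromℕ (suc m) + fromℕ (suc n)) ≈⟨ ⁻¹-∙-comm _ _ ⟨
    - fromℕ (suc m) - fromℕ (suc n)   ∎
    where import Data.Nat.Properties as ℕ

  fromℤ-neg : ∀ i → fromℤ (ℤ.- i) ≈ - fromℤ i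
  fromℤ-neg (+ zero)    = sym -0#≈0#
  fromℤ-neg (+ (suc n)) = refl
  fromℤ-neg -[1+ n ]    = sym (-‿involutive _)

  fromℤ-*-pos : ∀ m j → fromℤ (+ m ℤ.* j) ≈ fromℕ m * fromℤ j
  fromℤ-*-pos m (+ n) = begin
    fromℤ (+ m ℤ.* + n) ≡⟨ ≡.cong fromℤ (ℤ.pos-* m n) ⟨
    fromℕ (m ℕ.* n)     ≈⟨ fromℕ-* m n ⟩
    fromℕ m * fromℕ n   ∎
  fromℤ-*-pos m -[1+ n ] = begin
    fromℤ (+ m ℤ.* -[1+ n ])          ≡⟨ ≡.cong fromℤ (ℤ.neg-distribʳ-* (+ m) (+ suc n)) ⟨
    fromℤ (ℤ.- (+ m ℤ.* + suc n))     ≈⟨ fromℤ-neg (+ m ℤ.* + suc n) ⟩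
    - fromℤ (+ m ℤ.* + suc n)         ≈⟨ -‿cong (fromℤ-*-pos m (+ suc n)) ⟩
    - (fromℕ m * fromℕ (suc n))       ≈⟨ -‿distribʳ-* _ _ ⟩
    fromℕ m * - fromℕ (suc n)         ∎

  fromℤ-* : ∀ i j → fromℤ (i ℤ.* j) ≈ fromℤ i * fromℤ j
  fromℤ-* (+ m)    j = fromℤ-*-pos m j
  fromℤ-* -[1+ m ] j = begin
    fromℤ (-[1+ m ] ℤ.* j)        ≡⟨ ≡.cong fromℤ (ℤ.neg-distribˡ-* (+ suc m) j) ⟨
    fromℤ (ℤ.- (+ suc m ℤ.* j))   ≈⟨ fromℤ-neg (+ suc m ℤ.* j) ⟩
    - fromℤ (+ suc m ℤ.* j)       ≈⟨ -‿cong (fromℤ-*-pos (suc m) j) ⟩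
    - (fromℕ (suc m) * fromℤ j)   ≈⟨ -‿distribˡ-* _ _ ⟩
    (- fromℕ (suc m)) * fromℤ j   ∎

  morphism : ℤ.+-*-rawRing -Raw-AlmostCommutative⟶ fromCommutativeRing R
  morphism = record
    { ⟦_⟧    = fromℤ
    ; +-homo = fromℤ-+
    ; *-homo = fromℤ-*
    ; -‿homo = fromℤ-neg
    ; 0-homo = refl
    ; 1-homo = refl
    }

  -- A one-sided test suffices: in positive characteristic distinct integers may have equal images,
  -- but the solver only has to recognise coefficients that agree as integers.
  fromℤ-≟ : ∀ i j → Maybe (fromℤ i ≈ fromℤ j)
  fromℤ-≟ i j with i ℤ.≟ j
  ... | yes i≡j = just (reflexive (≡.cong fromℤ i≡j))
  ... | no  _   = nothing

  open Algebra.Solver.Ring ℤ.+-*-rawRing (fromCommutativeRing R) morphism fromℤ-≟ public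
    using (Polynomial; con; solve; _:=_; _:+_; _:*_; _:-_; :-_; _:^_; _:×_)

  :#_ : ∀ {n} → ℕ → Polynomial n
  :# n = con (+ n)

Coprime-prime : ∀ {p n} → Prime p → p ∤ n → Coprime p n
Coprime-prime p-prime p∤n (d∣p , d∣n) with prime⇒irreducible p-prime d∣p
... | inj₁ d≡1 = d≡1
... | inj₂ d≡p = contradiction (≡.subst (_∣ _) d≡p d∣n) p∤n

-- Pigeonhole: a missed value could be prepended to `f`, giving an injection of `Fin (suc n)` into
-- `Fin n`.
injective⇒surjective : ∀ {n} {f : Fin n → Fin n} → Injective _≡_ _≡_ f → ∀ i → ∃[ j ] f j ≡ i
injective⇒surjective {n} {f} f-inj i with Fin.any? (λ j → f j Fin.≟ i)
... | yes hit = hit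
... | no miss = contradiction (Fin.injective⇒≤ f′-inj) ℕ.1+n≰n
  where
  f′ : Fin (suc n) → Fin n
  f′ zero    = i
  f′ (suc j) = f j
  f′-inj : Injective _≡_ _≡_ f′
  f′-inj {zero}  {zero}  _  = ≡.refl
  f′-inj {zero}  {suc k} eq = contradiction (k , ≡.sym eq) miss
  f′-inj {suc j} {zero}  eq = contradiction (j , eq) miss
  f′-inj {suc j} {suc k} eq = ≡.cong suc (f-inj eq)

-- Arithmetic of a finite field and the bound on the number of roots of a polynomial.

module FiniteFieldProperties {c ℓ} (𝔽 : FiniteField c ℓ) where
  open FiniteField 𝔽 hiding (zero)
  open Algebra.Properties.Group +-group public using ()
    renaming (x∙y⁻¹≈ε⇒x≈y to x-y≈0⇒x≈y; x≈y⇒x∙y⁻¹≈ε to x≈y⇒x-y≈0; ∙-cancelʳ to +-cancelʳ)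
  open Algebra.Properties.CommutativeSemiring.Exp commutativeSemiring
    using (^-homo-*; ^-assocʳ; ^-distrib-*; ^-congˡ; ^-congʳ) public
  open IntegerCoefficients commutativeRing
  open Relation.Binary.Reasoning.Setoid setoid

  1≉0 : 1# ≉ 0#
  1≉0 = 0≉1 ∘ sym

  -- 0# ⁻¹ is 0#.
  infix 8 _⁻¹
  _⁻¹ : Carrier → Carrier
  x ⁻¹ = 1# ÷ x

  ÷-cancelʳ : ∀ x {y} → y ≉ 0# → (x ÷ y) * y ≈ x
  ÷-cancelʳ x {y} y≉0 with y ≟ 0#
  ... | yes y≈0 = contradiction y≈0 y≉0
  ... | no y≉0′ = begin
    x * proj₁ (reciprocal y y≉0′) * y   ≈⟨ *-assoc _ _ _ ⟩
    x * (proj₁ (reciprocal y y≉0′) * y) ≈⟨ *-congˡ (trans (*-comm _ _) (proj₂ (reciprocal y y≉0′))) ⟩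
    x * 1#                              ≈⟨ *-identityʳ x ⟩
    x                                   ∎

  ⁻¹-inverseˡ : ∀ {x} → x ≉ 0# → x ⁻¹ * x ≈ 1#
  ⁻¹-inverseˡ = ÷-cancelʳ 1#

  ⁻¹-inverseʳ : ∀ {x} → x ≉ 0# → x * x ⁻¹ ≈ 1#
  ⁻¹-inverseʳ x≉0 = trans (*-comm _ _) (⁻¹-inverseˡ x≉0)

  *-cancelˡ-≉0 : ∀ {x y z} → x ≉ 0# → x * y ≈ x * z → y ≈ z
  *-cancelˡ-≉0 {x} {y} {z} x≉0 xy≈xz = begin
    y               ≈⟨ *-identityˡ y ⟨
    1# * y          ≈⟨ *-congʳ (⁻¹-inverseˡ x≉0) ⟨
    x ⁻¹ * x * y    ≈⟨ *-assoc _ _ _ ⟩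
    x ⁻¹ * (x * y)  ≈⟨ *-congˡ xy≈xz ⟩
    x ⁻¹ * (x * z)  ≈⟨ *-assoc _ _ _ ⟨
    x ⁻¹ * x * z    ≈⟨ *-congʳ (⁻¹-inverseˡ x≉0) ⟩
    1# * z          ≈⟨ *-identityˡ z ⟩
    z               ∎

  x≉0∧xy≈0⇒y≈0 : ∀ {x y} → x ≉ 0# → x * y ≈ 0# → y ≈ 0#
  x≉0∧xy≈0⇒y≈0 x≉0 xy≈0 = *-cancelˡ-≉0 x≉0 (trans xy≈0 (sym (zeroʳ _)))

  xy≈0⇒x≈0⊎y≈0 : ∀ {x y} → x * y ≈ 0# → x ≈ 0# ⊎ y ≈ 0#
  xy≈0⇒x≈0⊎y≈0 {x} xy≈0 with x ≟ 0#
  ... | yes x≈0 = inj₁ x≈0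
  ... | no  x≉0 = inj₂ (x≉0∧xy≈0⇒y≈0 x≉0 xy≈0)

  *-≉0 : ∀ {x y} → x ≉ 0# → y ≉ 0# → x * y ≉ 0#
  *-≉0 x≉0 y≉0 = y≉0 ∘ x≉0∧xy≈0⇒y≈0 x≉0

  x*y≈1⇒x≉0 : ∀ {x y} → x * y ≈ 1# → x ≉ 0#
  x*y≈1⇒x≉0 xy≈1 x≈0 = 0≉1 (trans (sym (zeroˡ _)) (trans (*-congʳ (sym x≈0)) xy≈1))

  ⁻¹-unique : ∀ {x y} → x * y ≈ 1# → y ≈ x ⁻¹
  ⁻¹-unique xy≈1 = *-cancelˡ-≉0 x≉0 (trans xy≈1 (sym (⁻¹-inverseʳ x≉0)))
    where x≉0 = x*y≈1⇒x≉0 xy≈1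

  x≈0⇒x⁻¹≈0 : ∀ {x} → x ≈ 0# → x ⁻¹ ≈ 0#
  x≈0⇒x⁻¹≈0 {x} x≈0 with x ≟ 0#
  ... | yes _  = refl
  ... | no x≉0 = contradiction x≈0 x≉0

  ⁻¹-cong : ∀ {x y} → x ≈ y → x ⁻¹ ≈ y ⁻¹
  ⁻¹-cong {x} {y} x≈y = by-cases (x ≟ 0#)
    where
    -- A separate function instead of a `with`: abstracting `x ≟ 0#` would also replace the test
    -- inside `x ⁻¹`, and the lemmas about `x ⁻¹` would no longer match the goal.
    by-cases : Dec (x ≈ 0#) → x ⁻¹ ≈ y ⁻¹
    by-cases (yes x≈0) = trans (x≈0⇒x⁻¹≈0 x≈0) (sym (x≈0⇒x⁻¹≈0 (trans (sym x≈y) x≈0)))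
    by-cases (no  x≉0) = ⁻¹-unique (trans (*-congʳ (sym x≈y)) (⁻¹-inverseʳ x≉0))

  ⁻¹-involutive : ∀ x → (x ⁻¹) ⁻¹ ≈ x
  ⁻¹-involutive x = by-cases (x ≟ 0#)
    where
    by-cases : Dec (x ≈ 0#) → (x ⁻¹) ⁻¹ ≈ x
    by-cases (yes x≈0) = trans (x≈0⇒x⁻¹≈0 (x≈0⇒x⁻¹≈0 x≈0)) (sym x≈0)
    by-cases (no  x≉0) = sym (⁻¹-unique (⁻¹-inverseˡ x≉0))

  -- Thanks to the value 0 at 0, inversion is a permutation of the whole field, and so a legitimate
  -- substitution in sums over it.
  ⁻¹-injective : Injective _≈_ _≈_ _⁻¹
  ⁻¹-injective {x} {y} x⁻¹≈y⁻¹ = trans (sym (⁻¹-involutive x)) (trans (⁻¹-cong x⁻¹≈y⁻¹) (⁻¹-involutive y))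

  ⁻¹-distrib-* : ∀ x y → (x * y) ⁻¹ ≈ x ⁻¹ * y ⁻¹
  ⁻¹-distrib-* x y = by-cases (x ≟ 0#) (y ≟ 0#)
    where
    by-cases : Dec (x ≈ 0#) → Dec (y ≈ 0#) → (x * y) ⁻¹ ≈ x ⁻¹ * y ⁻¹
    by-cases (yes x≈0) _ = trans (x≈0⇒x⁻¹≈0 (trans (*-congʳ x≈0) (zeroˡ y)))
                                 (sym (trans (*-congʳ (x≈0⇒x⁻¹≈0 x≈0)) (zeroˡ _)))
    by-cases (no _) (yes y≈0) = trans (x≈0⇒x⁻¹≈0 (trans (*-congˡ y≈0) (zeroʳ x)))
                                      (sym (trans (*-congˡ (x≈0⇒x⁻¹≈0 y≈0)) (zeroʳ _)))
    by-cases (no x≉0) (no y≉0) = sym (⁻¹-unique (begin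
      x * y * (x ⁻¹ * y ⁻¹)     ≈⟨ solve 4 (λ x y i j → x :* y :* (i :* j) := (x :* i) :* (y :* j)) refl x y (x ⁻¹) (y ⁻¹) ⟩
      (x * x ⁻¹) * (y * y ⁻¹)   ≈⟨ *-cong (⁻¹-inverseʳ x≉0) (⁻¹-inverseʳ y≉0) ⟩
      1# * 1#                   ≈⟨ *-identityˡ 1# ⟩
      1#                        ∎))

  ^-≉0 : ∀ {x} → x ≉ 0# → ∀ n → x ^ n ≉ 0#
  ^-≉0 x≉0 zero    = 1≉0
  ^-≉0 x≉0 (suc n) = *-≉0 x≉0 (^-≉0 x≉0 n)

  x^n≈1⇒x≉0 : ∀ {x} n → .{{NonZero n}} → x ^ n ≈ 1# → x ≉ 0#
  x^n≈1⇒x≉0 (suc n) = x*y≈1⇒x≉0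

  1^n≈1 : ∀ n → 1# ^ n ≈ 1#
  1^n≈1 zero    = refl
  1^n≈1 (suc n) = trans (*-identityˡ _) (1^n≈1 n)

  x^m≈1⇒x^km≈1 : ∀ {x} k m → x ^ m ≈ 1# → x ^ (k ℕ.* m) ≈ 1#
  x^m≈1⇒x^km≈1 {x} k m x^m≈1 = begin
    x ^ (k ℕ.* m) ≡⟨ ≡.cong (x ^_) (ℕ.*-comm k m) ⟩
    x ^ (m ℕ.* k) ≈⟨ ^-assocʳ x m k ⟨
    (x ^ m) ^ k   ≈⟨ ^-congˡ k x^m≈1 ⟩
    1# ^ k        ≈⟨ 1^n≈1 k ⟩
    1#            ∎

  x^m≈1∧m∣n⇒x^n≈1 : ∀ {x m n} → x ^ m ≈ 1# → m ∣ n → x ^ n ≈ 1#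
  x^m≈1∧m∣n⇒x^n≈1 {m = m} x^m≈1 (divides k ≡.refl) = x^m≈1⇒x^km≈1 k m x^m≈1

  ^-∸-≈1 : ∀ {x m n} → x ≉ 0# → m ℕ.≤ n → x ^ m ≈ x ^ n → x ^ (n ℕ.∸ m) ≈ 1#
  ^-∸-≈1 {x} {m} {n} x≉0 m≤n x^m≈x^n = *-cancelˡ-≉0 (^-≉0 x≉0 m) (begin
    x ^ m * x ^ (n ℕ.∸ m) ≈⟨ ^-homo-* x m (n ℕ.∸ m) ⟨
    x ^ (m ℕ.+ (n ℕ.∸ m)) ≡⟨ ≡.cong (x ^_) (ℕ.m+[n∸m]≡n m≤n) ⟩
    x ^ n                 ≈⟨ x^m≈x^n ⟨
    x ^ m                 ≈⟨ *-identityʳ _ ⟨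
    x ^ m * 1#            ∎)

  any? : ∀ {p} {P : Pred Carrier p} → P Respects _≈_ → Decidable P → Dec (∃ P)
  any? {P = P} resp P? = map′ (λ (i , p) → element i , p)
    (λ (x , p) → index x , resp (sym (Inverse.strictlyInverseʳ enumeration x)) p)
    (Fin.any? (P? ∘ element))

  index-injective : ∀ {x y} → index x ≡ index y → x ≈ y
  index-injective {x} {y} eq = begin
    x                 ≈⟨ Inverse.strictlyInverseʳ enumeration x ⟨
    element (index x) ≡⟨ ≡.cong element eq ⟩
    element (index y) ≈⟨ Inverse.strictlyInverseʳ enumeration y ⟩
    y                 ∎

  -- Monic polynomials of degree m, given by their lower coefficients.
  evalMonic : ∀ {m} → Vec Carrier m → Carrier → Carrier
  evalMonic []       x = 1#
  evalMonic (a ∷ as) x = a + x * evalMonic as x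

  -- Synthetic division: the coefficients of the quotient are the Horner values at `r` of the
  -- successive tails.
  evalMonic-division : ∀ {m} (as : Vec Carrier (suc m)) r → ∃[ bs ] ∀ x →
                       evalMonic as x ≈ (x - r) * evalMonic {m} bs x + evalMonic as r
  evalMonic-division (a ∷ []) r = [] , λ x →
    solve 3 (λ a r x → a :+ x :* :# 1 := (x :- r) :* :# 1 :+ (a :+ r :* :# 1)) refl a r x
  evalMonic-division (a ∷ as@(_ ∷ _)) r with bs , eq ← evalMonic-division as r =
    evalMonic as r ∷ bs , λ x → begin
      a + x * evalMonic as x
        ≈⟨ +-congˡ (*-congˡ (eq x)) ⟩
      a + x * ((x - r) * evalMonic bs x + evalMonic as r)
        ≈⟨ solve 5 (λ a r x u v → a :+ x :* ((x :- r) :* u :+ v)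
             := (x :- r) :* (v :+ x :* u) :+ (a :+ r :* v)) refl a r x _ _ ⟩
      (x - r) * (evalMonic as r + x * evalMonic bs x) + (a + r * evalMonic as r) ∎

  -- Induction on the degree: after division by `x - r zero`, the remaining points differ from
  -- `r zero` and are therefore roots of the quotient.
  evalMonic-roots : ∀ {m} (as : Vec Carrier m) (r : Fin (suc m) → Carrier) →
                    Injective _≡_ _≈_ r → ¬ (∀ i → evalMonic as (r i) ≈ 0#)
  evalMonic-roots []            r r-inj root = 1≉0 (root zero)
  evalMonic-roots as@(_ ∷ _) r r-inj root with bs , eq ← evalMonic-division as (r zero) =
    evalMonic-roots bs (r ∘ suc) (Fin.suc-injective ∘ r-inj) λ i →
      x≉0∧xy≈0⇒y≈0
        (λ d≈0 → contradiction (r-inj {suc i} {zero} (x-y≈0⇒x≈y _ _ d≈0)) λ ())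
        (begin
          (r (suc i) - r zero) * evalMonic bs (r (suc i))                           ≈⟨ +-identityʳ _ ⟨
          (r (suc i) - r zero) * evalMonic bs (r (suc i)) + 0#                      ≈⟨ +-congˡ (root zero) ⟨
          (r (suc i) - r zero) * evalMonic bs (r (suc i)) + evalMonic as (r zero)   ≈⟨ eq _ ⟨
          evalMonic as (r (suc i))                                                  ≈⟨ root (suc i) ⟩
          0#                                                                        ∎)

  evalMonic-replicate : ∀ m x → evalMonic (replicate m 0#) x ≈ x ^ m
  evalMonic-replicate zero    x = refl
  evalMonic-replicate (suc m) x = trans (+-identityˡ _) (*-congˡ (evalMonic-replicate m x))

  roots-of-unity-bound : ∀ m .{{_ : NonZero m}} (r : Fin (suc m) → Carrier) →
                         Injective _≡_ _≈_ r → ¬ (∀ i → r i ^ m ≈ 1#)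
  roots-of-unity-bound (suc m) r r-inj root =
    evalMonic-roots (- 1# ∷ replicate m 0#) r r-inj λ i → begin
      - 1# + r i * evalMonic (replicate m 0#) (r i) ≈⟨ +-congˡ (*-congˡ (evalMonic-replicate m (r i))) ⟩
      - 1# + r i ^ suc m                            ≈⟨ +-congˡ (root i) ⟩
      - 1# + 1#                                     ≈⟨ -‿inverseˡ 1# ⟩
      0#                                            ∎

-- Cyclicity of the unit group.

module PrimitiveRoots {c ℓ} (𝔽 : FiniteField c ℓ) where
  open FiniteField 𝔽 hiding (zero) renaming (order to q)
  open FiniteFieldProperties 𝔽
  open Relation.Binary.Reasoning.Setoid setoid

  coprime-exponents : ∀ {z a b} → Coprime a b → z ^ a ≈ 1# → z ^ b ≈ 1# → z ≈ 1#
  coprime-exponents {z} {a} {b} coprime z^a≈1 z^b≈1 with coprime-Bézout coprime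
  ... | Bézout.+- x y eq = begin
    z                   ≈⟨ *-identityʳ z ⟨
    z * 1#              ≈⟨ *-congˡ (x^m≈1⇒x^km≈1 y b z^b≈1) ⟨
    z ^ suc (y ℕ.* b)   ≡⟨ ≡.cong (z ^_) eq ⟩
    z ^ (x ℕ.* a)       ≈⟨ x^m≈1⇒x^km≈1 x a z^a≈1 ⟩
    1#                  ∎
  ... | Bézout.-+ x y eq = begin
    z                   ≈⟨ *-identityʳ z ⟨
    z * 1#              ≈⟨ *-congˡ (x^m≈1⇒x^km≈1 x a z^a≈1) ⟨
    z ^ suc (x ℕ.* a)   ≡⟨ ≡.cong (z ^_) eq ⟩
    z ^ (y ℕ.* b)       ≈⟨ x^m≈1⇒x^km≈1 y b z^b≈1 ⟩
    1#                  ∎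

  ^-*-^ : ∀ x a b s t → (x ^ a) ^ s * (x ^ b) ^ t ≈ x ^ (a ℕ.* s ℕ.+ b ℕ.* t)
  ^-*-^ x a b s t = begin
    (x ^ a) ^ s * (x ^ b) ^ t       ≈⟨ *-cong (^-assocʳ x a s) (^-assocʳ x b t) ⟩
    x ^ (a ℕ.* s) * x ^ (b ℕ.* t)   ≈⟨ ^-homo-* x (a ℕ.* s) (b ℕ.* t) ⟨
    x ^ (a ℕ.* s ℕ.+ b ℕ.* t)       ∎

  -- Bézout writes 1 as `ua - vb` or `vb - ua`. The negative coefficient is made a natural number by
  -- replacing `-v` with `v(a-1)`, or `-u` with `u(b-1)`, which changes the exponent of `y` by a
  -- multiple of `ab`.
  coprime-decomposition : ∀ {a b} → Coprime a b → .{{NonZero a}} → .{{NonZero b}} →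
                          ∀ {y} → y ^ (a ℕ.* b) ≈ 1# → ∃₂ λ s t → (y ^ a) ^ s * (y ^ b) ^ t ≈ y
  coprime-decomposition {a@(suc a′)} {b@(suc b′)} coprime {y} y^ab≈1
    with coprime-Bézout coprime
  ... | Bézout.+- u v eq = u , v ℕ.* a′ , (begin
    (y ^ a) ^ u * (y ^ b) ^ (v ℕ.* a′)    ≈⟨ ^-*-^ y a b u (v ℕ.* a′) ⟩
    y ^ (a ℕ.* u ℕ.+ b ℕ.* (v ℕ.* a′))    ≡⟨ ≡.cong (λ e → y ^ (e ℕ.+ b ℕ.* (v ℕ.* a′)))
                                               (≡.trans (ℕ.*-comm a u) (≡.sym eq)) ⟩
    y ^ (suc (v ℕ.* b) ℕ.+ b ℕ.* (v ℕ.* a′)) ≡⟨ ≡.cong (y ^_) (arith v a′ b) ⟩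
    y ^ suc (v ℕ.* (a ℕ.* b))             ≈⟨ *-congˡ (x^m≈1⇒x^km≈1 v (a ℕ.* b) y^ab≈1) ⟩
    y * 1#                                ≈⟨ *-identityʳ y ⟩
    y                                     ∎)
    where
    arith : ∀ v a b → suc (v ℕ.* b) ℕ.+ b ℕ.* (v ℕ.* a) ≡ suc (v ℕ.* (suc a ℕ.* b))
    arith = solve-∀
  ... | Bézout.-+ u v eq = u ℕ.* b′ , v , (begin
    (y ^ a) ^ (u ℕ.* b′) * (y ^ b) ^ v    ≈⟨ ^-*-^ y a b (u ℕ.* b′) v ⟩
    y ^ (a ℕ.* (u ℕ.* b′) ℕ.+ b ℕ.* v)    ≡⟨ ≡.cong (λ e → y ^ (a ℕ.* (u ℕ.* b′) ℕ.+ e))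
                                               (≡.trans (ℕ.*-comm b v) (≡.sym eq)) ⟩
    y ^ (a ℕ.* (u ℕ.* b′) ℕ.+ suc (u ℕ.* a)) ≡⟨ ≡.cong (y ^_) (arith u a b′) ⟩
    y ^ suc (u ℕ.* (a ℕ.* b))             ≈⟨ *-congˡ (x^m≈1⇒x^km≈1 u (a ℕ.* b) y^ab≈1) ⟩
    y * 1#                                ≈⟨ *-identityʳ y ⟩
    y                                     ∎)
    where
    arith : ∀ u a b → a ℕ.* (u ℕ.* b) ℕ.+ suc (u ℕ.* a) ≡ suc (u ℕ.* (a ℕ.* suc b))
    arith = solve-∀

  _IsPowerOf_ : Carrier → Carrier → Set ℓ
  x IsPowerOf g = ∃[ k ] x ≈ g ^ k

  -- The `d`th roots of unity that lie in the field form a cyclic group, however few they are.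
  -- Asking for no element of exact order `d` makes the notion true for every nonzero `d`, so that
  -- it can be proved by induction on prime factors.
  CyclicRoots : ℕ → Set _
  CyclicRoots d = ∃[ g ] g ^ d ≈ 1# × (∀ x → x ^ d ≈ 1# → x IsPowerOf g)

  -- Equal powers would give `z ^ (j ∸ i) ≈ 1#` with a positive exponent below `p`, hence coprime to
  -- `p`.
  powers-distinct : ∀ {p z} → Prime p → z ^ p ≈ 1# → z ≉ 1# → ∀ {i j} → i ℕ.< j → j ℕ.< p → z ^ i ≉ z ^ j
  powers-distinct {p} {z} p-prime z^p≈1 z≉1 {i} {j} i<j j<p z^i≈z^j =
    z≉1 (coprime-exponents
      (prime⇒coprime p-prime (ℕ.≤-<-trans (ℕ.m∸n≤m j i) j<p))
      z^p≈1
      (^-∸-≈1 (x^n≈1⇒x≉0 p z^p≈1) (ℕ.<⇒≤ i<j) z^i≈z^j))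
    where instance
      _ = prime⇒nonZero p-prime
      _ = ℕ.>-nonZero (ℕ.m<n⇒0<n∸m i<j)

  -- Either 1 is the only `p`th root of unity, or some `z ≉ 1#` has `p` distinct powers; a root
  -- outside these would be one root too many for `x ^ p - 1`.
  cyclicRoots-prime : ∀ {p} → Prime p → CyclicRoots p
  cyclicRoots-prime {p} p-prime
    with any? (λ z≈z′ (z≉1 , z^p≈1) → z≉1 ∘ trans z≈z′ , trans (^-congˡ p (sym z≈z′)) z^p≈1)
              (λ z → ¬? (z ≟ 1#) ×-dec (z ^ p ≟ 1#))
  ... | no ∄ = 1# , 1^n≈1 p , λ x x^p≈1 → 0 , x≈1 x x^p≈1 (x ≟ 1#)
    where
    x≈1 : ∀ x → x ^ p ≈ 1# → Dec (x ≈ 1#) → x ≈ 1#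
    x≈1 x x^p≈1 (yes x≈1) = x≈1
    x≈1 x x^p≈1 (no  x≉1) = contradiction (x , x≉1 , x^p≈1) ∄
  ... | yes (z , z≉1 , z^p≈1) = z , z^p≈1 , power
    where
    instance _ = prime⇒nonZero p-prime

    power : ∀ y → y ^ p ≈ 1# → y IsPowerOf z
    power y y^p≈1 with Fin.any? (λ (i : Fin p) → y ≟ z ^ toℕ i)
    ... | yes (i , y≈z^i) = toℕ i , y≈z^i
    ... | no  ∄ = contradiction root (roots-of-unity-bound p r r-injective)
      where
      r : Fin (suc p) → Carrier
      r zero    = y
      r (suc i) = z ^ toℕ i

      root : ∀ i → r i ^ p ≈ 1#
      root zero    = y^p≈1
      root (suc i) = begin
        (z ^ toℕ i) ^ p   ≈⟨ ^-assocʳ z (toℕ i) p ⟩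
        z ^ (toℕ i ℕ.* p) ≈⟨ x^m≈1⇒x^km≈1 (toℕ i) p z^p≈1 ⟩
        1#                ∎

      r-injective : Injective _≡_ _≈_ r
      r-injective {zero}  {zero}  _ = ≡.refl
      r-injective {zero}  {suc j} y≈z^j = contradiction (j , y≈z^j) ∄
      r-injective {suc i} {zero}  z^i≈y = contradiction (i , sym z^i≈y) ∄
      r-injective {suc i} {suc j} z^i≈z^j with ℕ.<-cmp (toℕ i) (toℕ j)
      ... | tri< i<j _ _ = contradiction z^i≈z^j (powers-distinct p-prime z^p≈1 z≉1 i<j (Fin.toℕ<n j))
      ... | tri≈ _ i≡j _ = ≡.cong suc (Fin.toℕ-injective i≡j)
      ... | tri> _ _ j<i = contradiction (sym z^i≈z^j) (powers-distinct p-prime z^p≈1 z≉1 j<i (Fin.toℕ<n i))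

  -- The `p`th and `d`th powers of `g * z` are `g ^ p` and `z ^ d`, from which Bézout recovers `g`
  -- and `z`. A general `y` is likewise recovered from `y ^ p`, a power of `g`, and `y ^ d`, a power
  -- of `z`.
  cyclicRoots-coprime : ∀ {p d} .{{_ : NonZero p}} .{{_ : NonZero d}} → Coprime p d →
                        CyclicRoots p → CyclicRoots d → CyclicRoots (p ℕ.* d)
  cyclicRoots-coprime {p} {d} coprime (z , z^p≈1 , z-gen) (g , g^d≈1 , g-gen) =
    g * z , trans (^-distrib-* g z (p ℕ.* d)) (trans (*-cong g^pd≈1 z^pd≈1) (*-identityˡ 1#)) , power
    where
    g^pd≈1 : g ^ (p ℕ.* d) ≈ 1#
    g^pd≈1 = x^m≈1⇒x^km≈1 p d g^d≈1
    z^pd≈1 : z ^ (p ℕ.* d) ≈ 1#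
    z^pd≈1 = x^m≈1∧m∣n⇒x^n≈1 {z} {p} z^p≈1 (ℕ.m∣m*n d)

    gz^p≈g^p : (g * z) ^ p ≈ g ^ p
    gz^p≈g^p = trans (^-distrib-* g z p) (trans (*-congˡ z^p≈1) (*-identityʳ _))
    gz^d≈z^d : (g * z) ^ d ≈ z ^ d
    gz^d≈z^d = trans (^-distrib-* g z d) (trans (*-congʳ g^d≈1) (*-identityˡ _))

    g-power : g IsPowerOf (g * z)
    g-power with s , t , eq ← coprime-decomposition coprime g^pd≈1 = p ℕ.* s , (begin
      g                         ≈⟨ eq ⟨
      (g ^ p) ^ s * (g ^ d) ^ t ≈⟨ *-congˡ (trans (^-congˡ t g^d≈1) (1^n≈1 t)) ⟩
      (g ^ p) ^ s * 1#          ≈⟨ *-identityʳ _ ⟩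
      (g ^ p) ^ s               ≈⟨ ^-congˡ s gz^p≈g^p ⟨
      ((g * z) ^ p) ^ s         ≈⟨ ^-assocʳ (g * z) p s ⟩
      (g * z) ^ (p ℕ.* s)       ∎)

    z-power : z IsPowerOf (g * z)
    z-power with s , t , eq ← coprime-decomposition coprime z^pd≈1 = d ℕ.* t , (begin
      z                         ≈⟨ eq ⟨
      (z ^ p) ^ s * (z ^ d) ^ t ≈⟨ *-congʳ (trans (^-congˡ s z^p≈1) (1^n≈1 s)) ⟩
      1# * (z ^ d) ^ t          ≈⟨ *-identityˡ _ ⟩
      (z ^ d) ^ t               ≈⟨ ^-congˡ t gz^d≈z^d ⟨
      ((g * z) ^ d) ^ t         ≈⟨ ^-assocʳ (g * z) d t ⟩
      (g * z) ^ (d ℕ.* t)       ∎)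

    power : ∀ y → y ^ (p ℕ.* d) ≈ 1# → y IsPowerOf (g * z)
    power y y^pd≈1
      with s , t , eq ← coprime-decomposition coprime y^pd≈1
         | i , y^p≈g^i ← g-gen (y ^ p) (trans (^-assocʳ y p d) y^pd≈1)
         | j , y^d≈z^j ← z-gen (y ^ d) (trans (^-assocʳ y d p) (trans (^-congʳ y (ℕ.*-comm d p)) y^pd≈1))
         | a , g≈h^a ← g-power
         | b , z≈h^b ← z-power
      = (a ℕ.* i) ℕ.* s ℕ.+ (b ℕ.* j) ℕ.* t , (begin
      y                                               ≈⟨ eq ⟨
      (y ^ p) ^ s * (y ^ d) ^ t                       ≈⟨ *-cong (^-congˡ s (power-of a i y^p≈g^i g≈h^a)) (^-congˡ t (power-of b j y^d≈z^j z≈h^b)) ⟩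
      ((g * z) ^ (a ℕ.* i)) ^ s * ((g * z) ^ (b ℕ.* j)) ^ t ≈⟨ ^-*-^ (g * z) (a ℕ.* i) (b ℕ.* j) s t ⟩
      (g * z) ^ ((a ℕ.* i) ℕ.* s ℕ.+ (b ℕ.* j) ℕ.* t) ∎)
      where
      power-of : ∀ {x y h} a i → x ≈ y ^ i → y ≈ h ^ a → x ≈ h ^ (a ℕ.* i)
      power-of {x} {y} {h} a i x≈y^i y≈h^a = begin
        x             ≈⟨ x≈y^i ⟩
        y ^ i         ≈⟨ ^-congˡ i y≈h^a ⟩
        (h ^ a) ^ i   ≈⟨ ^-assocʳ h a i ⟩
        h ^ (a ℕ.* i) ∎

  -- When p ∣ d, a pth root of a generator g of the dth roots of unity generates the
  -- (pd)th roots of unity; if g has no pth root, then g ^ k is a pth power only for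
  -- p ∣ k, and every (pd)th root of unity is already a dth root of unity.
  module _ {p d} (p-prime : Prime p) (p∣d : p ∣ d) .{{_ : NonZero d}} {g} (g^d≈1 : g ^ d ≈ 1#)
           (g-gen : ∀ x → x ^ d ≈ 1# → x IsPowerOf g) where
    private
      g≉0 : g ≉ 0#
      g≉0 = x^n≈1⇒x≉0 d g^d≈1

    quotient-of-pth-powers : ∀ {x y z} → x ≉ 0# → x ^ p * z ≈ y ^ p → (y * x ⁻¹) ^ p ≈ z
    quotient-of-pth-powers {x} {y} {z} x≉0 eq = *-cancelˡ-≉0 (^-≉0 x≉0 p) (begin
      x ^ p * (y * x ⁻¹) ^ p    ≈⟨ ^-distrib-* x (y * x ⁻¹) p ⟨
      (x * (y * x ⁻¹)) ^ p      ≈⟨ ^-congˡ p x[yx⁻¹]≈y ⟩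
      y ^ p                     ≈⟨ eq ⟨
      x ^ p * z                 ∎)
      where
      x[yx⁻¹]≈y : x * (y * x ⁻¹) ≈ y
      x[yx⁻¹]≈y = begin
        x * (y * x ⁻¹) ≈⟨ *-comm _ _ ⟩
        y * x ⁻¹ * x   ≈⟨ *-assoc _ _ _ ⟩
        y * (x ⁻¹ * x) ≈⟨ *-congˡ (⁻¹-inverseˡ x≉0) ⟩
        y * 1#         ≈⟨ *-identityʳ y ⟩
        y              ∎

    -- The quotient `y / x` is a `p`th root of unity, hence a `d`th one because `p ∣ d`, hence a
    -- power of `g`.
    power-of-generator : ∀ {x y} → x ≉ 0# → x ^ p ≈ y ^ p → ∃[ j ] y ≈ g ^ j * x
    power-of-generator {x} {y} x≉0 x^p≈y^p
      with j , yx⁻¹≈g^j ← g-gen (y * x ⁻¹)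
             (x^m≈1∧m∣n⇒x^n≈1 (quotient-of-pth-powers x≉0 (trans (*-identityʳ _) x^p≈y^p)) p∣d)
      = j , (begin
      y              ≈⟨ *-identityʳ y ⟨
      y * 1#         ≈⟨ *-congˡ (⁻¹-inverseˡ x≉0) ⟨
      y * (x ⁻¹ * x) ≈⟨ *-assoc _ _ _ ⟨
      y * x ⁻¹ * x   ≈⟨ *-congʳ yx⁻¹≈g^j ⟩
      g ^ j * x      ∎)

    cyclicRoots-root : ∀ {x} → x ^ p ≈ g → CyclicRoots (p ℕ.* d)
    cyclicRoots-root {x} x^p≈g = x , x^pd≈1 , power
      where
      instance _ = ℕ.m*n≢0 p d {{prime⇒nonZero p-prime}}
      x^pd≈1 : x ^ (p ℕ.* d) ≈ 1#
      x^pd≈1 = trans (sym (^-assocʳ x p d)) (trans (^-congˡ d x^p≈g) g^d≈1)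

      power : ∀ y → y ^ (p ℕ.* d) ≈ 1# → y IsPowerOf x
      power y y^pd≈1
        with k , y^p≈g^k ← g-gen (y ^ p) (trans (^-assocʳ y p d) y^pd≈1)
        with j , y≈g^jx^k ← power-of-generator {x ^ k} {y} (^-≉0 (x^n≈1⇒x≉0 (p ℕ.* d) x^pd≈1) k) (begin
               (x ^ k) ^ p    ≈⟨ ^-assocʳ x k p ⟩
               x ^ (k ℕ.* p)  ≈⟨ ^-congʳ x (ℕ.*-comm k p) ⟩
               x ^ (p ℕ.* k)  ≈⟨ ^-assocʳ x p k ⟨
               (x ^ p) ^ k    ≈⟨ ^-congˡ k x^p≈g ⟩
               g ^ k          ≈⟨ y^p≈g^k ⟨
               y ^ p          ∎)
        = p ℕ.* j ℕ.+ k , (begin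
        y                     ≈⟨ y≈g^jx^k ⟩
        g ^ j * x ^ k         ≈⟨ *-congʳ (^-congˡ j x^p≈g) ⟨
        (x ^ p) ^ j * x ^ k   ≈⟨ *-congʳ (^-assocʳ x p j) ⟩
        x ^ (p ℕ.* j) * x ^ k ≈⟨ ^-homo-* x (p ℕ.* j) k ⟨
        x ^ (p ℕ.* j ℕ.+ k)   ∎)

    cyclicRoots-noRoot : (∀ x → x ^ p ≉ g) → CyclicRoots (p ℕ.* d)
    cyclicRoots-noRoot no-root = g , x^m≈1⇒x^km≈1 p d g^d≈1 , power
      where
      power : ∀ y → y ^ (p ℕ.* d) ≈ 1# → y IsPowerOf g
      power y y^pd≈1 with g-gen (y ^ p) (trans (^-assocʳ y p d) y^pd≈1)
      ... | k , y^p≈g^k with p ∣? k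
      ...   | yes (divides l ≡.refl)
              with j , y≈g^j*g^l ← power-of-generator (^-≉0 g≉0 l) (trans (^-assocʳ g l p) (sym y^p≈g^k))
              = j ℕ.+ l , trans y≈g^j*g^l (sym (^-homo-* g j l))
      ...   | no  p∤k with coprime-Bézout (Coprime-prime p-prime p∤k)
      -- With `y ^ p ≈ g ^ k` and `1 + vk = up`, the element `g ^ u / y ^ v` is a `p`th root of `g`;
      -- the other Bézout case uses the inverse quotient.
      ...     | Bézout.+- u v eq = contradiction
                (quotient-of-pth-powers {y ^ v} {g ^ u} (^-≉0 y≉0 v) (begin
                  (y ^ v) ^ p * g       ≈⟨ *-congʳ y^vp≈g^vk ⟩
                  g ^ (v ℕ.* k) * g     ≈⟨ *-comm _ _ ⟩
                  g ^ suc (v ℕ.* k)     ≡⟨ ≡.cong (g ^_) eq ⟩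
                  g ^ (u ℕ.* p)         ≈⟨ ^-assocʳ g u p ⟨
                  (g ^ u) ^ p           ∎))
                (no-root _)
        where
        instance _ = ℕ.m*n≢0 p d {{prime⇒nonZero p-prime}}
        y≉0 : y ≉ 0#
        y≉0 = x^n≈1⇒x≉0 (p ℕ.* d) y^pd≈1
        y^vp≈g^vk : (y ^ v) ^ p ≈ g ^ (v ℕ.* k)
        y^vp≈g^vk = begin
          (y ^ v) ^ p     ≈⟨ ^-assocʳ y v p ⟩
          y ^ (v ℕ.* p)   ≈⟨ ^-congʳ y (ℕ.*-comm v p) ⟩
          y ^ (p ℕ.* v)   ≈⟨ ^-assocʳ y p v ⟨
          (y ^ p) ^ v     ≈⟨ ^-congˡ v y^p≈g^k ⟩
          (g ^ k) ^ v     ≈⟨ ^-assocʳ g k v ⟩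
          g ^ (k ℕ.* v)   ≈⟨ ^-congʳ g (ℕ.*-comm k v) ⟩
          g ^ (v ℕ.* k)   ∎
      ...     | Bézout.-+ u v eq = contradiction
                (quotient-of-pth-powers {g ^ u} {y ^ v} (^-≉0 g≉0 u) (begin
                  (g ^ u) ^ p * g       ≈⟨ *-comm _ _ ⟩
                  g * (g ^ u) ^ p       ≈⟨ *-congˡ (^-assocʳ g u p) ⟩
                  g ^ suc (u ℕ.* p)     ≡⟨ ≡.cong (g ^_) eq ⟩
                  g ^ (v ℕ.* k)         ≈⟨ ^-congʳ g (ℕ.*-comm v k) ⟩
                  g ^ (k ℕ.* v)         ≈⟨ ^-assocʳ g k v ⟨
                  (g ^ k) ^ v           ≈⟨ ^-congˡ v y^p≈g^k ⟨
                  (y ^ p) ^ v           ≈⟨ ^-assocʳ y p v ⟩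
                  y ^ (p ℕ.* v)         ≈⟨ ^-congʳ y (ℕ.*-comm p v) ⟩
                  y ^ (v ℕ.* p)         ≈⟨ ^-assocʳ y v p ⟨
                  (y ^ v) ^ p           ∎))
                (no-root _)

  cyclicRoots-product : ∀ {ps} → All Prime ps → NonZero (product ps) × CyclicRoots (product ps)
  cyclicRoots-product [] = _ , 1# , *-identityˡ 1# , λ x x¹≈1 → 0 , trans (sym (*-identityʳ x)) x¹≈1
  cyclicRoots-product {p ∷ ps} (p-prime ∷ ps-prime)
    with d≢0 , (g , g^d≈1 , g-gen) ← cyclicRoots-product ps-prime =
    ℕ.m*n≢0 p d , cyclic
    where
    d = product ps
    instance
      _ = d≢0
      _ = prime⇒nonZero p-prime
    cyclic : CyclicRoots (p ℕ.* d)
    cyclic with p ∣? d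
    ... | no p∤d = cyclicRoots-coprime (Coprime-prime p-prime p∤d) (cyclicRoots-prime p-prime) (g , g^d≈1 , g-gen)
    ... | yes p∣d with any? (λ x≈y x^p≈g → trans (^-congˡ p (sym x≈y)) x^p≈g) (λ x → x ^ p ≟ g)
    ...   | yes (x , x^p≈g) = cyclicRoots-root p-prime p∣d g^d≈1 g-gen x^p≈g
    ...   | no  ∄           = cyclicRoots-noRoot p-prime p∣d g^d≈1 g-gen (λ x x^p≈g → ∄ (x , x^p≈g))

  cyclicRoots : ∀ d → .{{NonZero d}} → CyclicRoots d
  cyclicRoots d with record { isFactorisation = d≡ ; factorsPrime = primes } ← factorise d =
    ≡.subst CyclicRoots (≡.sym d≡) (proj₂ (cyclicRoots-product primes))

  -- Pigeonhole on 0 and the `q` powers with exponents from 0 to `q - 1`. No power is 0, so two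
  -- powers collide; including 0 is what sharpens the bound to `k < q`.
  period : ∀ {x} → x ≉ 0# → ∃[ k ] NonZero k × k ℕ.< q × x ^ k ≈ 1#
  period {x} x≉0 = collision (Fin.pigeonhole (ℕ.n<1+n q) r)
    where
    r : Fin (suc q) → Fin q
    r zero    = index 0#
    r (suc i) = index (x ^ toℕ i)
    collision : ∃₂ (λ i j → i Fin.< j × r i ≡ r j) → ∃[ k ] NonZero k × k ℕ.< q × x ^ k ≈ 1#
    collision (zero , suc j , _ , eq) =
      contradiction (sym (index-injective eq)) (^-≉0 x≉0 (toℕ j))
    collision (suc i , suc j , ℕ.s<s i<j , eq) =
      toℕ j ℕ.∸ toℕ i , ℕ.>-nonZero (ℕ.m<n⇒0<n∸m i<j) ,
      ℕ.≤-<-trans (ℕ.m∸n≤m (toℕ j) (toℕ i)) (Fin.toℕ<n j) ,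
      ^-∸-≈1 x≉0 (ℕ.<⇒≤ i<j) (index-injective eq)

  record PrimitiveRoot : Set (c ⊔ ℓ) where
    field
      g         : Carrier
      generates : ∀ {x} → x ≉ 0# → x IsPowerOf g
      g^[q-1]≈1 : g ^ (q ℕ.∸ 1) ≈ 1#
      order     : ∀ {k} → g ^ k ≈ 1# → q ℕ.∸ 1 ∣ k
      q-1≢0     : NonZero (q ℕ.∸ 1)

    g≉0 : g ≉ 0#
    g≉0 = x^n≈1⇒x≉0 _ {{q-1≢0}} g^[q-1]≈1

  -- The order of every unit is less than q, so all units are (q !)th roots of unity.
  primitiveRoot : PrimitiveRoot
  primitiveRoot with g , g^q!≈1 , g-gen ← cyclicRoots (q !) {{q ℕ.!≢0}} = record
    { g = g
    ; generates = generates
    ; g^[q-1]≈1 = g^[q-1]≈1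
    ; order     = order
    ; q-1≢0     = q-1≢0
    }
    where
    g≉0 : g ≉ 0#
    g≉0 = x^n≈1⇒x≉0 (q !) {{q ℕ.!≢0}} g^q!≈1

    k∣k! : ∀ k → .{{NonZero k}} → k ∣ k !
    k∣k! (suc k) = ℕ.m∣m*n (k !)

    generates : ∀ {x} → x ≉ 0# → x IsPowerOf g
    generates {x} x≉0 with k , k≢0 , k<q , x^k≈1 ← period x≉0 =
      g-gen x (x^m≈1∧m∣n⇒x^n≈1 x^k≈1 (ℕ.∣-trans (k∣k! k {{k≢0}}) (ℕ.m≤n⇒m!∣n! (ℕ.<⇒≤ k<q))))

    -- If `g ^ k ≈ 1#`, an element is determined by being zero or by its exponent modulo `k`, which
    -- embeds the field into `Fin (suc k)`.
    q≤1+k : ∀ k → .{{NonZero k}} → g ^ k ≈ 1# → q ℕ.≤ suc k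
    q≤1+k k g^k≈1 = Fin.injective⇒≤ {f = code ∘ element} λ {i} {j} eq → ≡.trans
      (≡.sym (Inverse.strictlyInverseˡ enumeration i))
      (≡.trans (Inverse.to-cong enumeration
                 (trans (sym (decode-code (element i))) (trans (reflexive (≡.cong decode eq)) (decode-code (element j)))))
               (Inverse.strictlyInverseˡ enumeration j))
      where
      code : Carrier → Fin (suc k)
      code x with x ≟ 0#
      ... | yes _  = zero
      ... | no x≉0 = suc (Fin.fromℕ< (ℕ.m%n<n (proj₁ (generates x≉0)) k))

      decode : Fin (suc k) → Carrier
      decode zero    = 0#
      decode (suc i) = g ^ toℕ i

      decode-code : ∀ x → decode (code x) ≈ x
      decode-code x with x ≟ 0#
      ... | yes x≈0 = sym x≈0
      ... | no  x≉0 with l , x≈g^l ← generates x≉0 = begin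
        g ^ toℕ (Fin.fromℕ< (ℕ.m%n<n l k))    ≡⟨ ≡.cong (g ^_) (Fin.toℕ-fromℕ< (ℕ.m%n<n l k)) ⟩
        g ^ (l ℕ.% k)                         ≈⟨ *-identityʳ _ ⟨
        g ^ (l ℕ.% k) * 1#                    ≈⟨ *-congˡ (x^m≈1⇒x^km≈1 (l ℕ./ k) k g^k≈1) ⟨
        g ^ (l ℕ.% k) * g ^ (l ℕ./ k ℕ.* k)   ≈⟨ ^-homo-* g (l ℕ.% k) (l ℕ./ k ℕ.* k) ⟨
        g ^ (l ℕ.% k ℕ.+ l ℕ./ k ℕ.* k)       ≡⟨ ≡.cong (g ^_) (ℕ.m≡m%n+[m/n]*n l k) ⟨
        g ^ l                                 ≈⟨ x≈g^l ⟨
        x                                     ∎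

    -- The period `k` of `g` found by pigeonhole satisfies `k < q`, and the count of elements gives
    -- `q ≤ suc k`; so it is `q ∸ 1`.
    period-q-1 : NonZero (q ℕ.∸ 1) × g ^ (q ℕ.∸ 1) ≈ 1#
    period-q-1 with k , k≢0 , k<q , g^k≈1 ← period g≉0 = ≡.subst (λ m → NonZero m × g ^ m ≈ 1#)
      (ℕ.≤-antisym (ℕ.∸-monoˡ-≤ 1 k<q) (ℕ.∸-monoˡ-≤ {q} {suc k} 1 (q≤1+k k {{k≢0}} g^k≈1)))
      (k≢0 , g^k≈1)

    q-1≢0 : NonZero (q ℕ.∸ 1)
    q-1≢0 = proj₁ period-q-1

    g^[q-1]≈1 : g ^ (q ℕ.∸ 1) ≈ 1#
    g^[q-1]≈1 = proj₂ period-q-1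

    order : ∀ {k} → g ^ k ≈ 1# → q ℕ.∸ 1 ∣ k
    order {k} g^k≈1 = ℕ.m%n≡0⇒n∣m k n (remainder (k ℕ.% n) ≡.refl)
      where
      n = q ℕ.∸ 1
      instance _ = q-1≢0
      remainder : ∀ r → k ℕ.% n ≡ r → r ≡ 0
      remainder zero    _  = ≡.refl
      remainder (suc r) eq = contradiction (ℕ.∸-monoˡ-≤ {q} {suc (suc r)} 1 (q≤1+k (suc r) g^r≈1))
                                           (ℕ.<⇒≱ (≡.subst (ℕ._< n) eq (ℕ.m%n<n k n)))
        where
        g^r≈1 : g ^ suc r ≈ 1#
        g^r≈1 = begin
          g ^ suc r                             ≡⟨ ≡.cong (g ^_) eq ⟨
          g ^ (k ℕ.% n)                         ≈⟨ *-identityʳ _ ⟨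
          g ^ (k ℕ.% n) * 1#                    ≈⟨ *-congˡ (x^m≈1⇒x^km≈1 (k ℕ./ n) n g^[q-1]≈1) ⟨
          g ^ (k ℕ.% n) * g ^ (k ℕ./ n ℕ.* n)   ≈⟨ ^-homo-* g (k ℕ.% n) (k ℕ./ n ℕ.* n) ⟨
          g ^ (k ℕ.% n ℕ.+ k ℕ./ n ℕ.* n)       ≡⟨ ≡.cong (g ^_) (ℕ.m≡m%n+[m/n]*n k n) ⟨
          g ^ k                                 ≈⟨ g^k≈1 ⟩
          1#                                    ∎

-- Apartness and roots of unity in the value field.

module ValueFieldProperties {k ℓ₁ ℓ₂} (K : AlgebraicallyClosedField₀ k ℓ₁ ℓ₂) where
  open AlgebraicallyClosedField₀ K public
    using (commutativeRing; _#_; #-irrefl; #-sym; #-cotrans; #⇒invertible; characteristicZero; algebraicallyClosed; heytingCommutativeRing)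
  open CommutativeRing commutativeRing public hiding (zero)
  open IntegerCoefficients commutativeRing public
  open Algebra.Apartness.Properties.HeytingCommutativeRing heytingCommutativeRing public
    using (invertibleˡ⇒#; #-congʳ; #-congˡ)
  open Algebra.Properties.Group +-group public using ()
    renaming (x∙y⁻¹≈ε⇒x≈y to x-y≈0⇒x≈y; x≈y⇒x∙y⁻¹≈ε to x≈y⇒x-y≈0)
  open Algebra.Properties.CommutativeSemiring.Exp commutativeSemiring public
    using (_^_; ^-homo-*; ^-assocʳ; ^-distrib-*; ^-congˡ; ^-congʳ)
  open Algebra.Properties.Semiring.Sum semiring public
    using (sum; sum-cong-≋; sum-replicate-zero)
  open Relation.Binary.Reasoning.Setoid setoid

  ^-swap : ∀ x a b → (x ^ a) ^ b ≈ (x ^ b) ^ a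
  ^-swap x a b = trans (^-assocʳ x a b) (trans (^-congʳ x (ℕ.*-comm a b)) (sym (^-assocʳ x b a)))

  1^n≈1 : ∀ n → 1# ^ n ≈ 1#
  1^n≈1 zero    = refl
  1^n≈1 (suc n) = trans (*-identityˡ _) (1^n≈1 n)

  x#y∧[x-y]z≈0⇒z≈0 : ∀ {x y z} → x # y → (x - y) * z ≈ 0# → z ≈ 0#
  x#y∧[x-y]z≈0⇒z≈0 {x} {y} {z} x#y eq with i , i[x-y]≈1 , _ ← #⇒invertible x#y = begin
    z                 ≈⟨ *-identityˡ z ⟨
    1# * z            ≈⟨ *-congʳ i[x-y]≈1 ⟨
    i * (x - y) * z   ≈⟨ *-assoc _ _ _ ⟩
    i * ((x - y) * z) ≈⟨ *-congˡ eq ⟩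
    i * 0#            ≈⟨ zeroʳ i ⟩
    0#                ∎

  fromℕ#0 : ∀ n → .{{NonZero n}} → fromℕ n # 0#
  fromℕ#0 n = #-congʳ (sym (fromℕ≈· n)) (characteristicZero n)

  x#0∧xy≈0⇒y≈0 : ∀ {x y} → x # 0# → x * y ≈ 0# → y ≈ 0#
  x#0∧xy≈0⇒y≈0 {x} {y} x#0 xy≈0 = x#y∧[x-y]z≈0⇒z≈0 x#0
    (trans (solve 2 (λ x y → (x :- :# 0) :* y := x :* y) refl x y) xy≈0)

  fromℕ-*-cancelˡ : ∀ n → .{{NonZero n}} → ∀ {x y} → fromℕ n * x ≈ fromℕ n * y → x ≈ y
  fromℕ-*-cancelˡ n {x} {y} nx≈ny = x-y≈0⇒x≈y _ _ (x#0∧xy≈0⇒y≈0 (fromℕ#0 n) (begin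
    fromℕ n * (x - y)           ≈⟨ solve 3 (λ n x y → n :* (x :- y) := n :* x :- n :* y) refl (fromℕ n) x y ⟩
    fromℕ n * x - fromℕ n * y   ≈⟨ x≈y⇒x-y≈0 nx≈ny ⟩
    0#                          ∎))

  x-y≈z#0⇒x#y : ∀ {x y z} → x - y ≈ z → z # 0# → x # y
  x-y≈z#0⇒x#y {x} {y} {z} x-y≈z z#0 with i , i[z-0]≈1 , _ ← #⇒invertible z#0 = invertibleˡ⇒# (i , (begin
    i * (x - y)  ≈⟨ *-congˡ (trans x-y≈z (solve 1 (λ z → z := z :- :# 0) refl z)) ⟩
    i * (z - 0#) ≈⟨ i[z-0]≈1 ⟩
    1#           ∎))

  1#-1 : 1# # - 1#
  1#-1 = x-y≈z#0⇒x#y (solve 0 (:# 1 :- (:- :# 1) := :# 2) refl) (fromℕ#0 2)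

  1≉-1 : ¬ 1# ≈ - 1#
  1≉-1 1≈-1 = #-irrefl 1≈-1 1#-1

  -- Since 1 and -1 are apart, cotransitivity makes `x` apart from one of them; the corresponding
  -- factor of `x² - 1` is invertible and can be cancelled.
  x²≈1⇒x≈±1 : ∀ {x} → x * x ≈ 1# → x ≈ 1# ⊎ x ≈ - 1#
  x²≈1⇒x≈±1 {x} x²≈1 with #-cotrans 1#-1 x
  ... | inj₁ 1#x  = inj₂ (x-y≈0⇒x≈y _ _ (x#y∧[x-y]z≈0⇒z≈0 1#x (begin
    (1# - x) * (x - - 1#) ≈⟨ solve 1 (λ x → (:# 1 :- x) :* (x :- (:- :# 1)) := :# 1 :- x :* x) refl x ⟩
    1# - x * x            ≈⟨ x≈y⇒x-y≈0 (sym x²≈1) ⟩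
    0#                    ∎)))
  ... | inj₂ x#-1 = inj₁ (x-y≈0⇒x≈y _ _ (x#y∧[x-y]z≈0⇒z≈0 x#-1 (begin
    (x - - 1#) * (x - 1#) ≈⟨ solve 1 (λ x → (x :- (:- :# 1)) :* (x :- :# 1) := x :* x :- :# 1) refl x ⟩
    x * x - 1#            ≈⟨ x≈y⇒x-y≈0 x²≈1 ⟩
    0#                    ∎)))

  -- Cotransitivity leaves the case that `x ^ suc n` is apart from `x`. Then `x * (x ^ n - 1#)` is
  -- invertible, so `x ^ n` is apart from 1 and the induction goes on.
  x^n#1⇒x#1 : ∀ x n → x ^ n # 1# → x # 1#
  x^n#1⇒x#1 x zero    1#1 = contradiction 1#1 (#-irrefl refl)
  x^n#1⇒x#1 x (suc n) x^[1+n]#1 with #-cotrans x^[1+n]#1 x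
  ... | inj₂ x#1       = x#1
  ... | inj₁ x^[1+n]#x with i , eq , _ ← #⇒invertible x^[1+n]#x =
    x^n#1⇒x#1 x n (invertibleˡ⇒# (i * x , (begin
      i * x * (x ^ n - 1#)    ≈⟨ solve 3 (λ i x y → i :* x :* (y :- :# 1) := i :* (x :* y :- x)) refl i x (x ^ n) ⟩
      i * (x * x ^ n - x)     ≈⟨ eq ⟩
      1#                      ∎)))

  nthRoot : ∀ n → .{{NonZero n}} → ∀ a → ∃[ x ] x ^ n ≈ a
  nthRoot (suc n) a with x , eq ← algebraicallyClosed n (λ { zero → - a ; (suc _) → 0# }) =
    x , x-y≈0⇒x≈y _ _ (begin
      x ^ suc n - a                          ≈⟨ solve 2 (λ y a → y :- a := y :+ ((:- a) :* :# 1 :+ :# 0)) refl (x ^ suc n) a ⟩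
      x ^ suc n + (- a * 1# + 0#)            ≈⟨ +-congˡ (+-congˡ (sum-zero x)) ⟨
      x ^ suc n + (- a * 1# + sum (λ (i : Fin n) → 0# * x ^ suc (toℕ i)))   ≈⟨ eq ⟩
      0#                                     ∎)
    where
    sum-zero : ∀ x → sum (λ (i : Fin n) → 0# * x ^ suc (toℕ i)) ≈ 0#
    sum-zero x = trans (sum-cong-≋ {n} (λ i → zeroˡ _)) (sum-replicate-zero n)

  -- The sixth cyclotomic polynomial. In characteristic zero its roots are the elements of order
  -- exactly 6, so primitivity becomes an equation, without any inequality.
  IsPrimitiveSixthRoot : Carrier → Set ℓ₁
  IsPrimitiveSixthRoot w = w * w - w + 1# ≈ 0#

  primitiveSixthRoot : ∃ IsPrimitiveSixthRoot
  primitiveSixthRoot with x , eq ← algebraicallyClosed 1 (λ { zero → 1# ; (suc _) → - 1# }) =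
    x , trans (solve 1 (λ x → x :* x :- x :+ :# 1 :=
                 x :^ 2 :+ (:# 1 :* :# 1 :+ ((:- :# 1) :* (x :* :# 1) :+ :# 0))) refl x) eq

  module _ {w} (w-primitive : IsPrimitiveSixthRoot w) where

    w³≈-1 : w ^ 3 ≈ - 1#
    w³≈-1 = x-y≈0⇒x≈y _ _ (begin
      w ^ 3 - - 1#                  ≈⟨ solve 1 (λ w → w :^ 3 :- (:- :# 1) := (w :+ :# 1) :* (w :* w :- w :+ :# 1)) refl w ⟩
      (w + 1#) * (w * w - w + 1#)   ≈⟨ *-congˡ w-primitive ⟩
      (w + 1#) * 0#                 ≈⟨ zeroʳ _ ⟩
      0#                            ∎)

    w⁶≈1 : w ^ 6 ≈ 1#
    w⁶≈1 = begin
      w ^ 6           ≈⟨ solve 1 (λ w → w :^ 6 := w :^ 3 :* w :^ 3) refl w ⟩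
      w ^ 3 * w ^ 3   ≈⟨ *-cong w³≈-1 w³≈-1 ⟩
      - 1# * - 1#     ≈⟨ solve 0 ((:- :# 1) :* (:- :# 1) := :# 1) refl ⟩
      1#              ∎

    -- Modulo the cyclotomic polynomial, `- (w + 1#)` times `w ^ 2 - 1#` is 3, which is invertible.
    w²#1 : w ^ 2 # 1#
    w²#1 = invertibleˡ⇒# (i * - (w + 1#) , (begin
      i * - (w + 1#) * (w ^ 2 - 1#)     ≈⟨ solve 2 (λ i w → i :* (:- (w :+ :# 1)) :* (w :^ 2 :- :# 1)
                                             := i :* ((:# 3 :- :# 0) :- (w :+ :# 2) :* (w :* w :- w :+ :# 1))) refl i w ⟩
      i * ((fromℕ 3 - 0#) - (w + fromℕ 2) * (w * w - w + 1#))
                                        ≈⟨ *-congˡ (+-congˡ (-‿cong (trans (*-congˡ w-primitive) (zeroʳ _)))) ⟩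
      i * ((fromℕ 3 - 0#) - 0#)         ≈⟨ *-congˡ (solve 1 (λ x → x :- :# 0 := x) refl _) ⟩
      i * (fromℕ 3 - 0#)                ≈⟨ proj₁ (proj₂ inv) ⟩
      1#                                ∎))
      where
      inv = #⇒invertible (fromℕ#0 3)
      i = proj₁ inv

    base-#1 : ∀ {t} n → t ^ n ≈ w → t ^ 2 # 1#
    base-#1 {t} n t^n≈w = x^n#1⇒x#1 (t ^ 2) n (#-congʳ (begin
      w ^ 2        ≈⟨ ^-congˡ 2 t^n≈w ⟨
      (t ^ n) ^ 2  ≈⟨ ^-swap t n 2 ⟩
      (t ^ 2) ^ n  ∎) w²#1)

    -- Here `t ^ 3` is 1 or -1. The value 1 would force `w ^ 3 ≈ 1#`; the value -1 annihilates
    -- `(t² - 1)(t² - t + 1)`, whose first factor is invertible because `t ^ 2` has a power apart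
    -- from 1.
    primitiveSixthRoot-base : ∀ {t} n → t ^ 6 ≈ 1# → t ^ n ≈ w → IsPrimitiveSixthRoot t
    primitiveSixthRoot-base {t} n t⁶≈1 t^n≈w = by-cases (x²≈1⇒x≈±1 (trans (sym (^-homo-* t 3 3)) t⁶≈1))
      where
      by-cases : t ^ 3 ≈ 1# ⊎ t ^ 3 ≈ - 1# → IsPrimitiveSixthRoot t
      by-cases (inj₁ t³≈1)  = contradiction (begin
        1#            ≈⟨ trans (^-congˡ n t³≈1) (1^n≈1 n) ⟨
        (t ^ 3) ^ n   ≈⟨ ^-swap t 3 n ⟩
        (t ^ n) ^ 3   ≈⟨ ^-congˡ 3 t^n≈w ⟩
        w ^ 3         ≈⟨ w³≈-1 ⟩
        - 1#          ∎) 1≉-1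
      by-cases (inj₂ t³≈-1) = x#y∧[x-y]z≈0⇒z≈0 (base-#1 n t^n≈w) (begin
        (t ^ 2 - 1#) * (t * t - t + 1#)   ≈⟨ solve 1 (λ t → (t :^ 2 :- :# 1) :* (t :* t :- t :+ :# 1)
                                               := (t :- :# 1) :* (t :^ 3 :- (:- :# 1))) refl t ⟩
        (t - 1#) * (t ^ 3 - - 1#)         ≈⟨ *-congˡ (x≈y⇒x-y≈0 t³≈-1) ⟩
        (t - 1#) * 0#                     ≈⟨ zeroʳ _ ⟩
        0#                                ∎)

-- Sums over the finite field: substitution, indicator functions and fibres.

module Sums {c ℓ k ℓ₁ ℓ₂} (𝔽 : FiniteField c ℓ) (K : AlgebraicallyClosedField₀ k ℓ₁ ℓ₂) where
  private
    module F where
      open FiniteField 𝔽 public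
      open FiniteFieldProperties 𝔽 public
  open ValueFieldProperties K
  open Algebra.Properties.Semiring.Sum semiring
    using (∑-distrib-+; ∑-comm; sum-permute; *-distribˡ-sum; sum-remove)
  open Characters 𝔽 K using (sumOver𝔽)
  open Relation.Binary.Reasoning.Setoid setoid

  -- Opaque, so that the summand can be inferred from a sum.
  opaque
    ∑ : (F.Carrier → Carrier) → Carrier
    ∑ = sumOver𝔽

  syntax ∑ (λ x → t) = ∑[ x ] t

  opaque
    unfolding ∑

    ∑≈sumOver𝔽 : ∀ f → ∑ f ≈ sumOver𝔽 f
    ∑≈sumOver𝔽 f = refl

    ∑-cong : ∀ {f g : F.Carrier → Carrier} → (∀ x → f x ≈ g x) → ∑[ x ] f x ≈ ∑[ x ] g x
    ∑-cong f≈g = sum-cong-≋ {F.order} (f≈g ∘ F.element)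

    ∑-+ : ∀ (f g : F.Carrier → Carrier) → ∑[ x ] (f x + g x) ≈ ∑[ x ] f x + ∑[ x ] g x
    ∑-+ f g = ∑-distrib-+ (f ∘ F.element) (g ∘ F.element)

    ∑-*ˡ : ∀ a (f : F.Carrier → Carrier) → ∑[ x ] (a * f x) ≈ a * ∑[ x ] f x
    ∑-*ˡ a f = sym (*-distribˡ-sum a (f ∘ F.element))

    ∑-*ʳ : ∀ a (f : F.Carrier → Carrier) → ∑[ x ] (f x * a) ≈ (∑[ x ] f x) * a
    ∑-*ʳ a f = trans (∑-cong (λ x → *-comm (f x) a)) (trans (∑-*ˡ a f) (*-comm _ _))

    ∑-swap : ∀ (f : F.Carrier → F.Carrier → Carrier) →
             ∑[ x ] (∑[ y ] f x y) ≈ ∑[ y ] (∑[ x ] f x y)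
    ∑-swap f = ∑-comm (λ i j → f (F.element i) (F.element j))

    ∑-0 : ∑[ x ] 0# ≈ 0#
    ∑-0 = sum-replicate-zero F.order

    -- Injectivity is enough: transported to indices, `σ` is an injection of a finite set into
    -- itself, hence a permutation.
    ∑-substitution : ∀ {σ : F.Carrier → F.Carrier} {f : F.Carrier → Carrier} →
                     σ Preserves F._≈_ ⟶ F._≈_ → Injective F._≈_ F._≈_ σ → f Preserves F._≈_ ⟶ _≈_ →
                     ∑[ x ] f (σ x) ≈ ∑[ x ] f x
    ∑-substitution {σ} {f} σ-cong σ-inj f-cong = begin
      ∑[ x ] f (σ x)                              ≈⟨ ∑-cong (λ x → f-cong (F.sym (Inverse.strictlyInverseʳ F.enumeration (σ x)))) ⟩
      sum (λ i → f (F.element (π i)))               ≈⟨ sum-permute (f ∘ F.element) perm ⟨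
      ∑[ x ] f x                                  ∎
      where
      π : Fin F.order → Fin F.order
      π i = F.index (σ (F.element i))

      element-injective : ∀ {i j} → F.element i F.≈ F.element j → i ≡ j
      element-injective {i} {j} eq = ≡.trans (≡.sym (Inverse.strictlyInverseˡ F.enumeration i))
        (≡.trans (Inverse.to-cong F.enumeration eq) (Inverse.strictlyInverseˡ F.enumeration j))

      π-injective : Injective _≡_ _≡_ π
      π-injective eq = element-injective (σ-inj (F.index-injective eq))

      perm : Permutation′ F.order
      perm = permutation π (proj₁ ∘ surj) (proj₂ ∘ surj) (λ i → π-injective (proj₂ (surj (π i))))
        where
        surj : ∀ i → ∃[ j ] π j ≡ i
        surj = injective⇒surjective π-injective

  𝟙 : ∀ {p} {P : Set p} → Dec P → Carrier
  𝟙 (yes _) = 1#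
  𝟙 (no  _) = 0#

  𝟙-yes : ∀ {p} {P : Set p} (P? : Dec P) → P → 𝟙 P? ≈ 1#
  𝟙-yes (yes _) _ = refl
  𝟙-yes (no ¬p) p = contradiction p ¬p

  𝟙-no : ∀ {p} {P : Set p} (P? : Dec P) → ¬ P → 𝟙 P? ≈ 0#
  𝟙-no (yes p) ¬p = contradiction p ¬p
  𝟙-no (no _)  _  = refl

  𝟙-cong : ∀ {p q} {P : Set p} {Q : Set q} (P? : Dec P) (Q? : Dec Q) → (P → Q) → (Q → P) → 𝟙 P? ≈ 𝟙 Q?
  𝟙-cong (yes p) Q? P⇒Q Q⇒P = sym (𝟙-yes Q? (P⇒Q p))
  𝟙-cong (no ¬p) Q? P⇒Q Q⇒P = sym (𝟙-no Q? (¬p ∘ Q⇒P))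

  opaque
    unfolding ∑

    ∑-δ : ∀ {f : F.Carrier → Carrier} → f Preserves F._≈_ ⟶ _≈_ → ∀ a →
          ∑[ x ] (𝟙 (x F.≟ a) * f x) ≈ f a
    ∑-δ {f} f-cong a = sum-δ (F.index a) (λ i → 𝟙 (F.element i F.≟ a) * f (F.element i)) at-a off-a
      where
      at-a : 𝟙 (F.element (F.index a) F.≟ a) * f (F.element (F.index a)) ≈ f a
      at-a = trans (*-cong (𝟙-yes (_ F.≟ _) elem) (f-cong elem)) (*-identityˡ _)
        where
        elem : F.element (F.index a) F.≈ a
        elem = Inverse.strictlyInverseʳ F.enumeration a

      off-a : ∀ i → i ≢ F.index a → 𝟙 (F.element i F.≟ a) * f (F.element i) ≈ 0#
      off-a i i≢a = trans (*-congʳ (𝟙-no (_ F.≟ _) λ eq → i≢a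
        (≡.trans (≡.sym (Inverse.strictlyInverseˡ F.enumeration i)) (Inverse.to-cong F.enumeration eq)))) (zeroˡ _)

      sum-δ : ∀ {n} (i : Fin n) (t : Fin n → Carrier) {b} → t i ≈ b → (∀ j → j ≢ i → t j ≈ 0#) → sum t ≈ b
      sum-δ {suc n} i t {b} tᵢ≈b t≈0 = begin
        sum t                                       ≈⟨ sum-remove t ⟩
        t i + sum (λ j → t (Fin.punchIn i j))       ≈⟨ +-cong tᵢ≈b (sum-cong-≋ {n} (λ j → t≈0 _ (Fin.punchInᵢ≢i i j))) ⟩
        b + sum {n} (λ _ → 0#)                      ≈⟨ +-congˡ (sum-replicate-zero n) ⟩
        b + 0#                                      ≈⟨ +-identityʳ b ⟩
        b                                           ∎

  ∑-𝟙 : ∀ a → ∑[ x ] 𝟙 (x F.≟ a) ≈ 1#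
  ∑-𝟙 a = trans (∑-cong (λ x → sym (*-identityʳ _))) (∑-δ (λ _ → refl) a)

  -- Change of variable `u = P v`, with `N u` the weighted size of a fibre. The count is compared
  -- only after multiplication by `f u`, so it may be wrong where `f` vanishes, typically at 0.
  ∑-fibres : ∀ (h : F.Carrier → Carrier) (P : F.Carrier → F.Carrier) (N : F.Carrier → Carrier)
             {f : F.Carrier → Carrier} → f Preserves F._≈_ ⟶ _≈_ →
             (∀ u → (∑[ v ] (h v * 𝟙 (u F.≟ P v))) * f u ≈ N u * f u) →
             ∑[ v ] (h v * f (P v)) ≈ ∑[ u ] (N u * f u)
  ∑-fibres h P N {f} f-cong count = begin
    ∑[ v ] (h v * f (P v))                                    ≈⟨ ∑-cong (λ v → *-congˡ (∑-δ f-cong (P v))) ⟨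
    ∑[ v ] (h v * (∑[ u ] (𝟙 (u F.≟ P v) * f u)))           ≈⟨ ∑-cong (λ v → ∑-*ˡ (h v) _) ⟨
    ∑[ v ] (∑[ u ] (h v * (𝟙 (u F.≟ P v) * f u)))           ≈⟨ ∑-swap _ ⟩
    ∑[ u ] (∑[ v ] (h v * (𝟙 (u F.≟ P v) * f u)))           ≈⟨ ∑-cong (λ u → ∑-cong (λ v → *-assoc _ _ _)) ⟨
    ∑[ u ] (∑[ v ] (h v * 𝟙 (u F.≟ P v) * f u))             ≈⟨ ∑-cong (λ u → ∑-*ʳ (f u) _) ⟩
    ∑[ u ] ((∑[ v ] (h v * 𝟙 (u F.≟ P v))) * f u)           ≈⟨ ∑-cong count ⟩
    ∑[ u ] (N u * f u)                                        ∎

-- Cube roots of unity, squares, and the polynomial identities in the finite field.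

module SixthRootsOfUnity {c ℓ} (𝔽 : FiniteField c ℓ)
    (primitiveRoot : PrimitiveRoots.PrimitiveRoot 𝔽) (6∣q-1 : 6 ∣ FiniteField.order 𝔽 ℕ.∸ 1) where
  open FiniteField 𝔽 hiding (zero; order)
  open FiniteFieldProperties 𝔽
  open IntegerCoefficients commutativeRing
  open PrimitiveRoots.PrimitiveRoot primitiveRoot
  open Relation.Binary.Reasoning.Setoid setoid

  private
    m = ℕ.quotient 6∣q-1

    g^6m≈1 : g ^ (m ℕ.* 6) ≈ 1#
    g^6m≈1 = trans (^-congʳ g (≡.sym (_∣_.equality 6∣q-1))) g^[q-1]≈1

    g^jm≉1 : ∀ j → .{{NonZero j}} → j ℕ.< 6 → g ^ (m ℕ.* j) ≉ 1#
    g^jm≉1 j j<6 g^jm≈1 = ℕ.<⇒≱ j<6 (ℕ.∣⇒≤ (ℕ.*-cancelˡ-∣ m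
      (≡.subst (_∣ (m ℕ.* j)) (_∣_.equality 6∣q-1) (order g^jm≈1))))
      where
      m≢0 : ∀ m → NonZero (m ℕ.* 6) → NonZero m
      m≢0 (suc _) _ = _
      instance _ = m≢0 m (≡.subst NonZero (_∣_.equality 6∣q-1) q-1≢0)

  -- In characteristic 2 the only square root of 1 is 1, but `g ^ (m * 3)` with `m = (q-1)/6` is
  -- another.
  2≉0 : fromℕ 2 ≉ 0#
  2≉0 2≈0 with xy≈0⇒x≈0⊎y≈0 {h - 1#} {h + 1#} (begin
      (h - 1#) * (h + 1#) ≈⟨ solve 1 (λ h → (h :- :# 1) :* (h :+ :# 1) := h :* h :- :# 1) refl h ⟩
      h * h - 1#          ≈⟨ x≈y⇒x-y≈0 h²≈1 ⟩
      0#                  ∎)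
    where
    h = g ^ (m ℕ.* 3)
    h²≈1 : h * h ≈ 1#
    h²≈1 = begin
      h * h                       ≈⟨ ^-homo-* g (m ℕ.* 3) (m ℕ.* 3) ⟨
      g ^ (m ℕ.* 3 ℕ.+ m ℕ.* 3)   ≈⟨ ^-congʳ g (ℕ.*-distribˡ-+ m 3 3) ⟨
      g ^ (m ℕ.* 6)               ≈⟨ g^6m≈1 ⟩
      1#                          ∎
  ... | inj₁ h-1≈0 = g^jm≉1 3 (ℕ.s≤s (ℕ.s≤s (ℕ.s≤s (ℕ.s≤s ℕ.z≤n)))) (x-y≈0⇒x≈y _ _ h-1≈0)
  ... | inj₂ h+1≈0 = g^jm≉1 3 (ℕ.s≤s (ℕ.s≤s (ℕ.s≤s (ℕ.s≤s ℕ.z≤n)))) (begin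
      h                  ≈⟨ solve 1 (λ h → h := h :+ :# 1 :+ :# 1 :- :# 2) refl h ⟩
      h + 1# + 1# - fromℕ 2  ≈⟨ +-cong (+-congʳ h+1≈0) (-‿cong 2≈0) ⟩
      0# + 1# - 0#       ≈⟨ solve 0 (:# 0 :+ :# 1 :- :# 0 := :# 1) refl ⟩
      1#                 ∎)
    where h = g ^ (m ℕ.* 3)

  ρ : Carrier
  ρ = g ^ (m ℕ.* 2)

  ρ≉1 : ρ ≉ 1#
  ρ≉1 = g^jm≉1 2 (ℕ.s≤s (ℕ.s≤s (ℕ.s≤s ℕ.z≤n)))

  ρ²+ρ+1≈0 : ρ * ρ + ρ + 1# ≈ 0#
  ρ²+ρ+1≈0 = x≉0∧xy≈0⇒y≈0 (ρ≉1 ∘ x-y≈0⇒x≈y _ _) (begin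
    (ρ - 1#) * (ρ * ρ + ρ + 1#) ≈⟨ solve 1 (λ ρ → (ρ :- :# 1) :* (ρ :* ρ :+ ρ :+ :# 1) := ρ :^ 3 :- :# 1) refl ρ ⟩
    ρ ^ 3 - 1#                  ≈⟨ x≈y⇒x-y≈0 ρ³≈1 ⟩
    0#                          ∎)
    where
    ρ³≈1 : ρ ^ 3 ≈ 1#
    ρ³≈1 = trans (^-assocʳ g (m ℕ.* 2) 3) (trans (^-congʳ g (ℕ.*-assoc m 2 3)) g^6m≈1)

  -- In characteristic 3 the polynomial `ρ² + ρ + 1` is `(ρ - 1)²`, which would force `ρ ≈ 1#`.
  3≉0 : fromℕ 3 ≉ 0#
  3≉0 3≈0 with xy≈0⇒x≈0⊎y≈0 {ρ - 1#} {ρ - 1#} (begin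
    (ρ - 1#) * (ρ - 1#)               ≈⟨ solve 1 (λ ρ → (ρ :- :# 1) :* (ρ :- :# 1) := ρ :* ρ :+ ρ :+ :# 1 :- :# 3 :* ρ) refl ρ ⟩
    ρ * ρ + ρ + 1# - fromℕ 3 * ρ      ≈⟨ +-cong ρ²+ρ+1≈0 (-‿cong (*-congʳ 3≈0)) ⟩
    0# - 0# * ρ                       ≈⟨ solve 1 (λ ρ → :# 0 :- :# 0 :* ρ := :# 0) refl ρ ⟩
    0#                                ∎)
  ... | inj₁ eq = ρ≉1 (x-y≈0⇒x≈y _ _ eq)
  ... | inj₂ eq = ρ≉1 (x-y≈0⇒x≈y _ _ eq)

  -- The quadratic formula for `ρ² + ρ + 1 = 0` reads `ρ = (-1 + √-3)/2`.
  √-3 : Carrier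
  √-3 = fromℕ 2 * ρ + 1#

  √-3²≈-3 : √-3 * √-3 ≈ - fromℕ 3
  √-3²≈-3 = begin
    √-3 * √-3                                   ≈⟨ solve 1 (λ ρ → (:# 2 :* ρ :+ :# 1) :* (:# 2 :* ρ :+ :# 1)
                                                     := :# 4 :* (ρ :* ρ :+ ρ :+ :# 1) :- :# 3) refl ρ ⟩
    fromℕ 4 * (ρ * ρ + ρ + 1#) - fromℕ 3        ≈⟨ +-congʳ (trans (*-congˡ ρ²+ρ+1≈0) (zeroʳ _)) ⟩
    0# - fromℕ 3                                ≈⟨ +-identityˡ _ ⟩
    - fromℕ 3                                   ∎

  √-3≉0 : √-3 ≉ 0#
  √-3≉0 √-3≈0 = 3≉0 (begin
    fromℕ 3        ≈⟨ solve 1 (λ x → x := :- (:- x)) refl _ ⟩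
    - - fromℕ 3    ≈⟨ -‿cong √-3²≈-3 ⟨
    - (√-3 * √-3)  ≈⟨ -‿cong (trans (*-congʳ √-3≈0) (zeroˡ _)) ⟩
    - 0#           ≈⟨ solve 0 (:- :# 0 := :# 0) refl ⟩
    0#             ∎)

  -- D x is the cubic with D (v + v⁻¹) = v³ + v⁻³, and x is called nonsplit when
  -- x = v + v⁻¹ has no solution v.
  D : Carrier → Carrier
  D x = x * x * x - fromℕ 3 * x

  -- The discriminant of `v² - xv + 1`, whose roots are the solutions of `v + v⁻¹ = x`.
  Δ : Carrier → Carrier
  Δ x = x * x - fromℕ 4

  D-cong : ∀ {x y} → x ≈ y → D x ≈ D y
  D-cong x≈y = +-cong (*-cong (*-cong x≈y x≈y) x≈y) (-‿cong (*-congˡ x≈y))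

  Δ-cong : ∀ {x y} → x ≈ y → Δ x ≈ Δ y
  Δ-cong x≈y = +-congʳ (*-cong x≈y x≈y)

  IsSquare : Carrier → Set _
  IsSquare x = ∃[ s ] s * s ≈ x

  isSquare? : ∀ x → Dec (IsSquare x)
  isSquare? x = any? (λ s≈s′ s²≈x → trans (*-cong (sym s≈s′) (sym s≈s′)) s²≈x) (λ s → s * s ≟ x)

  IsSquare-resp : ∀ {x y} → x ≈ y → IsSquare x → IsSquare y
  IsSquare-resp x≈y (s , s²≈x) = s , trans s²≈x x≈y

  IsSquare-cancel : ∀ {x y} → x ≉ 0# → IsSquare (x * x * y) → IsSquare y
  IsSquare-cancel {x} {y} x≉0 (s , s²≈x²y) = s * x ⁻¹ , *-cancelˡ-≉0 (*-≉0 x≉0 x≉0) (begin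
    x * x * (s * x ⁻¹ * (s * x ⁻¹))   ≈⟨ solve 3 (λ x s i → x :* x :* (s :* i :* (s :* i)) := s :* s :* (i :* x) :* (i :* x)) refl x s (x ⁻¹) ⟩
    s * s * (x ⁻¹ * x) * (x ⁻¹ * x)   ≈⟨ *-cong (*-congˡ (⁻¹-inverseˡ x≉0)) (⁻¹-inverseˡ x≉0) ⟩
    s * s * 1# * 1#                   ≈⟨ trans (*-identityʳ _) (*-identityʳ _) ⟩
    s * s                             ≈⟨ s²≈x²y ⟩
    x * x * y                         ∎)

  -- `Δ (D x)` equals `(x² - 1)² Δ x`, and the square factor is nonzero because `x² = 1` would give
  -- `Δ x = -3`, a square.
  D-nonsplit : ∀ {x} → ¬ IsSquare (Δ x) → ¬ IsSquare (Δ (D x))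
  D-nonsplit {x} Δx-nonsquare = Δx-nonsquare ∘ IsSquare-cancel x²-1≉0 ∘ IsSquare-resp
    (solve 1 (λ x → (x :* x :* x :- :# 3 :* x) :* (x :* x :* x :- :# 3 :* x) :- :# 4
       := (x :* x :- :# 1) :* (x :* x :- :# 1) :* (x :* x :- :# 4)) refl x)
    where
    x²-1≉0 : x * x - 1# ≉ 0#
    x²-1≉0 x²-1≈0 = Δx-nonsquare (√-3 , (begin
      √-3 * √-3             ≈⟨ √-3²≈-3 ⟩
      - fromℕ 3             ≈⟨ +-identityˡ _ ⟨
      0# - fromℕ 3          ≈⟨ +-congʳ x²-1≈0 ⟨
      x * x - 1# - fromℕ 3  ≈⟨ solve 1 (λ x → x :* x :- :# 1 :- :# 3 := x :* x :- :# 4) refl x ⟩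
      x * x - fromℕ 4       ∎))

  -- (D y - D x)/(y - x) is a quadratic in y with discriminant -3 (x² - 4).
  D-injective-nonsplit : ∀ {x y} → ¬ IsSquare (Δ x) → D x ≈ D y → x ≈ y
  D-injective-nonsplit {x} {y} Δx-nonsquare Dx≈Dy with xy≈0⇒x≈0⊎y≈0 {x - y} {x * x + x * y + y * y - fromℕ 3} (begin
    (x - y) * (x * x + x * y + y * y - fromℕ 3) ≈⟨ solve 2 (λ x y → (x :- y) :* (x :* x :+ x :* y :+ y :* y :- :# 3)
                                                     := (x :* x :* x :- :# 3 :* x) :- (y :* y :* y :- :# 3 :* y)) refl x y ⟩
    D x - D y                                   ≈⟨ x≈y⇒x-y≈0 Dx≈Dy ⟩
    0#                                          ∎)
  ... | inj₁ x-y≈0 = x-y≈0⇒x≈y _ _ x-y≈0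
  ... | inj₂ quadratic = contradiction (IsSquare-cancel √-3≉0 (fromℕ 2 * y + x , (begin
    (fromℕ 2 * y + x) * (fromℕ 2 * y + x)
      ≈⟨ solve 2 (λ x y → (:# 2 :* y :+ x) :* (:# 2 :* y :+ x)
           := :# 4 :* (x :* x :+ x :* y :+ y :* y :- :# 3) :+ (:- :# 3) :* (x :* x :- :# 4)) refl x y ⟩
    fromℕ 4 * (x * x + x * y + y * y - fromℕ 3) + - fromℕ 3 * Δ x
      ≈⟨ +-cong (trans (*-congˡ quadratic) (zeroʳ _)) (*-congʳ (sym √-3²≈-3)) ⟩
    0# + √-3 * √-3 * Δ x  ≈⟨ +-identityˡ _ ⟩
    √-3 * √-3 * Δ x       ∎))) Δx-nonsquare

  -- A substitution in a sum has to permute the whole field, whereas `D` takes the value 2 at both 2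
  -- and -1. So `D` is kept on the nonsplit elements and replaced by the identity elsewhere.
  π : Carrier → Carrier
  π x with isSquare? (Δ x)
  ... | yes _ = x
  ... | no  _ = D x

  π-injective : Injective _≈_ _≈_ π
  π-injective {x} {y} πx≈πy with isSquare? (Δ x) | isSquare? (Δ y)
  ... | yes _   | yes _   = πx≈πy
  ... | yes □x  | no ¬□y  = contradiction (IsSquare-resp (Δ-cong πx≈πy) □x) (D-nonsplit ¬□y)
  ... | no ¬□x  | yes □y  = contradiction (IsSquare-resp (Δ-cong (sym πx≈πy)) □y) (D-nonsplit ¬□x)
  ... | no ¬□x  | no _    = D-injective-nonsplit ¬□x πx≈πy

  π-cong : ∀ {x y} → x ≈ y → π x ≈ π y
  π-cong {x} {y} x≈y with isSquare? (Δ x) | isSquare? (Δ y)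
  ... | yes _   | yes _   = x≈y
  ... | yes □x  | no ¬□y  = contradiction (IsSquare-resp (Δ-cong x≈y) □x) ¬□y
  ... | no ¬□x  | yes □y  = contradiction (IsSquare-resp (Δ-cong (sym x≈y)) □y) ¬□x
  ... | no _    | no _    = D-cong x≈y

  IsSquare-g^ : ∀ {x i} → x ≈ g ^ i → 2 ∣ i → IsSquare x
  IsSquare-g^ {x} {i} x≈g^i (divides j i≡j*2) = g ^ j , (begin
    g ^ j * g ^ j     ≈⟨ solve 1 (λ h → h :* h := h :^ 2) refl (g ^ j) ⟩
    (g ^ j) ^ 2       ≈⟨ ^-assocʳ g j 2 ⟩
    g ^ (j ℕ.* 2)     ≈⟨ ^-congʳ g i≡j*2 ⟨
    g ^ i             ≈⟨ x≈g^i ⟨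
    x                 ∎)

  IsCube : Carrier → Set _
  IsCube x = ∃[ r ] r * r * r ≈ x

  isCube? : ∀ x → Dec (IsCube x)
  isCube? x = any? (λ r≈s r³≈x → trans (*-cong (*-cong (sym r≈s) (sym r≈s)) (sym r≈s)) r³≈x) (λ r → r * r * r ≟ x)

  IsCube-g^ : ∀ {x i} → x ≈ g ^ i → 3 ∣ i → IsCube x
  IsCube-g^ {x} {i} x≈g^i (divides j i≡j*3) = g ^ j , (begin
    g ^ j * g ^ j * g ^ j     ≈⟨ solve 1 (λ h → h :* h :* h := h :^ 3) refl (g ^ j) ⟩
    (g ^ j) ^ 3               ≈⟨ ^-assocʳ g j 3 ⟩
    g ^ (j ℕ.* 3)             ≈⟨ ^-congʳ g i≡j*3 ⟨
    g ^ i                     ≈⟨ x≈g^i ⟨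
    x                         ∎)

  x²≈0⇒x≈0 : ∀ {x} → x * x ≈ 0# → x ≈ 0#
  x²≈0⇒x≈0 x²≈0 with xy≈0⇒x≈0⊎y≈0 x²≈0
  ... | inj₁ x≈0 = x≈0
  ... | inj₂ x≈0 = x≈0

  x≉0⇒x≉-x : ∀ {x} → x ≉ 0# → x ≉ - x
  x≉0⇒x≉-x {x} x≉0 x≈-x = x≉0 (x≉0∧xy≈0⇒y≈0 2≉0 (begin
    fromℕ 2 * x   ≈⟨ solve 1 (λ x → :# 2 :* x := x :- (:- x)) refl x ⟩
    x - (- x)     ≈⟨ x≈y⇒x-y≈0 x≈-x ⟩
    0#            ∎))

  x²≈y²⇒x≈±y : ∀ {x y} → x * x ≈ y * y → x ≈ y ⊎ x ≈ - y
  x²≈y²⇒x≈±y {x} {y} x²≈y² with xy≈0⇒x≈0⊎y≈0 {x - y} {x - (- y)} (begin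
    (x - y) * (x - (- y)) ≈⟨ solve 2 (λ x y → (x :- y) :* (x :- (:- y)) := x :* x :- y :* y) refl x y ⟩
    x * x - y * y         ≈⟨ x≈y⇒x-y≈0 x²≈y² ⟩
    0#                    ∎)
  ... | inj₁ eq = inj₁ (x-y≈0⇒x≈y _ _ eq)
  ... | inj₂ eq = inj₂ (x-y≈0⇒x≈y _ _ eq)

  4≉0 : fromℕ 4 ≉ 0#
  4≉0 4≈0 = *-≉0 2≉0 2≉0 (trans (solve 0 (:# 2 :* :# 2 := :# 4) refl) 4≈0)

  affine-injective : ∀ {a} b → a ≉ 0# → Injective _≈_ _≈_ (λ x → a * x + b)
  affine-injective {a} b a≉0 {x} {y} eq = *-cancelˡ-≉0 a≉0 (x-y≈0⇒x≈y _ _ (begin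
    a * x - a * y             ≈⟨ solve 4 (λ a x y b → a :* x :- a :* y := (a :* x :+ b) :- (a :* y :+ b)) refl a x y b ⟩
    (a * x + b) - (a * y + b) ≈⟨ x≈y⇒x-y≈0 eq ⟩
    0#                        ∎))

  completeSquare : ∀ b c y → (fromℕ 2 * y + b) * (fromℕ 2 * y + b) - (b * b - fromℕ 4 * c) ≈ fromℕ 4 * (y * y + b * y + c)
  completeSquare b c y = solve 3 (λ y b c → (:# 2 :* y :+ b) :* (:# 2 :* y :+ b) :- (b :* b :- :# 4 :* c)
    := :# 4 :* (y :* y :+ b :* y :+ c)) refl y b c

  module _ {r} (r≉0 : r ≉ 0#) where

    r₁ r₂ : Carrier
    r₁ = r * ρ
    r₂ = r * (ρ * ρ)

    cube-factorisation : ∀ v → (v - r) * ((v - r₁) * (v - r₂)) ≈ v * v * v - r * r * r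
    cube-factorisation v = begin
      (v - r) * ((v - r₁) * (v - r₂))
        ≈⟨ solve 3 (λ v r ρ → (v :- r) :* ((v :- r :* ρ) :* (v :- r :* (ρ :* ρ)))
             := v :* v :* v :- r :* r :* r
                :+ (ρ :* ρ :+ ρ :+ :# 1) :* (v :* r :* r :* ρ :- v :* v :* r :- r :* r :* r :* (ρ :- :# 1)))
             refl v r ρ ⟩
      v * v * v - r * r * r + (ρ * ρ + ρ + 1#) * (v * r * r * ρ - v * v * r - r * r * r * (ρ - 1#))
        ≈⟨ +-congˡ (trans (*-congʳ ρ²+ρ+1≈0) (zeroˡ _)) ⟩
      v * v * v - r * r * r + 0#
        ≈⟨ +-identityʳ _ ⟩
      v * v * v - r * r * r ∎

    private
      ρ≉0 : ρ ≉ 0#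
      ρ≉0 = ^-≉0 g≉0 (m ℕ.* 2)

      ρ-1≉0 : ρ - 1# ≉ 0#
      ρ-1≉0 eq = ρ≉1 (x-y≈0⇒x≈y _ _ eq)

      ρ+1≉0 : ρ + 1# ≉ 0#
      ρ+1≉0 eq = *-≉0 ρ≉0 ρ≉0 (begin
        ρ * ρ             ≈⟨ +-identityʳ _ ⟨
        ρ * ρ + 0#        ≈⟨ +-congˡ eq ⟨
        ρ * ρ + (ρ + 1#)  ≈⟨ +-assoc _ _ _ ⟨
        ρ * ρ + ρ + 1#    ≈⟨ ρ²+ρ+1≈0 ⟩
        0#                ∎)

      ≉-from-difference : ∀ {a b x} → x ≈ b - a → x ≉ 0# → ∀ {v} → v ≈ a → v ≉ b
      ≉-from-difference x≈b-a x≉0 v≈a v≈b = x≉0 (trans x≈b-a (x≈y⇒x-y≈0 (trans (sym v≈b) v≈a)))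

    v≈r⇒v≉r₁ : ∀ {v} → v ≈ r → v ≉ r₁
    v≈r⇒v≉r₁ = ≉-from-difference
      (solve 2 (λ r ρ → r :* (ρ :- :# 1) := r :* ρ :- r) refl r ρ)
      (*-≉0 r≉0 ρ-1≉0)

    v≈r⇒v≉r₂ : ∀ {v} → v ≈ r → v ≉ r₂
    v≈r⇒v≉r₂ = ≉-from-difference
      (solve 2 (λ r ρ → r :* (ρ :- :# 1) :* (ρ :+ :# 1) := r :* (ρ :* ρ) :- r) refl r ρ)
      (*-≉0 (*-≉0 r≉0 ρ-1≉0) ρ+1≉0)

    v≈r₁⇒v≉r₂ : ∀ {v} → v ≈ r₁ → v ≉ r₂
    v≈r₁⇒v≉r₂ = ≉-from-difference
      (solve 2 (λ r ρ → r :* ρ :* (ρ :- :# 1) := r :* (ρ :* ρ) :- r :* ρ) refl r ρ)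
      (*-≉0 (*-≉0 r≉0 ρ≉0) ρ-1≉0)

  x+x⁻¹-quadratic : ∀ {x} → x ≉ 0# → ∀ y → x * ((x + x ⁻¹) - y) ≈ x * x + (- y) * x + 1#
  x+x⁻¹-quadratic {x} x≉0 y = begin
    x * ((x + x ⁻¹) - y)            ≈⟨ solve 3 (λ x i y → x :* ((x :+ i) :- y) := x :* x :+ (:- y) :* x :+ x :* i) refl x (x ⁻¹) y ⟩
    x * x + (- y) * x + x * x ⁻¹    ≈⟨ +-congˡ (⁻¹-inverseʳ x≉0) ⟩
    x * x + (- y) * x + 1#          ∎

  D-x+x⁻¹ : ∀ {x} → x ≉ 0# → x * x * x + (x * x * x) ⁻¹ ≈ D (x + x ⁻¹)
  D-x+x⁻¹ {x} x≉0 = begin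
    x * x * x + (x * x * x) ⁻¹
      ≈⟨ +-congˡ (trans (⁻¹-distrib-* (x * x) x) (*-congʳ (⁻¹-distrib-* x x))) ⟩
    x * x * x + i * i * i
      ≈⟨ solve 2 (λ x i → x :* x :* x :+ i :* i :* i := (x :+ i) :* (x :+ i) :* (x :+ i) :- :# 3 :* (x :* i) :* (x :+ i)) refl x i ⟩
    (x + i) * (x + i) * (x + i) - fromℕ 3 * (x * i) * (x + i)
      ≈⟨ +-congˡ (-‿cong (*-congʳ (trans (*-congˡ (⁻¹-inverseʳ x≉0)) (*-identityʳ _)))) ⟩
    D (x + i) ∎
    where i = x ⁻¹

  D-fixes-Δ≈0 : ∀ {x} → Δ x ≈ 0# → D x ≈ x
  D-fixes-Δ≈0 {x} Δx≈0 = x-y≈0⇒x≈y _ _ (begin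
    D x - x   ≈⟨ solve 1 (λ x → x :* x :* x :- :# 3 :* x :- x := x :* (x :* x :- :# 4)) refl x ⟩
    x * Δ x   ≈⟨ trans (*-congˡ Δx≈0) (zeroʳ x) ⟩
    0#        ∎)

  -- Inverting y turns the summand of the hypergeometric series at z into a single
  -- character value at R y.
  module RationalFunction (z : Carrier) where
    R : Carrier → Carrier
    R y = y * (y - 1#) * (y - z) ⁻¹

    R-0 : ∀ {y} → y ≈ 0# → R y ≈ 0#
    R-0 y≈0 = trans (*-congʳ (trans (*-congʳ y≈0) (zeroˡ _))) (zeroˡ _)

    R-reciprocal : ∀ {y} → y ≉ 0# → y * (1# - y ⁻¹) * (1# - z * y ⁻¹) ⁻¹ ≈ R y
    R-reciprocal {y} y≉0 = begin
      y * (1# - i) * (1# - z * i) ⁻¹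
        ≈⟨ *-congˡ (⁻¹-cong (trans (+-congʳ (sym (⁻¹-inverseʳ y≉0)))
             (solve 3 (λ y i z → y :* i :- z :* i := (y :- z) :* i) refl y i z))) ⟩
      y * (1# - i) * ((y - z) * i) ⁻¹
        ≈⟨ *-congˡ (trans (⁻¹-distrib-* (y - z) i) (*-congˡ (⁻¹-involutive y))) ⟩
      y * (1# - i) * ((y - z) ⁻¹ * y)
        ≈⟨ solve 3 (λ y i j → y :* (:# 1 :- i) :* (j :* y) := y :* (y :- y :* i) :* j) refl y i ((y - z) ⁻¹) ⟩
      y * (y - y * i) * (y - z) ⁻¹
        ≈⟨ *-congʳ (*-congˡ (+-congˡ (-‿cong (⁻¹-inverseʳ y≉0)))) ⟩
      R y ∎
      where i = y ⁻¹

    -- The equation `R y = u` with the denominator `y - z` cleared.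
    quadratic : Carrier → Carrier → Carrier
    quadratic u y = y * y + (- (1# + u)) * y + u * z

    private
      quadratic-expand : ∀ u y → y * (y - 1#) - (y - z) * u ≈ quadratic u y
      quadratic-expand u y = solve 3 (λ u y z → y :* (y :- :# 1) :- (y :- z) :* u
        := y :* y :+ (:- (:# 1 :+ u)) :* y :+ u :* z) refl u y z

      [y-z]R : ∀ {y} → y - z ≉ 0# → (y - z) * R y ≈ y * (y - 1#)
      [y-z]R {y} y-z≉0 = begin
        (y - z) * (y * (y - 1#) * (y - z) ⁻¹) ≈⟨ solve 3 (λ d a i → d :* (a :* i) := a :* (d :* i)) refl (y - z) (y * (y - 1#)) ((y - z) ⁻¹) ⟩
        y * (y - 1#) * ((y - z) * (y - z) ⁻¹) ≈⟨ *-congˡ (⁻¹-inverseʳ y-z≉0) ⟩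
        y * (y - 1#) * 1#                     ≈⟨ *-identityʳ _ ⟩
        y * (y - 1#)                          ∎

    -- Nonzero `u` rules out the pole `y = z`, at which total division gives `R` the value 0.
    R-fibre⇒quadratic : ∀ {u y} → u ≉ 0# → u ≈ R y → quadratic u y ≈ 0#
    R-fibre⇒quadratic {u} {y} u≉0 u≈Ry = trans (sym (quadratic-expand u y)) (x≈y⇒x-y≈0 (sym (begin
      (y - z) * u    ≈⟨ *-congˡ u≈Ry ⟩
      (y - z) * R y  ≈⟨ [y-z]R y-z≉0 ⟩
      y * (y - 1#)   ∎)))
      where
      y-z≉0 : y - z ≉ 0#
      y-z≉0 y-z≈0 = u≉0 (trans u≈Ry (trans (*-congˡ (x≈0⇒x⁻¹≈0 y-z≈0)) (zeroʳ _)))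

    -- Clearing the denominator could add the root `y = z`, but then `z * (z - 1#)` would vanish.
    quadratic⇒R-fibre : z ≉ 0# → z ≉ 1# → ∀ {u y} → quadratic u y ≈ 0# → u ≈ R y
    quadratic⇒R-fibre z≉0 z≉1 {u} {y} quadratic≈0 = *-cancelˡ-≉0 y-z≉0 (begin
      (y - z) * u    ≈⟨ x-y≈0⇒x≈y _ _ (trans (quadratic-expand u y) quadratic≈0) ⟨
      y * (y - 1#)   ≈⟨ [y-z]R y-z≉0 ⟨
      (y - z) * R y  ∎)
      where
      y-z≉0 : y - z ≉ 0#
      y-z≉0 y-z≈0 = *-≉0 z≉0 (z≉1 ∘ x-y≈0⇒x≈y _ _) (begin
        z * (z - 1#)                  ≈⟨ *-cong y≈z (+-congʳ y≈z) ⟨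
        y * (y - 1#)                  ≈⟨ x-y≈0⇒x≈y _ _ (trans (quadratic-expand u y) quadratic≈0) ⟩
        (y - z) * u                   ≈⟨ trans (*-congʳ y-z≈0) (zeroˡ u) ⟩
        0#                            ∎)
        where
        y≈z : y ≈ z
        y≈z = x-y≈0⇒x≈y _ _ y-z≈0

    -- With the factor `u` removed, the discriminant is a function of `u + u ⁻¹`. That factor
    -- contributes `α u ^ 3`, which turns the weight `α u` into `α u ^ 4`.
    discriminant : ∀ {u} → u ≉ 0# →
                   (- (1# + u)) * (- (1# + u)) - fromℕ 4 * (u * z) ≈ u * ((u + u ⁻¹) + (fromℕ 2 - fromℕ 4 * z))
    discriminant {u} u≉0 = begin
      (- (1# + u)) * (- (1# + u)) - fromℕ 4 * (u * z)
        ≈⟨ solve 2 (λ u z → (:- (:# 1 :+ u)) :* (:- (:# 1 :+ u)) :- :# 4 :* (u :* z)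
             := u :* u :+ :# 1 :+ u :* (:# 2 :- :# 4 :* z)) refl u z ⟩
      u * u + 1# + u * (fromℕ 2 - fromℕ 4 * z)
        ≈⟨ +-congʳ (+-congˡ (⁻¹-inverseʳ u≉0)) ⟨
      u * u + u * u ⁻¹ + u * (fromℕ 2 - fromℕ 4 * z)
        ≈⟨ solve 3 (λ u i s → u :* u :+ u :* i :+ u :* s := u :* ((u :+ i) :+ s)) refl u (u ⁻¹) (fromℕ 2 - fromℕ 4 * z) ⟩
      u * ((u + u ⁻¹) + (fromℕ 2 - fromℕ 4 * z)) ∎

-- Multiplicative functions on the field, extended by 0.

module MultiplicativeFunctions {c ℓ k ℓ₁ ℓ₂} (𝔽 : FiniteField c ℓ) (K : AlgebraicallyClosedField₀ k ℓ₁ ℓ₂) where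
  private
    module F where
      open FiniteField 𝔽 public
      open FiniteFieldProperties 𝔽 public
  open ValueFieldProperties K
  open Sums 𝔽 K
  open Relation.Binary.Reasoning.Setoid setoid

  -- Characters are handled as plain functions with value 0 at 0: field identities can then be
  -- applied inside them without carrying units, and powers of `α` are again such functions.
  record IsMultiplicative (α : F.Carrier → Carrier) : Set (c ⊔ ℓ ⊔ ℓ₁) where
    field
      α-cong : α Preserves F._≈_ ⟶ _≈_
      α-0    : α F.0# ≈ 0#
      α-1    : α F.1# ≈ 1#
      α-*    : ∀ x y → α (x F.* y) ≈ α x * α y

    α-^ : ∀ x n → α (x F.^ n) ≈ α x ^ n
    α-^ x zero    = α-1
    α-^ x (suc n) = trans (α-* x (x F.^ n)) (*-congˡ (α-^ x n))

    α-⁻¹ : ∀ {x} → x F.≉ F.0# → α x * α (x F.⁻¹) ≈ 1#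
    α-⁻¹ {x} x≉0 = begin
      α x * α (x F.⁻¹)  ≈⟨ α-* x (x F.⁻¹) ⟨
      α (x F.* x F.⁻¹)  ≈⟨ α-cong (F.⁻¹-inverseʳ x≉0) ⟩
      α F.1#            ≈⟨ α-1 ⟩
      1#                ∎

    α-x≈0 : ∀ {x} → x F.≈ F.0# → α x ≈ 0#
    α-x≈0 x≈0 = trans (α-cong x≈0) α-0

    -- Multiplication by x permutes the field.
    ∑-α≈0 : ∀ {x} → x F.≉ F.0# → α x # 1# → ∑[ y ] α y ≈ 0#
    ∑-α≈0 {x} x≉0 αx#1 = x#y∧[x-y]z≈0⇒z≈0 αx#1 (begin
      (α x - 1#) * S     ≈⟨ solve 2 (λ a s → (a :- :# 1) :* s := a :* s :- s) refl (α x) S ⟩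
      α x * S - S        ≈⟨ x≈y⇒x-y≈0 αx*S≈S ⟩
      0#                 ∎)
      where
      S = ∑[ y ] α y
      αx*S≈S : α x * S ≈ S
      αx*S≈S = begin
        α x * (∑[ y ] α y)     ≈⟨ ∑-*ˡ (α x) α ⟨
        ∑[ y ] (α x * α y)     ≈⟨ ∑-cong (λ y → α-* x y) ⟨
        ∑[ y ] α (x F.* y)     ≈⟨ ∑-substitution F.*-congˡ (F.*-cancelˡ-≉0 x≉0) α-cong ⟩
        ∑[ y ] α y             ∎

  -- The exponent must be nonzero since `0# ^ 0` is 1; this is also why the indicator of the nonzero
  -- elements is written `α ^ 6`.
  ^-isMultiplicative : ∀ {α} → IsMultiplicative α → ∀ n → .{{NonZero n}} → IsMultiplicative (λ x → α x ^ n)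
  ^-isMultiplicative {α} α-mult n@(suc _) = record
    { α-cong = ^-congˡ n ∘ α-cong
    ; α-0    = trans (*-congʳ α-0) (zeroˡ _)
    ; α-1    = trans (^-congˡ n α-1) (1^n≈1 n)
    ; α-*    = λ x y → trans (^-congˡ n (α-* x y)) (^-distrib-* (α x) (α y) n)
    }
    where open IsMultiplicative α-mult

-- Root counts by characters, and the evaluation of the hypergeometric sum.

module SexticCharacterSums {c ℓ k ℓ₁ ℓ₂} (𝔽 : FiniteField c ℓ) (K : AlgebraicallyClosedField₀ k ℓ₁ ℓ₂)
    (primitiveRoot : PrimitiveRoots.PrimitiveRoot 𝔽) (6∣q-1 : 6 ∣ FiniteField.order 𝔽 ℕ.∸ 1)
    {α : FiniteField.Carrier 𝔽 → AlgebraicallyClosedField₀.Carrier K}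
    (α-isMultiplicative : MultiplicativeFunctions.IsMultiplicative 𝔽 K α)
    (αg-primitive : ValueFieldProperties.IsPrimitiveSixthRoot K
                      (α (PrimitiveRoots.PrimitiveRoot.g primitiveRoot))) where
  private
    module F where
      open FiniteField 𝔽 public
      open FiniteFieldProperties 𝔽 public
      open IntegerCoefficients commutativeRing public
      open PrimitiveRoots.PrimitiveRoot primitiveRoot public
      open SixthRootsOfUnity 𝔽 primitiveRoot 6∣q-1 public
  open ValueFieldProperties K
  open Sums 𝔽 K
  open MultiplicativeFunctions 𝔽 K
  open IsMultiplicative α-isMultiplicative
  open Relation.Binary.Reasoning.Setoid setoid

  private
    t = α F.g

  φ : F.Carrier → Carrier
  φ x = α x ^ 3

  φ-isMultiplicative : IsMultiplicative φ
  φ-isMultiplicative = ^-isMultiplicative α-isMultiplicative 3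

  open IsMultiplicative φ-isMultiplicative using ()
    renaming (α-cong to φ-cong; α-* to φ-*; α-x≈0 to φ-x≈0; ∑-α≈0 to ∑-φ≈0)

  α-power : ∀ {x i} → x F.≈ F.g F.^ i → α x ≈ t ^ i
  α-power {i = i} x≈g^i = trans (α-cong x≈g^i) (α-^ F.g i)

  α⁶≈1 : ∀ {x} → x F.≉ F.0# → α x ^ 6 ≈ 1#
  α⁶≈1 {x} x≉0 with i , x≈g^i ← F.generates x≉0 = begin
    α x ^ 6      ≈⟨ ^-congˡ 6 (α-power {x} {i} x≈g^i) ⟩
    (t ^ i) ^ 6  ≈⟨ ^-swap t i 6 ⟩
    (t ^ 6) ^ i  ≈⟨ ^-congˡ i (w⁶≈1 αg-primitive) ⟩
    1# ^ i       ≈⟨ 1^n≈1 i ⟩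
    1#           ∎

  φ-square : ∀ {x} → x F.≉ F.0# → φ (x F.* x) ≈ 1#
  φ-square {x} x≉0 = trans (φ-* x x) (trans (sym (^-homo-* (α x) 3 3)) (α⁶≈1 x≉0))

  -- A nonsquare is an odd power of `g`, and `φ g` is `t ^ 3`, which is -1.
  φ-nonsquare : ∀ {x} → ¬ F.IsSquare x → φ x ≈ - 1#
  φ-nonsquare {x} ¬□x = begin
    α x ^ 3                   ≈⟨ ^-congˡ 3 (α-power {x} {i} x≈g^i) ⟩
    (t ^ i) ^ 3               ≈⟨ ^-swap t i 3 ⟩
    (t ^ 3) ^ i               ≈⟨ ^-congˡ i (w³≈-1 αg-primitive) ⟩
    (- 1#) ^ i                ≈⟨ odd-power i ¬2∣i ⟩
    - 1#                      ∎
    where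
    x≉0 : x F.≉ F.0#
    x≉0 x≈0 = ¬□x (F.0# , F.trans (F.zeroˡ F.0#) (F.sym x≈0))
    i = proj₁ (F.generates x≉0)
    x≈g^i : x F.≈ F.g F.^ i
    x≈g^i = proj₂ (F.generates x≉0)

    ¬2∣i : ¬ 2 ∣ i
    ¬2∣i = ¬□x ∘ F.IsSquare-g^ {i = i} x≈g^i

    odd-power : ∀ i → ¬ 2 ∣ i → (- 1#) ^ i ≈ - 1#
    odd-power zero          2∤0 = contradiction (2 ℕ.∣0) 2∤0
    odd-power (suc zero)    _   = *-identityʳ _
    odd-power (suc (suc i)) 2∤i+2 = begin
      - 1# * (- 1# * (- 1#) ^ i) ≈⟨ solve 1 (λ x → (:- :# 1) :* ((:- :# 1) :* x) := x) refl ((- 1#) ^ i) ⟩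
      (- 1#) ^ i                 ≈⟨ odd-power i (2∤i+2 ∘ ℕ.∣m∣n⇒∣m+n ℕ.∣-refl) ⟩
      - 1#                       ∎

  ∑-squareRoots : ∀ x → ∑[ s ] 𝟙 (s F.* s F.≟ x) ≈ 1# + φ x
  ∑-squareRoots x = by-cases (x F.≟ F.0#) (F.isSquare? x)
    where
    by-cases : Dec (x F.≈ F.0#) → Dec (F.IsSquare x) → ∑[ s ] 𝟙 (s F.* s F.≟ x) ≈ 1# + φ x
    by-cases (yes x≈0) _ = begin
      ∑[ s ] 𝟙 (s F.* s F.≟ x)  ≈⟨ ∑-cong (λ s → 𝟙-cong (s F.* s F.≟ x) (s F.≟ F.0#)
                                     (λ s²≈x → F.x²≈0⇒x≈0 (F.trans s²≈x x≈0))
                                     (λ s≈0 → F.trans (F.*-congʳ s≈0) (F.trans (F.zeroˡ s) (F.sym x≈0)))) ⟩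
      ∑[ s ] 𝟙 (s F.≟ F.0#)     ≈⟨ ∑-𝟙 F.0# ⟩
      1#                        ≈⟨ +-identityʳ 1# ⟨
      1# + 0#                   ≈⟨ +-congˡ (φ-x≈0 x≈0) ⟨
      1# + φ x                  ∎
    by-cases (no x≉0) (yes (r , r²≈x)) = begin
      ∑[ s ] 𝟙 (s F.* s F.≟ x)                          ≈⟨ ∑-cong two-roots ⟩
      ∑[ s ] (𝟙 (s F.≟ r) + 𝟙 (s F.≟ F.- r))            ≈⟨ ∑-+ _ _ ⟩
      ∑[ s ] 𝟙 (s F.≟ r) + ∑[ s ] 𝟙 (s F.≟ F.- r)       ≈⟨ +-cong (∑-𝟙 r) (∑-𝟙 (F.- r)) ⟩
      1# + 1#                                           ≈⟨ +-congˡ (trans (sym (φ-square r≉0)) (φ-cong r²≈x)) ⟩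
      1# + φ x                                          ∎
      where
      r≉0 : r F.≉ F.0#
      r≉0 r≈0 = x≉0 (F.trans (F.sym r²≈x) (F.trans (F.*-congʳ r≈0) (F.zeroˡ r)))

      two-roots : ∀ s → 𝟙 (s F.* s F.≟ x) ≈ 𝟙 (s F.≟ r) + 𝟙 (s F.≟ F.- r)
      two-roots s with s F.≟ r | s F.≟ F.- r
      ... | yes s≈r | yes s≈-r = contradiction (F.trans (F.sym s≈r) s≈-r) (F.x≉0⇒x≉-x r≉0)
      ... | yes s≈r | no  _    = trans (𝟙-yes (s F.* s F.≟ x) (F.trans (F.*-cong s≈r s≈r) r²≈x)) (sym (+-identityʳ 1#))
      ... | no  _   | yes s≈-r = trans (𝟙-yes (s F.* s F.≟ x) (F.trans (F.*-cong s≈-r s≈-r)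
                                   (F.trans (F.solve 1 (λ r → (F.:- r) F.:* (F.:- r) F.:= r F.:* r) F.refl r) r²≈x))) (sym (+-identityˡ 1#))
      ... | no s≉r  | no s≉-r  = trans (𝟙-no (s F.* s F.≟ x) (λ s²≈x → neither (F.x²≈y²⇒x≈±y (F.trans s²≈x (F.sym r²≈x))))) (sym (+-identityˡ 0#))
        where
        neither : ¬ (s F.≈ r ⊎ s F.≈ F.- r)
        neither (inj₁ s≈r)  = s≉r s≈r
        neither (inj₂ s≈-r) = s≉-r s≈-r
    by-cases (no _) (no ¬□x) = begin
      ∑[ s ] 𝟙 (s F.* s F.≟ x)  ≈⟨ ∑-cong (λ s → 𝟙-no (s F.* s F.≟ x) (λ s²≈x → ¬□x (s , s²≈x))) ⟩
      ∑[ s ] 0#                 ≈⟨ ∑-0 ⟩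
      0#                        ≈⟨ -‿inverseʳ 1# ⟨
      1# - 1#                   ≈⟨ +-congˡ (φ-nonsquare ¬□x) ⟨
      1# + φ x                  ∎

  -- Completing the square is the substitution `y ↦ 2y + b`, a permutation because 2 is invertible;
  -- it reduces the count to square roots of the discriminant.
  ∑-quadraticRoots : ∀ b c → ∑[ y ] 𝟙 (y F.* y F.+ b F.* y F.+ c F.≟ F.0#) ≈ 1# + φ (b F.* b F.- F.fromℕ 4 F.* c)
  ∑-quadraticRoots b c = begin
    ∑[ y ] 𝟙 (y F.* y F.+ b F.* y F.+ c F.≟ F.0#)   ≈⟨ ∑-cong (λ y → 𝟙-cong (_ F.≟ _) (_ F.≟ _) (complete y) (uncomplete y)) ⟩
    ∑[ y ] 𝟙 (σ y F.* σ y F.≟ disc)                 ≈⟨ ∑-substitution {σ} (λ eq → F.+-congʳ (F.*-congˡ eq)) (F.affine-injective b F.2≉0)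
                                                         (λ eq → 𝟙-cong (_ F.≟ _) (_ F.≟ _) (F.trans (F.*-cong (F.sym eq) (F.sym eq))) (F.trans (F.*-cong eq eq))) ⟩
    ∑[ s ] 𝟙 (s F.* s F.≟ disc)                     ≈⟨ ∑-squareRoots disc ⟩
    1# + φ disc                                     ∎
    where
    disc = b F.* b F.- F.fromℕ 4 F.* c
    σ : F.Carrier → F.Carrier
    σ y = F.fromℕ 2 F.* y F.+ b

    complete : ∀ y → y F.* y F.+ b F.* y F.+ c F.≈ F.0# → σ y F.* σ y F.≈ disc
    complete y eq = F.x-y≈0⇒x≈y _ _ (F.trans (F.completeSquare b c y) (F.trans (F.*-congˡ eq) (F.zeroʳ _)))

    uncomplete : ∀ y → σ y F.* σ y F.≈ disc → y F.* y F.+ b F.* y F.+ c F.≈ F.0#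
    uncomplete y eq = F.x≉0∧xy≈0⇒y≈0 F.4≉0 (F.trans (F.sym (F.completeSquare b c y)) (F.x≈y⇒x-y≈0 eq))

  -- `α x ^ 2` is a cube root of unity, equal to 1 on cubes and nontrivial on noncubes, so its first
  -- three powers add up to 3 or to 0.
  ∑-cubeRoots : ∀ {x} → x F.≉ F.0# → ∑[ v ] 𝟙 (x F.≟ v F.* v F.* v) ≈ α x ^ 6 + α x ^ 4 + α x ^ 2
  ∑-cubeRoots {x} x≉0 = by-cases (F.isCube? x)
    where
    by-cases : Dec (F.IsCube x) →
               ∑[ v ] 𝟙 (x F.≟ v F.* v F.* v) ≈ α x ^ 6 + α x ^ 4 + α x ^ 2
    by-cases (yes (r , r³≈x)) = begin
      ∑[ v ] 𝟙 (x F.≟ v F.* v F.* v)                    ≈⟨ ∑-cong three-roots ⟩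
      ∑[ v ] (𝟙 (v F.≟ r) + 𝟙 (v F.≟ r₁) + 𝟙 (v F.≟ r₂)) ≈⟨ trans (∑-+ _ _) (+-congʳ (∑-+ _ _)) ⟩
      ∑[ v ] 𝟙 (v F.≟ r) + ∑[ v ] 𝟙 (v F.≟ r₁) + ∑[ v ] 𝟙 (v F.≟ r₂)
                                                        ≈⟨ +-cong (+-cong (∑-𝟙 r) (∑-𝟙 r₁)) (∑-𝟙 r₂) ⟩
      1# + 1# + 1#                                      ≈⟨ solve 0 (:# 1 :+ :# 1 :+ :# 1 := :# 1 :^ 3 :+ :# 1 :^ 2 :+ :# 1) refl ⟩
      1# ^ 3 + 1# ^ 2 + 1#                              ≈⟨ +-cong (+-cong (^-congˡ 3 αx²≈1) (^-congˡ 2 αx²≈1)) αx²≈1 ⟨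
      (α x ^ 2) ^ 3 + (α x ^ 2) ^ 2 + α x ^ 2           ≈⟨ solve 1 (λ a → (a :^ 2) :^ 3 :+ (a :^ 2) :^ 2 :+ a :^ 2 := a :^ 6 :+ a :^ 4 :+ a :^ 2) refl (α x) ⟩
      α x ^ 6 + α x ^ 4 + α x ^ 2                       ∎
      where
      r≉0 : r F.≉ F.0#
      r≉0 r≈0 = x≉0 (F.trans (F.sym r³≈x) (F.trans (F.*-congˡ r≈0) (F.zeroʳ _)))
      r₁ = F.r₁ r≉0
      r₂ = F.r₂ r≉0

      αx²≈1 : α x ^ 2 ≈ 1#
      αx²≈1 = begin
        α x ^ 2         ≈⟨ ^-congˡ 2 (α-cong r³≈x) ⟨
        α (r F.* r F.* r) ^ 2     ≈⟨ ^-congˡ 2 (trans (α-* (r F.* r) r) (*-congʳ (α-* r r))) ⟩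
        (α r * α r * α r) ^ 2     ≈⟨ solve 1 (λ a → (a :* a :* a) :^ 2 := a :^ 6) refl (α r) ⟩
        α r ^ 6         ≈⟨ α⁶≈1 r≉0 ⟩
        1#              ∎

      factorisation : ∀ v → (v F.- r) F.* ((v F.- r₁) F.* (v F.- r₂)) F.≈ v F.* v F.* v F.- x
      factorisation v = F.trans (F.cube-factorisation r≉0 v) (F.+-congˡ (F.-‿cong r³≈x))

      cube : ∀ {v} → (v F.- r) F.* ((v F.- r₁) F.* (v F.- r₂)) F.≈ F.0# → x F.≈ v F.* v F.* v
      cube {v} eq = F.sym (F.x-y≈0⇒x≈y _ _ (F.trans (F.sym (factorisation v)) eq))

      vanish : ∀ {v a} → v F.≈ a → v F.- a F.≈ F.0#
      vanish = F.x≈y⇒x-y≈0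

      three-roots : ∀ v → 𝟙 (x F.≟ v F.* v F.* v) ≈ 𝟙 (v F.≟ r) + 𝟙 (v F.≟ r₁) + 𝟙 (v F.≟ r₂)
      three-roots v with v F.≟ r | v F.≟ r₁ | v F.≟ r₂
      ... | yes v≈r | yes v≈r₁ | _ = contradiction v≈r₁ (F.v≈r⇒v≉r₁ r≉0 v≈r)
      ... | yes v≈r | no _ | yes v≈r₂ = contradiction v≈r₂ (F.v≈r⇒v≉r₂ r≉0 v≈r)
      ... | no _ | yes v≈r₁ | yes v≈r₂ = contradiction v≈r₂ (F.v≈r₁⇒v≉r₂ r≉0 v≈r₁)
      ... | yes v≈r | no _ | no _ = trans
        (𝟙-yes (x F.≟ _) (cube (F.trans (F.*-congʳ (vanish v≈r)) (F.zeroˡ _))))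
        (solve 0 (:# 1 := :# 1 :+ :# 0 :+ :# 0) refl)
      ... | no _ | yes v≈r₁ | no _ = trans
        (𝟙-yes (x F.≟ _) (cube (F.trans (F.*-congˡ (F.trans (F.*-congʳ (vanish v≈r₁)) (F.zeroˡ _))) (F.zeroʳ _))))
        (solve 0 (:# 1 := :# 0 :+ :# 1 :+ :# 0) refl)
      ... | no _ | no _ | yes v≈r₂ = trans
        (𝟙-yes (x F.≟ _) (cube (F.trans (F.*-congˡ (F.trans (F.*-congˡ (vanish v≈r₂)) (F.zeroʳ _))) (F.zeroʳ _))))
        (solve 0 (:# 1 := :# 0 :+ :# 0 :+ :# 1) refl)
      ... | no v≉r | no v≉r₁ | no v≉r₂ = trans
        (𝟙-no (x F.≟ _) λ x≈v³ → F.*-≉0 (v≉r ∘ F.x-y≈0⇒x≈y _ _) (F.*-≉0 (v≉r₁ ∘ F.x-y≈0⇒x≈y _ _) (v≉r₂ ∘ F.x-y≈0⇒x≈y _ _))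
          (F.trans (factorisation v) (F.x≈y⇒x-y≈0 (F.sym x≈v³))))
        (solve 0 (:# 0 := :# 0 :+ :# 0 :+ :# 0) refl)
    by-cases (no ∄) = begin
      ∑[ v ] 𝟙 (x F.≟ v F.* v F.* v)        ≈⟨ ∑-cong (λ v → 𝟙-no (x F.≟ _) (λ x≈v³ → ∄ (v , F.sym x≈v³))) ⟩
      ∑[ v ] 0#                             ≈⟨ ∑-0 ⟩
      0#                                    ≈⟨ vanishing (i ℕ.% 3) ≡.refl ⟨
      (t ^ (i ℕ.% 3)) ^ 6 + (t ^ (i ℕ.% 3)) ^ 4 + (t ^ (i ℕ.% 3)) ^ 2
        ≈⟨ solve 1 (λ a → a :^ 6 :+ a :^ 4 :+ a :^ 2 := (a :^ 2) :^ 3 :+ (a :^ 2) :^ 2 :+ a :^ 2) refl (t ^ (i ℕ.% 3)) ⟩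
      ((t ^ (i ℕ.% 3)) ^ 2) ^ 3 + ((t ^ (i ℕ.% 3)) ^ 2) ^ 2 + (t ^ (i ℕ.% 3)) ^ 2
        ≈⟨ +-cong (+-cong (^-congˡ 3 αx²≈) (^-congˡ 2 αx²≈)) αx²≈ ⟨
      (α x ^ 2) ^ 3 + (α x ^ 2) ^ 2 + α x ^ 2 ≈⟨ solve 1 (λ a → (a :^ 2) :^ 3 :+ (a :^ 2) :^ 2 :+ a :^ 2 := a :^ 6 :+ a :^ 4 :+ a :^ 2) refl (α x) ⟩
      α x ^ 6 + α x ^ 4 + α x ^ 2           ∎
      where
      i = proj₁ (F.generates x≉0)
      x≈g^i : x F.≈ F.g F.^ i
      x≈g^i = proj₂ (F.generates x≉0)

      -- Since `t ^ 6 ≈ 1#`, only `i` modulo 3 matters. This leaves two nonzero residues, for each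
      -- of which the sum is a multiple of `t² - t + 1`.
      αx²≈ : α x ^ 2 ≈ (t ^ (i ℕ.% 3)) ^ 2
      αx²≈ = begin
        α x ^ 2                                           ≈⟨ ^-congˡ 2 (α-power {x} {i} x≈g^i) ⟩
        (t ^ i) ^ 2                                       ≈⟨ ^-congˡ 2 (^-congʳ t (ℕ.m≡m%n+[m/n]*n i 3)) ⟩
        (t ^ (i ℕ.% 3 ℕ.+ i ℕ./ 3 ℕ.* 3)) ^ 2             ≈⟨ ^-congˡ 2 (^-homo-* t (i ℕ.% 3) (i ℕ./ 3 ℕ.* 3)) ⟩
        (t ^ (i ℕ.% 3) * t ^ (i ℕ./ 3 ℕ.* 3)) ^ 2         ≈⟨ ^-distrib-* (t ^ (i ℕ.% 3)) _ 2 ⟩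
        (t ^ (i ℕ.% 3)) ^ 2 * (t ^ (i ℕ./ 3 ℕ.* 3)) ^ 2   ≈⟨ *-congˡ (trans (^-assocʳ t (i ℕ./ 3 ℕ.* 3) 2) (^-congʳ t (ℕ.*-assoc (i ℕ./ 3) 3 2))) ⟩
        (t ^ (i ℕ.% 3)) ^ 2 * t ^ (i ℕ./ 3 ℕ.* 6)         ≈⟨ *-congˡ (trans (^-congʳ t (ℕ.*-comm (i ℕ./ 3) 6)) (sym (^-assocʳ t 6 (i ℕ./ 3)))) ⟩
        (t ^ (i ℕ.% 3)) ^ 2 * (t ^ 6) ^ (i ℕ./ 3)         ≈⟨ *-congˡ (trans (^-congˡ (i ℕ./ 3) (w⁶≈1 αg-primitive)) (1^n≈1 (i ℕ./ 3))) ⟩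
        (t ^ (i ℕ.% 3)) ^ 2 * 1#                          ≈⟨ *-identityʳ _ ⟩
        (t ^ (i ℕ.% 3)) ^ 2                               ∎

      vanishing : ∀ r → i ℕ.% 3 ≡ r → (t ^ r) ^ 6 + (t ^ r) ^ 4 + (t ^ r) ^ 2 ≈ 0#
      vanishing 0 i%3≡0 = contradiction (F.IsCube-g^ {i = i} x≈g^i (ℕ.m%n≡0⇒n∣m i 3 i%3≡0)) ∄
      vanishing 1 _ = begin
        (t ^ 1) ^ 6 + (t ^ 1) ^ 4 + (t ^ 1) ^ 2          ≈⟨ solve 1 (λ t → (t :^ 1) :^ 6 :+ (t :^ 1) :^ 4 :+ (t :^ 1) :^ 2
                                                              := t :^ 2 :* (t :* t :+ t :+ :# 1) :* (t :* t :- t :+ :# 1)) refl t ⟩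
        t ^ 2 * (t * t + t + 1#) * (t * t - t + 1#)      ≈⟨ trans (*-congˡ αg-primitive) (zeroʳ _) ⟩
        0#                                               ∎
      vanishing 2 _ = begin
        (t ^ 2) ^ 6 + (t ^ 2) ^ 4 + (t ^ 2) ^ 2          ≈⟨ solve 1 (λ t → (t :^ 2) :^ 6 :+ (t :^ 2) :^ 4 :+ (t :^ 2) :^ 2
                                                              := t :^ 4 :* (t :^ 4 :- t :^ 2 :+ :# 1) :* (t :* t :+ t :+ :# 1) :* (t :* t :- t :+ :# 1)) refl t ⟩
        t ^ 4 * (t ^ 4 - t ^ 2 + 1#) * (t * t + t + 1#) * (t * t - t + 1#) ≈⟨ trans (*-congˡ αg-primitive) (zeroʳ _) ⟩
        0#                                               ∎
      vanishing (suc (suc (suc r))) i%3≡ = contradiction (ℕ.m%n<n i 3)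
        (ℕ.≤⇒≯ (≡.subst (3 ℕ.≤_) (≡.sym i%3≡) (ℕ.s≤s (ℕ.s≤s (ℕ.s≤s ℕ.z≤n)))))

  -- α ^ 6 is the indicator function of the nonzero elements, and α ^ 4 and α ^ 2 are
  -- the two nontrivial cubic characters.
  α⁶α²≈α² : ∀ x → α x ^ 6 * α x ^ 2 ≈ α x ^ 2
  α⁶α²≈α² x = by-cases (x F.≟ F.0#)
    where
    by-cases : Dec (x F.≈ F.0#) → α x ^ 6 * α x ^ 2 ≈ α x ^ 2
    by-cases (yes x≈0) = trans (*-congˡ αx²≈0) (trans (zeroʳ _) (sym αx²≈0))
      where
      αx²≈0 : α x ^ 2 ≈ 0#
      αx²≈0 = trans (*-congʳ (α-x≈0 x≈0)) (zeroˡ _)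
    by-cases (no x≉0) = trans (*-congʳ (α⁶≈1 x≉0)) (*-identityˡ _)

  α[x⁻¹]⁴≈α² : ∀ x → α (x F.⁻¹) ^ 4 ≈ α x ^ 2
  α[x⁻¹]⁴≈α² x = by-cases (x F.≟ F.0#)
    where
    by-cases : Dec (x F.≈ F.0#) → α (x F.⁻¹) ^ 4 ≈ α x ^ 2
    by-cases (yes x≈0) = trans (*-congʳ (α-x≈0 (F.x≈0⇒x⁻¹≈0 x≈0)))
      (trans (zeroˡ _) (sym (trans (*-congʳ (α-x≈0 x≈0)) (zeroˡ _))))
    by-cases (no x≉0) = begin
      β ^ 4                       ≈⟨ *-identityˡ _ ⟨
      1# * β ^ 4                  ≈⟨ *-congʳ (α⁶≈1 x≉0) ⟨
      α x ^ 6 * β ^ 4             ≈⟨ solve 2 (λ a b → a :^ 6 :* b :^ 4 := a :^ 2 :* (a :* b) :^ 4) refl (α x) β ⟩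
      α x ^ 2 * (α x * β) ^ 4     ≈⟨ *-congˡ (trans (^-congˡ 4 (α-⁻¹ x≉0)) (1^n≈1 4)) ⟩
      α x ^ 2 * 1#                ≈⟨ *-identityʳ _ ⟩
      α x ^ 2                     ∎
      where β = α (x F.⁻¹)

  -- The weight `α v ^ 6` discards `v = 0`, where the convention for inverses would make `v + v⁻¹` a
  -- spurious 0. For nonzero `v`, the fibre over `w` is the root set of a quadratic of discriminant
  -- `Δ w`.
  ∑-x+x⁻¹ : ∀ {G : F.Carrier → Carrier} → G Preserves F._≈_ ⟶ _≈_ →
            ∑[ v ] (α v ^ 6 * G (v F.+ v F.⁻¹)) ≈ ∑[ w ] ((1# + φ (F.Δ w)) * G w)
  ∑-x+x⁻¹ G-cong = ∑-fibres (λ v → α v ^ 6) (λ v → v F.+ v F.⁻¹) (λ w → 1# + φ (F.Δ w)) G-cong λ w → *-congʳ (count w)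
    where
    module _ (w : F.Carrier) where
      summand : ∀ v → Dec (v F.≈ F.0#) → α v ^ 6 * 𝟙 (w F.≟ v F.+ v F.⁻¹) ≈ 𝟙 (v F.* v F.+ (F.- w) F.* v F.+ F.1# F.≟ F.0#)
      summand v (yes v≈0) = trans
        (trans (*-congʳ (trans (*-congʳ (α-x≈0 v≈0)) (zeroˡ _))) (zeroˡ _))
        (sym (𝟙-no (_ F.≟ _) λ eq → F.1≉0 (F.trans (F.sym (F.trans
          (F.+-congʳ (F.+-cong (F.trans (F.*-congʳ v≈0) (F.zeroˡ v)) (F.trans (F.*-congˡ v≈0) (F.zeroʳ _))))
          (F.trans (F.+-congʳ (F.+-identityˡ F.0#)) (F.+-identityˡ F.1#)))) eq)))
      summand v (no v≉0) = trans (*-congʳ (α⁶≈1 v≉0)) (trans (*-identityˡ _) (𝟙-cong (_ F.≟ _) (_ F.≟ _)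
        (λ w≈v+v⁻¹ → F.trans (F.sym (F.x+x⁻¹-quadratic v≉0 w))
          (F.trans (F.*-congˡ (F.x≈y⇒x-y≈0 (F.sym w≈v+v⁻¹))) (F.zeroʳ v)))
        (λ eq → F.sym (F.x-y≈0⇒x≈y _ _ (F.x≉0∧xy≈0⇒y≈0 v≉0 (F.trans (F.x+x⁻¹-quadratic v≉0 w) eq))))))

      count : ∑[ v ] (α v ^ 6 * 𝟙 (w F.≟ v F.+ v F.⁻¹)) ≈ 1# + φ (F.Δ w)
      count = begin
        ∑[ v ] (α v ^ 6 * 𝟙 (w F.≟ v F.+ v F.⁻¹))                       ≈⟨ ∑-cong (λ v → summand v (v F.≟ F.0#)) ⟩
        ∑[ v ] 𝟙 (v F.* v F.+ (F.- w) F.* v F.+ F.1# F.≟ F.0#)          ≈⟨ ∑-quadraticRoots (F.- w) F.1# ⟩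
        1# + φ ((F.- w) F.* (F.- w) F.- F.fromℕ 4 F.* F.1#)             ≈⟨ +-congˡ (φ-cong (F.solve 1
                                                                             (λ w → (F.:- w) F.:* (F.:- w) F.:- F.:# 4 F.:* F.:# 1 F.:= w F.:* w F.:- F.:# 4) F.refl w)) ⟩
        1# + φ (F.Δ w)                                                  ∎

  module _ {G : F.Carrier → Carrier} (G-cong : G Preserves F._≈_ ⟶ _≈_) where

    private
      G[u+u⁻¹]-cong : (λ u → G (u F.+ u F.⁻¹)) Preserves F._≈_ ⟶ _≈_
      G[u+u⁻¹]-cong eq = G-cong (F.+-cong eq (F.⁻¹-cong eq))

    -- The change of variable `u = v³`: the weight on the right counts the cube roots of `u`.
    ∑-x³+x⁻³ : ∑[ v ] (α v ^ 6 * G (F.D (v F.+ v F.⁻¹)))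
               ≈ ∑[ u ] ((α u ^ 6 + α u ^ 4 + α u ^ 2) * G (u F.+ u F.⁻¹))
    ∑-x³+x⁻³ = begin
      ∑[ v ] (α v ^ 6 * G (F.D (v F.+ v F.⁻¹)))   ≈⟨ ∑-cong (λ v → summand v (v F.≟ F.0#)) ⟨
      ∑[ v ] (1# * f (v F.* v F.* v))             ≈⟨ ∑-fibres (λ _ → 1#) (λ v → v F.* v F.* v) N f-cong (λ u → count u (u F.≟ F.0#)) ⟩
      ∑[ u ] (N u * f u)                          ≈⟨ ∑-cong N*α⁶ ⟩
      ∑[ u ] (N u * G (u F.+ u F.⁻¹))             ∎
      where
      N f : F.Carrier → Carrier
      N u = α u ^ 6 + α u ^ 4 + α u ^ 2
      -- The factor `α u ^ 6` makes `f` vanish at 0, where there is one cube root but `N` is 0. It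
      -- is absorbed at the end, as every term of `N` contains `α u ^ 2`.
      f u = α u ^ 6 * G (u F.+ u F.⁻¹)

      f-cong : f Preserves F._≈_ ⟶ _≈_
      f-cong eq = *-cong (^-congˡ 6 (α-cong eq)) (G[u+u⁻¹]-cong eq)

      f-0 : ∀ {u} → u F.≈ F.0# → f u ≈ 0#
      f-0 u≈0 = trans (*-congʳ (trans (*-congʳ (α-x≈0 u≈0)) (zeroˡ _))) (zeroˡ _)

      count : ∀ u → Dec (u F.≈ F.0#) → (∑[ v ] (1# * 𝟙 (u F.≟ v F.* v F.* v))) * f u ≈ N u * f u
      count u (yes u≈0) = trans (trans (*-congˡ (f-0 u≈0)) (zeroʳ _)) (sym (trans (*-congˡ (f-0 u≈0)) (zeroʳ _)))
      count u (no u≉0) = *-congʳ (trans (∑-cong (λ v → *-identityˡ _)) (∑-cubeRoots u≉0))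

      N*α⁶ : ∀ u → N u * f u ≈ N u * G (u F.+ u F.⁻¹)
      N*α⁶ u = begin
        N u * (a ^ 6 * G′)                              ≈⟨ solve 2 (λ a g → (a :^ 6 :+ a :^ 4 :+ a :^ 2) :* (a :^ 6 :* g)
                                                            := a :^ 6 :* a :^ 2 :* ((a :^ 4 :+ a :^ 2 :+ :# 1) :* g)) refl a G′ ⟩
        a ^ 6 * a ^ 2 * ((a ^ 4 + a ^ 2 + 1#) * G′)     ≈⟨ *-congʳ (α⁶α²≈α² u) ⟩
        a ^ 2 * ((a ^ 4 + a ^ 2 + 1#) * G′)             ≈⟨ solve 2 (λ a g → a :^ 2 :* ((a :^ 4 :+ a :^ 2 :+ :# 1) :* g)
                                                            := (a :^ 6 :+ a :^ 4 :+ a :^ 2) :* g) refl a G′ ⟩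
        N u * G′                                        ∎
        where
        a = α u
        G′ = G (u F.+ u F.⁻¹)

      summand : ∀ v → Dec (v F.≈ F.0#) → 1# * f (v F.* v F.* v) ≈ α v ^ 6 * G (F.D (v F.+ v F.⁻¹))
      summand v (yes v≈0) = trans (*-congˡ (f-0 (F.trans (F.*-congˡ v≈0) (F.zeroʳ _))))
        (trans (zeroʳ _) (sym (trans (*-congʳ (trans (*-congʳ (α-x≈0 v≈0)) (zeroˡ _))) (zeroˡ _))))
      summand v (no v≉0) = trans (*-identityˡ _) (*-cong
        (trans (α⁶≈1 (F.*-≉0 (F.*-≉0 v≉0 v≉0) v≉0)) (sym (α⁶≈1 v≉0)))
        (G-cong (F.D-x+x⁻¹ v≉0)))

    -- The weight is 0 where `Δ w` is a nonzero square; where `Δ w` is 0, `D` fixes `w`; elsewhere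
    -- `π` is `D`. So `D` may be replaced by the permutation `π`, which also preserves the weight.
    ∑-nonsplit : ∑[ w ] ((1# - φ (F.Δ w)) * G (F.D w)) ≈ ∑[ w ] ((1# - φ (F.Δ w)) * G w)
    ∑-nonsplit = trans (∑-cong summand) (∑-substitution F.π-cong F.π-injective
      (λ eq → *-cong (+-congˡ (-‿cong (φ-cong (F.Δ-cong eq)))) (G-cong eq)))
      where
      summand : ∀ w → (1# - φ (F.Δ w)) * G (F.D w) ≈ (1# - φ (F.Δ (F.π w))) * G (F.π w)
      summand w with F.isSquare? (F.Δ w)
      ... | no ¬□  = *-congʳ (+-congˡ (-‿cong (trans (φ-nonsquare ¬□) (sym (φ-nonsquare (F.D-nonsplit ¬□))))))
      ... | yes (s , s²≈Δ) = by-cases (s F.≟ F.0#)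
        where
        by-cases : Dec (s F.≈ F.0#) → (1# - φ (F.Δ w)) * G (F.D w) ≈ (1# - φ (F.Δ w)) * G w
        by-cases (yes s≈0) = *-congˡ (G-cong (F.D-fixes-Δ≈0 (F.trans (F.sym s²≈Δ) (F.trans (F.*-congʳ s≈0) (F.zeroˡ s)))))
        by-cases (no s≉0) = trans (trans (*-congʳ 1-φ≈0) (zeroˡ _)) (sym (trans (*-congʳ 1-φ≈0) (zeroˡ _)))
          where
          1-φ≈0 : 1# - φ (F.Δ w) ≈ 0#
          1-φ≈0 = x≈y⇒x-y≈0 (sym (trans (φ-cong (F.sym s²≈Δ)) (φ-square s≉0)))

    ∑-cubicCharacter : ∑[ u ] (α u ^ 4 * G (u F.+ u F.⁻¹)) ≈ ∑[ w ] G (F.D w) - ∑[ w ] G w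
    ∑-cubicCharacter = fromℕ-*-cancelˡ 2 (begin
      fromℕ 2 * S₄                      ≈⟨ solve 3 (λ s e n → :# 2 :* s := (e :+ s :+ s :+ n) :- (e :+ n)) refl S₄ split nonsplit ⟩
      (split + S₄ + S₄ + nonsplit) - (split + nonsplit)
                                        ≈⟨ +-cong (+-congʳ three-sums) (-‿cong (both G)) ⟩
      (splitD + nonsplit) - fromℕ 2 * ∑ G
                                        ≈⟨ +-congʳ (trans (+-congˡ (sym ∑-nonsplit)) (both (G ∘ F.D))) ⟩
      fromℕ 2 * ∑ (G ∘ F.D) - fromℕ 2 * ∑ G
                                        ≈⟨ solve 2 (λ x y → :# 2 :* x :- :# 2 :* y := :# 2 :* (x :- y)) refl (∑ (G ∘ F.D)) (∑ G) ⟩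
      fromℕ 2 * (∑ (G ∘ F.D) - ∑ G)     ∎)
      where
      S₄       = ∑[ u ] (α u ^ 4 * G (u F.+ u F.⁻¹))
      split    = ∑[ w ] ((1# + φ (F.Δ w)) * G w)
      nonsplit = ∑[ w ] ((1# - φ (F.Δ w)) * G w)
      splitD   = ∑[ w ] ((1# + φ (F.Δ w)) * G (F.D w))

      both : ∀ H → ∑[ w ] ((1# + φ (F.Δ w)) * H w) + ∑[ w ] ((1# - φ (F.Δ w)) * H w) ≈ fromℕ 2 * ∑[ w ] H w
      both H = begin
        ∑[ w ] ((1# + φ (F.Δ w)) * H w) + ∑[ w ] ((1# - φ (F.Δ w)) * H w)   ≈⟨ ∑-+ _ _ ⟨
        ∑[ w ] ((1# + φ (F.Δ w)) * H w + (1# - φ (F.Δ w)) * H w)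
          ≈⟨ ∑-cong (λ w → solve 2 (λ p h → (:# 1 :+ p) :* h :+ (:# 1 :- p) :* h := :# 2 :* h) refl (φ (F.Δ w)) (H w)) ⟩
        ∑[ w ] (fromℕ 2 * H w)                                             ≈⟨ ∑-*ˡ _ _ ⟩
        fromℕ 2 * ∑[ w ] H w                                               ∎

      -- Inversion interchanges the two conjugate cubic characters and fixes `u + u ⁻¹`; this is the
      -- source of the factor 2.
      S₂≈S₄ : ∑[ u ] (α u ^ 2 * G (u F.+ u F.⁻¹)) ≈ S₄
      S₂≈S₄ = begin
        ∑[ u ] (α u ^ 2 * G (u F.+ u F.⁻¹))                         ≈⟨ ∑-cong (λ u → *-cong (α[x⁻¹]⁴≈α² u)
                                                                        (G-cong (F.trans (F.+-congˡ (F.⁻¹-involutive u)) (F.+-comm _ _)))) ⟨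
        ∑[ u ] (α (u F.⁻¹) ^ 4 * G (u F.⁻¹ F.+ (u F.⁻¹) F.⁻¹))      ≈⟨ ∑-substitution {f = λ u → α u ^ 4 * G (u F.+ u F.⁻¹)} F.⁻¹-cong F.⁻¹-injective
                                                                        (λ eq → *-cong (^-congˡ 4 (α-cong eq)) (G[u+u⁻¹]-cong eq)) ⟩
        S₄                                                          ∎

      three-sums : split + S₄ + S₄ ≈ splitD
      three-sums = begin
        split + S₄ + S₄
          ≈⟨ +-cong (+-congʳ (sym (∑-x+x⁻¹ G-cong))) (sym S₂≈S₄) ⟩
        ∑[ u ] (α u ^ 6 * G (u F.+ u F.⁻¹)) + S₄ + ∑[ u ] (α u ^ 2 * G (u F.+ u F.⁻¹))
          ≈⟨ trans (∑-+ _ _) (+-congʳ (∑-+ _ _)) ⟨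
        ∑[ u ] (α u ^ 6 * G (u F.+ u F.⁻¹) + α u ^ 4 * G (u F.+ u F.⁻¹) + α u ^ 2 * G (u F.+ u F.⁻¹))
          ≈⟨ ∑-cong (λ u → solve 4 (λ a b c g → a :* g :+ b :* g :+ c :* g := (a :+ b :+ c) :* g) refl (α u ^ 6) (α u ^ 4) (α u ^ 2) (G (u F.+ u F.⁻¹))) ⟩
        ∑[ u ] ((α u ^ 6 + α u ^ 4 + α u ^ 2) * G (u F.+ u F.⁻¹))
          ≈⟨ ∑-x³+x⁻³ ⟨
        ∑[ v ] (α v ^ 6 * G (F.D (v F.+ v F.⁻¹)))
          ≈⟨ ∑-x+x⁻¹ {G ∘ F.D} (G-cong ∘ F.D-cong) ⟩
        splitD ∎

  αg#1 : t # 1#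
  αg#1 = x^n#1⇒x#1 t 2 (w²#1 αg-primitive)

  φg#1 : φ F.g # 1#
  φg#1 = #-sym (#-congˡ (sym (w³≈-1 αg-primitive)) 1#-1)

  ∑-φ-translate : ∀ s → ∑[ w ] φ (w F.+ s) ≈ 0#
  ∑-φ-translate s = trans (∑-substitution F.+-congʳ (F.+-cancelʳ s _ _) φ-cong) (∑-φ≈0 F.g≉0 φg#1)

  module _ {z : F.Carrier} (z≉0 : z F.≉ F.0#) (z≉1 : z F.≉ F.1#) where
    open F.RationalFunction z

    private
      shift = F.fromℕ 2 F.- F.fromℕ 4 F.* z

      N : F.Carrier → Carrier
      N u = 1# + φ ((F.- (F.1# F.+ u)) F.* (F.- (F.1# F.+ u)) F.- F.fromℕ 4 F.* (u F.* z))

    ∑-α∘R : ∑[ y ] α (R y) ≈ ∑[ u ] (N u * α u)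
    ∑-α∘R = begin
      ∑[ y ] α (R y)          ≈⟨ ∑-cong (λ y → *-identityˡ _) ⟨
      ∑[ y ] (1# * α (R y))   ≈⟨ ∑-fibres (λ _ → 1#) R N α-cong (λ u → count u (u F.≟ F.0#)) ⟩
      ∑[ u ] (N u * α u)      ∎
      where
      count : ∀ u → Dec (u F.≈ F.0#) → (∑[ y ] (1# * 𝟙 (u F.≟ R y))) * α u ≈ N u * α u
      count u (yes u≈0) = trans (trans (*-congˡ (α-x≈0 u≈0)) (zeroʳ _)) (sym (trans (*-congˡ (α-x≈0 u≈0)) (zeroʳ _)))
      count u (no u≉0) = *-congʳ (begin
        ∑[ y ] (1# * 𝟙 (u F.≟ R y))           ≈⟨ ∑-cong (λ y → trans (*-identityˡ _) (𝟙-cong (_ F.≟ _) (_ F.≟ _)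
                                                   (R-fibre⇒quadratic u≉0) (quadratic⇒R-fibre z≉0 z≉1))) ⟩
        ∑[ y ] 𝟙 (quadratic u y F.≟ F.0#)     ≈⟨ ∑-quadraticRoots (F.- (F.1# F.+ u)) (u F.* z) ⟩
        N u                                   ∎)

    -- The left side is the sum in Greene's series for `A = α`, `B = α⁻¹`, `C = ε` at `z`, without
    -- its prefactor; the linear term `∑ α u` drops out because `α` is nontrivial.
    ∑-hypergeometric :
      ∑[ y ] (α (y F.⁻¹) * α (F.1# F.- y) * α ((F.1# F.- z F.* y) F.⁻¹))
      ≈ ∑[ w ] φ (F.D w F.+ shift)
    ∑-hypergeometric = begin
      ∑[ y ] f y                                                ≈⟨ ∑-substitution F.⁻¹-cong F.⁻¹-injective f-cong ⟨
      ∑[ y ] f (y F.⁻¹)                                         ≈⟨ ∑-cong (λ y → invert y (y F.≟ F.0#)) ⟩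
      ∑[ y ] α (R y)                                            ≈⟨ ∑-α∘R ⟩
      ∑[ u ] (N u * α u)                                        ≈⟨ ∑-cong (λ u → discriminant-α u (u F.≟ F.0#)) ⟩
      ∑[ u ] (α u + α u ^ 4 * G (u F.+ u F.⁻¹))                 ≈⟨ ∑-+ _ _ ⟩
      ∑[ u ] α u + ∑[ u ] (α u ^ 4 * G (u F.+ u F.⁻¹))          ≈⟨ +-cong (∑-α≈0 F.g≉0 αg#1) (∑-cubicCharacter (φ-cong ∘ F.+-congʳ)) ⟩
      0# + (∑[ w ] G (F.D w) - ∑[ w ] G w)                      ≈⟨ +-congˡ (+-congˡ (-‿cong (∑-φ-translate shift))) ⟩
      0# + (∑[ w ] G (F.D w) - 0#)                              ≈⟨ solve 1 (λ x → :# 0 :+ (x :- :# 0) := x) refl _ ⟩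
      ∑[ w ] φ (F.D w F.+ shift)                                ∎
      where
      f G : F.Carrier → Carrier
      f y = α (y F.⁻¹) * α (F.1# F.- y) * α ((F.1# F.- z F.* y) F.⁻¹)
      G x = φ (x F.+ shift)

      f-cong : f Preserves F._≈_ ⟶ _≈_
      f-cong eq = *-cong (*-cong (α-cong (F.⁻¹-cong eq)) (α-cong (F.+-congˡ (F.-‿cong eq))))
        (α-cong (F.⁻¹-cong (F.+-congˡ (F.-‿cong (F.*-congˡ eq)))))

      invert : ∀ y → Dec (y F.≈ F.0#) → f (y F.⁻¹) ≈ α (R y)
      invert y (yes y≈0) = trans (trans (*-congʳ (trans (*-congʳ (α-x≈0 (F.trans (F.⁻¹-involutive y) y≈0))) (zeroˡ _))) (zeroˡ _))
        (sym (α-x≈0 (R-0 y≈0)))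
      invert y (no y≉0) = begin
        f (y F.⁻¹)
          ≈⟨ *-congʳ (*-congʳ (α-cong (F.⁻¹-involutive y))) ⟩
        α y * α (F.1# F.- y F.⁻¹) * α ((F.1# F.- z F.* y F.⁻¹) F.⁻¹)
          ≈⟨ trans (α-* _ _) (*-congʳ (α-* _ _)) ⟨
        α (y F.* (F.1# F.- y F.⁻¹) F.* (F.1# F.- z F.* y F.⁻¹) F.⁻¹)
          ≈⟨ α-cong (R-reciprocal y≉0) ⟩
        α (R y) ∎

      discriminant-α : ∀ u → Dec (u F.≈ F.0#) → N u * α u ≈ α u + α u ^ 4 * G (u F.+ u F.⁻¹)
      discriminant-α u (yes u≈0) = trans (trans (*-congˡ (α-x≈0 u≈0)) (zeroʳ _))
        (sym (trans (+-cong (α-x≈0 u≈0) (trans (*-congʳ (trans (*-congʳ (α-x≈0 u≈0)) (zeroˡ _))) (zeroˡ _))) (+-identityˡ 0#)))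
      discriminant-α u (no u≉0) = begin
        N u * α u                                       ≈⟨ *-congʳ (+-congˡ (trans (φ-cong (discriminant u≉0)) (φ-* _ _))) ⟩
        (1# + φ u * G (u F.+ u F.⁻¹)) * α u             ≈⟨ solve 2 (λ a g → (:# 1 :+ a :^ 3 :* g) :* a := a :+ a :^ 4 :* g) refl (α u) _ ⟩
        α u + α u ^ 4 * G (u F.+ u F.⁻¹)                ∎

-- The cubic at its critical point.

module CubicNormalForm {c ℓ} (𝔽 : FiniteField c ℓ) where
  open FiniteField 𝔽 hiding (zero)
  open FiniteFieldProperties 𝔽
  open IntegerCoefficients commutativeRing
  open Relation.Binary.Reasoning.Setoid setoid

  -- Connects the iterated sums in the definitions of `d` and `X` with the integer constants of the
  -- solver.
  ·≈fromℕ* : ∀ n x → n · x ≈ fromℕ n * x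
  ·≈fromℕ* n x = begin
    n · x          ≈⟨ ×-congʳ n (*-identityˡ x) ⟨
    n · (1# * x)   ≈⟨ ×-assoc-* n 1# x ⟨
    (n · 1#) * x   ≈⟨ *-congʳ (fromℕ≈· n) ⟨
    fromℕ n * x    ∎
    where open Algebra.Properties.Semiring.Mult semiring using (×-congʳ; ×-assoc-*)

  x+y≉0 : ∀ {h x y} → x ≉ y → h + x ≈ 0# → h + y ≉ 0#
  x+y≉0 {h} {x} {y} x≉y h+x≈0 h+y≈0 = x≉y (x-y≈0⇒x≈y _ _ (begin
    x - y               ≈⟨ solve 3 (λ h x y → x :- y := (h :+ x) :- (h :+ y)) refl h x y ⟩
    (h + x) - (h + y)   ≈⟨ +-cong h+x≈0 (-‿cong h+y≈0) ⟩
    0# - 0#             ≈⟨ -‿inverseʳ 0# ⟩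
    0#                  ∎))

  module Cubic (a b c h : Carrier) where
    -- For `f(x) = (x+a)(x+b)(x+c)` the Taylor expansion at `h` is
    -- `f(h+y) = y³ + d y² + f'(h) y + e`, and the equation for `h` says `f'(h) = 0`.
    d = 3 · h + a + b + c
    e = h ^ 3 + (a + b + c) * h ^ 2 + (a * b + b * c + c * a) * h + a * b * c
    X = - ((27 · e) ÷ (4 · (d ^ 3)))

    module CriticalPoint
      (2≉0 : fromℕ 2 ≉ 0#) (3≉0 : fromℕ 3 ≉ 0#) (a≉b : a ≉ b) (b≉c : b ≉ c) (a≉c : a ≉ c)
      (critical : 3 · (h ^ 2) + 2 · ((a + b + c) * h) + (a * b + b * c + c * a) ≈ 0#) (d≉0 : d ≉ 0#)
      where
      private
        A = h + a
        B = h + b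
        C = h + c

        d≈A+B+C : d ≈ A + B + C
        d≈A+B+C = solve 4 (λ a b c h → 3 :× h :+ a :+ b :+ c := (h :+ a) :+ (h :+ b) :+ (h :+ c)) refl a b c h

        e≈ABC : e ≈ A * B * C
        e≈ABC = solve 4 (λ a b c h → h :^ 3 :+ (a :+ b :+ c) :* h :^ 2 :+ (a :* b :+ b :* c :+ c :* a) :* h :+ a :* b :* c
          := (h :+ a) :* (h :+ b) :* (h :+ c)) refl a b c h

        AB+BC+CA≈0 : A * B + B * C + C * A ≈ 0#
        AB+BC+CA≈0 = trans (solve 4 (λ a b c h → (h :+ a) :* (h :+ b) :+ (h :+ b) :* (h :+ c) :+ (h :+ c) :* (h :+ a)
          := 3 :× (h :^ 2) :+ 2 :× ((a :+ b :+ c) :* h) :+ (a :* b :+ b :* c :+ c :* a)) refl a b c h) critical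

        -- A critical point of a cubic with simple roots is not a root.
        root-impossible : ∀ {x y z} → x * y + y * z + z * x ≈ 0# → y ≉ 0# → z ≉ 0# → x ≉ 0#
        root-impossible {x} {y} {z} eq y≉0 z≉0 x≈0 = *-≉0 y≉0 z≉0 (begin
          y * z                           ≈⟨ solve 2 (λ y z → y :* z := :# 0 :* y :+ y :* z :+ z :* :# 0) refl y z ⟩
          0# * y + y * z + z * 0#         ≈⟨ +-cong (+-congʳ (*-congʳ x≈0)) (*-congˡ x≈0) ⟨
          x * y + y * z + z * x           ≈⟨ eq ⟩
          0#                              ∎)

        rotate : ∀ {x y z} → x * y + y * z + z * x ≈ 0# → y * z + z * x + x * y ≈ 0#
        rotate {x} {y} {z} eq = trans (solve 3 (λ x y z → y :* z :+ z :* x :+ x :* y := x :* y :+ y :* z :+ z :* x) refl x y z) eq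

        A≉0 : A ≉ 0#
        A≉0 A≈0 = root-impossible AB+BC+CA≈0 (x+y≉0 a≉b A≈0) (x+y≉0 a≉c A≈0) A≈0
        B≉0 : B ≉ 0#
        B≉0 B≈0 = root-impossible (rotate AB+BC+CA≈0) (x+y≉0 b≉c B≈0) (x+y≉0 (a≉b ∘ sym) B≈0) B≈0
        C≉0 : C ≉ 0#
        C≉0 C≈0 = root-impossible (rotate (rotate AB+BC+CA≈0)) (x+y≉0 (a≉c ∘ sym) C≈0) (x+y≉0 (b≉c ∘ sym) C≈0) C≈0

        e≉0 : e ≉ 0#
        e≉0 e≈0 = *-≉0 (*-≉0 A≉0 B≉0) C≉0 (trans (sym e≈ABC) e≈0)

        27≉0 : fromℕ 27 ≉ 0#
        27≉0 27≈0 = *-≉0 (*-≉0 3≉0 3≉0) 3≉0 (trans (solve 0 (:# 3 :* :# 3 :* :# 3 := :# 27) refl) 27≈0)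

        4≉0 : fromℕ 4 ≉ 0#
        4≉0 4≈0 = *-≉0 2≉0 2≉0 (trans (solve 0 (:# 2 :* :# 2 := :# 4) refl) 4≈0)

      -- Δ * Δ is the discriminant of x³ - s x² + q x - p.
      4d³+27e≉0 : fromℕ 4 * d ^ 3 + fromℕ 27 * e ≉ 0#
      4d³+27e≉0 eq = *-≉0 difference≉0 difference≉0 (begin
        Δ * Δ
          ≈⟨ solve 4 (λ a b c h → let A = h :+ a; B = h :+ b; C = h :+ c; s = A :+ B :+ C; q = A :* B :+ B :* C :+ C :* A; p = A :* B :* C in
               (a :- b) :* (b :- c) :* (c :- a) :* ((a :- b) :* (b :- c) :* (c :- a))
               := q :* (s :* s :* q :- :# 4 :* (q :* q) :+ :# 18 :* s :* p) :- p :* (:# 4 :* s :^ 3 :+ :# 27 :* p)) refl a b c h ⟩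
        q * (s * s * q - fromℕ 4 * (q * q) + fromℕ 18 * s * p) - p * (fromℕ 4 * s ^ 3 + fromℕ 27 * p)
          ≈⟨ +-cong (trans (*-congʳ AB+BC+CA≈0) (zeroˡ _))
                    (-‿cong (*-congˡ (+-cong (*-congˡ (^-congˡ 3 (sym d≈A+B+C))) (*-congˡ (sym e≈ABC))))) ⟩
        0# - p * (fromℕ 4 * d ^ 3 + fromℕ 27 * e)
          ≈⟨ +-congˡ (-‿cong (trans (*-congˡ eq) (zeroʳ p))) ⟩
        0# - 0#
          ≈⟨ -‿inverseʳ 0# ⟩
        0# ∎)
        where
        Δ = (a - b) * (b - c) * (c - a)
        s = A + B + C
        q = A * B + B * C + C * A
        p = A * B * C
        difference≉0 : Δ ≉ 0#
        difference≉0 = *-≉0 (*-≉0 (a≉b ∘ x-y≈0⇒x≈y _ _) (b≉c ∘ x-y≈0⇒x≈y _ _)) (a≉c ∘ sym ∘ x-y≈0⇒x≈y _ _)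

      private
        4d³X≈-27e : fromℕ 4 * d ^ 3 * X ≈ - (fromℕ 27 * e)
        4d³X≈-27e = begin
          fromℕ 4 * d ^ 3 * X                 ≈⟨ *-congʳ (·≈fromℕ* 4 (d ^ 3)) ⟨
          (4 · d ^ 3) * X                     ≈⟨ solve 2 (λ x y → x :* (:- y) := :- (y :* x)) refl (4 · d ^ 3) _ ⟩
          - (((27 · e) ÷ (4 · d ^ 3)) * (4 · d ^ 3))  ≈⟨ -‿cong (÷-cancelʳ (27 · e) 4d³≉0) ⟩
          - (27 · e)                          ≈⟨ -‿cong (·≈fromℕ* 27 e) ⟩
          - (fromℕ 27 * e)                    ∎
          where
          4d³≉0 : 4 · d ^ 3 ≉ 0#
          4d³≉0 eq = *-≉0 4≉0 (^-≉0 d≉0 3) (trans (sym (·≈fromℕ* 4 (d ^ 3))) eq)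

      X≉0 : X ≉ 0#
      X≉0 X≈0 = *-≉0 27≉0 e≉0 (begin
        fromℕ 27 * e            ≈⟨ solve 1 (λ x → x := :- (:- x)) refl _ ⟩
        - - (fromℕ 27 * e)      ≈⟨ -‿cong (trans (sym 4d³X≈-27e) (trans (*-congˡ X≈0) (zeroʳ _))) ⟩
        - 0#                    ≈⟨ solve 0 (:- :# 0 := :# 0) refl ⟩
        0#                      ∎)

      -- The value 1 would make the discriminant of the cubic vanish, although its roots are
      -- distinct.
      X≉1 : X ≉ 1#
      X≉1 X≈1 = 4d³+27e≉0 (begin
        fromℕ 4 * d ^ 3 + fromℕ 27 * e        ≈⟨ +-congʳ (*-identityʳ _) ⟨
        fromℕ 4 * d ^ 3 * 1# + fromℕ 27 * e   ≈⟨ +-congʳ (*-congˡ X≈1) ⟨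
        fromℕ 4 * d ^ 3 * X + fromℕ 27 * e    ≈⟨ +-congʳ 4d³X≈-27e ⟩
        - (fromℕ 27 * e) + fromℕ 27 * e       ≈⟨ -‿inverseˡ _ ⟩
        0#                                    ∎)

      scale : Carrier
      scale = d ÷ fromℕ 3

      scale*3≈d : scale * fromℕ 3 ≈ d
      scale*3≈d = ÷-cancelʳ d 3≉0

      scale≉0 : scale ≉ 0#
      scale≉0 s≈0 = d≉0 (trans (sym scale*3≈d) (trans (*-congʳ s≈0) (zeroˡ _)))

      -- Put `y = s(w-1)` in `y³ + d y² + e`. With `d = 3s` the first two terms become
      -- `s³(w-1)²(w+2) = s³(w³ - 3w + 2)`, and `e = -4s³X` by the definition of `X`.
      normalForm : ∀ w → (scale * w + (h - scale) + a) * (scale * w + (h - scale) + b) * (scale * w + (h - scale) + c)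
        ≈ scale * scale * (scale * (w * w * w - fromℕ 3 * w + (fromℕ 2 - fromℕ 4 * X)))
      normalForm w = begin
        (s * w + (h - s) + a) * (s * w + (h - s) + b) * (s * w + (h - s) + c)
          ≈⟨ solve 6 (λ a b c h s w → let A = h :+ a; B = h :+ b; C = h :+ c; y = s :* (w :- :# 1) in
               (s :* w :+ (h :- s) :+ a) :* (s :* w :+ (h :- s) :+ b) :* (s :* w :+ (h :- s) :+ c)
               := s :* s :* (s :* (w :* w :* w :- :# 3 :* w :+ :# 2)) :+ A :* B :* C
                  :+ (A :* B :+ B :* C :+ C :* A) :* y :+ (A :+ B :+ C :- s :* :# 3) :* (y :* y)) refl a b c h s w ⟩
        s * s * (s * (w * w * w - fromℕ 3 * w + fromℕ 2)) + A * B * C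
          + (A * B + B * C + C * A) * (s * (w - 1#)) + (A + B + C - s * fromℕ 3) * (s * (w - 1#) * (s * (w - 1#)))
          ≈⟨ +-cong (+-cong (+-congˡ (trans (sym e≈ABC) e≈-4s³X)) (trans (*-congʳ AB+BC+CA≈0) (zeroˡ _)))
                    (trans (*-congʳ (x≈y⇒x-y≈0 (trans (sym d≈A+B+C) (sym scale*3≈d)))) (zeroˡ _)) ⟩
        s * s * (s * (w * w * w - fromℕ 3 * w + fromℕ 2)) + s * s * s * (- (fromℕ 4 * X)) + 0# + 0#
          ≈⟨ solve 3 (λ s w x → s :* s :* (s :* (w :* w :* w :- :# 3 :* w :+ :# 2)) :+ s :* s :* s :* (:- (:# 4 :* x)) :+ :# 0 :+ :# 0
               := s :* s :* (s :* (w :* w :* w :- :# 3 :* w :+ (:# 2 :- :# 4 :* x)))) refl s w X ⟩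
        s * s * (s * (w * w * w - fromℕ 3 * w + (fromℕ 2 - fromℕ 4 * X))) ∎
        where
        s = scale
        e≈-4s³X : e ≈ s * s * s * (- (fromℕ 4 * X))
        e≈-4s³X = *-cancelˡ-≉0 27≉0 (begin
          fromℕ 27 * e                                      ≈⟨ solve 1 (λ x → x := :- (:- x)) refl _ ⟩
          - - (fromℕ 27 * e)                                ≈⟨ -‿cong 4d³X≈-27e ⟨
          - (fromℕ 4 * d ^ 3 * X)                           ≈⟨ -‿cong (*-congʳ (*-congˡ (^-congˡ 3 scale*3≈d))) ⟨
          - (fromℕ 4 * (s * fromℕ 3) ^ 3 * X)               ≈⟨ solve 2 (λ s x → :- (:# 4 :* (s :* :# 3) :^ 3 :* x)
                                                                 := :# 27 :* (s :* s :* s :* (:- (:# 4 :* x)))) refl s X ⟩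
          fromℕ 27 * (s * s * s * (- (fromℕ 4 * X)))        ∎)

-- From characters of the unit group to functions on the field, and their values at a primitive
-- root.

module CharacterProperties {c ℓ k ℓ₁ ℓ₂} (𝔽 : FiniteField c ℓ) (K : AlgebraicallyClosedField₀ k ℓ₁ ℓ₂) where
  private
    module F where
      open FiniteField 𝔽 public
      open FiniteFieldProperties 𝔽 public
      open PrimitiveRoots 𝔽 public
    module KU = AbelianGroup (unitGroup (AlgebraicallyClosedField₀.commutativeRing K))
    module FU = AbelianGroup (unitGroup F.commutativeRing)
  open Characters 𝔽 K
  open ValueFieldProperties K
  open MultiplicativeFunctions 𝔽 K
  open Relation.Binary.Reasoning.Setoid setoid
  open Unit
  open GroupHomomorphism using (⟦_⟧; ⟦⟧-cong; homo; ε-homo; ⁻¹-homo)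

  unit≉0 : ∀ (u : FU.Carrier) → value u F.≉ F.0#
  unit≉0 u = F.x*y≈1⇒x≉0 (isReciprocal u)

  unit : ∀ {x} → x F.≉ F.0# → FU.Carrier
  unit {x} x≉0 = record { value = x ; value⁻¹ = x F.⁻¹ ; isReciprocal = F.⁻¹-inverseʳ x≉0 }

  ⟨⟩-unit : ∀ χ u → χ ⟨ value u ⟩ ≈ value (⟦ χ ⟧ u)
  ⟨⟩-unit χ u with value u F.≟ F.0#
  ... | yes u≈0 = contradiction u≈0 (unit≉0 u)
  ... | no  _   = ⟦⟧-cong χ F.refl

  ⟨⟩-≉0 : ∀ χ {x} (x≉0 : x F.≉ F.0#) → χ ⟨ x ⟩ ≈ value (⟦ χ ⟧ (unit x≉0))
  ⟨⟩-≉0 χ x≉0 = ⟨⟩-unit χ (unit x≉0)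

  ⟨⟩-≈0 : ∀ χ {x} → x F.≈ F.0# → χ ⟨ x ⟩ ≈ 0#
  ⟨⟩-≈0 χ {x} x≈0 with x F.≟ F.0#
  ... | yes _  = refl
  ... | no x≉0 = contradiction x≈0 x≉0

  ⟨⟩-isMultiplicative : ∀ χ → IsMultiplicative (χ ⟨_⟩)
  ⟨⟩-isMultiplicative χ = record
    { α-cong = λ {x} x≈y → χ-cong x≈y (x F.≟ F.0#)
    ; α-0    = ⟨⟩-≈0 χ F.refl
    ; α-1    = trans (⟨⟩-unit χ FU.ε) (ε-homo χ)
    ; α-*    = λ x y → χ-* (x F.≟ F.0#) (y F.≟ F.0#)
    }
    where
    χ-cong : ∀ {x y} → x F.≈ y → Dec (x F.≈ F.0#) → χ ⟨ x ⟩ ≈ χ ⟨ y ⟩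
    χ-cong x≈y (yes x≈0) = trans (⟨⟩-≈0 χ x≈0) (sym (⟨⟩-≈0 χ (F.trans (F.sym x≈y) x≈0)))
    χ-cong x≈y (no x≉0)  = trans (⟨⟩-≉0 χ x≉0) (trans (⟦⟧-cong χ x≈y) (sym (⟨⟩-≉0 χ (x≉0 ∘ F.trans x≈y))))

    χ-* : ∀ {x y} → Dec (x F.≈ F.0#) → Dec (y F.≈ F.0#) → χ ⟨ x F.* y ⟩ ≈ χ ⟨ x ⟩ * χ ⟨ y ⟩
    χ-* (yes x≈0) _ = trans (⟨⟩-≈0 χ (F.trans (F.*-congʳ x≈0) (F.zeroˡ _)))
      (sym (trans (*-congʳ (⟨⟩-≈0 χ x≈0)) (zeroˡ _)))
    χ-* (no _) (yes y≈0) = trans (⟨⟩-≈0 χ (F.trans (F.*-congˡ y≈0) (F.zeroʳ _)))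
      (sym (trans (*-congˡ (⟨⟩-≈0 χ y≈0)) (zeroʳ _)))
    χ-* (no x≉0) (no y≉0) = trans (⟨⟩-unit χ (unit x≉0 FU.∙ unit y≉0))
      (trans (homo χ (unit x≉0) (unit y≉0)) (sym (*-cong (⟨⟩-≉0 χ x≉0) (⟨⟩-≉0 χ y≉0))))

  ⟨⟩-≈χ : ∀ {χ χ′} → χ ≈χ χ′ → ∀ x → χ ⟨ x ⟩ ≈ χ′ ⟨ x ⟩
  ⟨⟩-≈χ χ≈χ′ x with x F.≟ F.0#
  ... | yes _ = refl
  ... | no  _ = χ≈χ′ _

  ⟨⟩-∙ : ∀ χ χ′ x → (χ ∙χ χ′) ⟨ x ⟩ ≈ χ ⟨ x ⟩ * χ′ ⟨ x ⟩
  ⟨⟩-∙ χ χ′ x with x F.≟ F.0#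
  ... | yes _ = sym (zeroˡ 0#)
  ... | no  _ = refl

  ⟨⟩-ε : ∀ {x} → x F.≉ F.0# → ε ⟨ x ⟩ ≈ 1#
  ⟨⟩-ε = ⟨⟩-≉0 ε

  ⟨⟩-∙ε : ∀ χ x → (χ ∙χ ε) ⟨ x ⟩ ≈ χ ⟨ x ⟩
  ⟨⟩-∙ε χ x with x F.≟ F.0#
  ... | yes _ = refl
  ... | no  _ = *-identityʳ _

  ⟨⟩-⁻¹ : ∀ χ x → (χ ⁻¹χ) ⟨ x ⟩ ≈ χ ⟨ x F.⁻¹ ⟩
  ⟨⟩-⁻¹ χ x = by-cases (x F.≟ F.0#)
    where
    by-cases : Dec (x F.≈ F.0#) → (χ ⁻¹χ) ⟨ x ⟩ ≈ χ ⟨ x F.⁻¹ ⟩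
    by-cases (yes x≈0) = trans (⟨⟩-≈0 (χ ⁻¹χ) x≈0) (sym (⟨⟩-≈0 χ (F.x≈0⇒x⁻¹≈0 x≈0)))
    by-cases (no x≉0) = trans (⟨⟩-≉0 (χ ⁻¹χ) x≉0)
      (trans (sym (⁻¹-homo χ (unit x≉0))) (sym (⟨⟩-unit χ (unit x≉0 FU.⁻¹))))

  ⟨⟩-^ : ∀ χ n {x} → x F.≉ F.0# → (χ ^χ n) ⟨ x ⟩ ≈ χ ⟨ x ⟩ ^ n
  ⟨⟩-^ χ zero    x≉0 = ⟨⟩-ε x≉0
  ⟨⟩-^ χ (suc n) {x} x≉0 = trans (⟨⟩-∙ χ (χ ^χ n) x) (*-congˡ (⟨⟩-^ χ n x≉0))

  ∘⁻¹-isMultiplicative : ∀ {α} → IsMultiplicative α → IsMultiplicative (λ x → α (x F.⁻¹))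
  ∘⁻¹-isMultiplicative α-mult = record
    { α-cong = α-cong ∘ F.⁻¹-cong
    ; α-0    = trans (α-cong (F.x≈0⇒x⁻¹≈0 F.refl)) α-0
    ; α-1    = trans (α-cong (F.sym (F.⁻¹-unique (F.*-identityˡ F.1#)))) α-1
    ; α-*    = λ x y → trans (α-cong (F.⁻¹-distrib-* x y)) (α-* _ _)
    }
    where open IsMultiplicative α-mult

  module _ (primitiveRoot : F.PrimitiveRoot) where
    open F.PrimitiveRoot primitiveRoot

    private n = F.order ℕ.∸ 1

    -- Reduces every identity between characters, such as `φ = α³`, to a single value, as all
    -- nonzero elements are powers of `g`.
    determined-by-g : ∀ {α β} → IsMultiplicative α → IsMultiplicative β → α g ≈ β g → ∀ x → α x ≈ β x
    determined-by-g {α} {β} α-mult β-mult αg≈βg x = by-cases (x F.≟ F.0#)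
      where
      module α = IsMultiplicative α-mult
      module β = IsMultiplicative β-mult
      by-cases : Dec (x F.≈ F.0#) → α x ≈ β x
      by-cases (yes x≈0) = trans (α.α-x≈0 x≈0) (sym (β.α-x≈0 x≈0))
      by-cases (no x≉0) with i , x≈g^i ← generates x≉0 = begin
        α x           ≈⟨ α.α-cong x≈g^i ⟩
        α (g F.^ i)   ≈⟨ α.α-^ g i ⟩
        α g ^ i       ≈⟨ ^-congˡ i αg≈βg ⟩
        β g ^ i       ≈⟨ β.α-^ g i ⟨
        β (g F.^ i)   ≈⟨ β.α-cong x≈g^i ⟨
        β x           ∎

    αg^n≈1 : ∀ {α} → IsMultiplicative α → α g ^ n ≈ 1#
    αg^n≈1 α-mult = trans (sym (α-^ g n)) (trans (α-cong g^[q-1]≈1) α-1)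
      where open IsMultiplicative α-mult

    module _ {ζ} (ζ^n≈1 : ζ ^ n ≈ 1#) where
      private
        powers-agree-≤ : ∀ {i j} → i ℕ.≤ j → g F.^ i F.≈ g F.^ j → ζ ^ i ≈ ζ ^ j
        powers-agree-≤ {i} {j} i≤j g^i≈g^j with order {j ℕ.∸ i} (F.^-∸-≈1 g≉0 i≤j g^i≈g^j)
        ... | divides r j-i≡r*n = begin
          ζ ^ i                     ≈⟨ *-identityʳ _ ⟨
          ζ ^ i * 1#                ≈⟨ *-congˡ (trans (^-congˡ r ζ^n≈1) (1^n≈1 r)) ⟨
          ζ ^ i * (ζ ^ n) ^ r       ≈⟨ *-congˡ (trans (^-assocʳ ζ n r) (^-congʳ ζ (≡.trans (ℕ.*-comm n r) (≡.sym j-i≡r*n)))) ⟩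
          ζ ^ i * ζ ^ (j ℕ.∸ i)     ≈⟨ ^-homo-* ζ i (j ℕ.∸ i) ⟨
          ζ ^ (i ℕ.+ (j ℕ.∸ i))     ≈⟨ ^-congʳ ζ (ℕ.m+[n∸m]≡n i≤j) ⟩
          ζ ^ j                     ∎

        powers-agree : ∀ i j → g F.^ i F.≈ g F.^ j → ζ ^ i ≈ ζ ^ j
        powers-agree i j g^i≈g^j with ℕ.≤-total i j
        ... | inj₁ i≤j = powers-agree-≤ i≤j g^i≈g^j
        ... | inj₂ j≤i = sym (powers-agree-≤ j≤i (F.sym g^i≈g^j))

        log : FU.Carrier → ℕ
        log u = proj₁ (generates (unit≉0 u))

        g^log : ∀ u → value u F.≈ g F.^ log u
        g^log u = proj₂ (generates (unit≉0 u))

        ζ-unit : KU.Carrier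
        ζ-unit = record
          { value        = ζ
          ; value⁻¹      = ζ ^ ℕ.pred n
          ; isReciprocal = trans (^-congʳ ζ (ℕ.suc-pred n {{q-1≢0}})) ζ^n≈1
          }

        power : ℕ → KU.Carrier
        power i = record
          { value        = ζ ^ i
          ; value⁻¹      = value⁻¹ ζ-unit ^ i
          ; isReciprocal = trans (sym (^-distrib-* ζ _ i)) (trans (^-congˡ i (isReciprocal ζ-unit)) (1^n≈1 i))
          }

        power-log-cong : ∀ u i {x} → value u F.≈ x → x F.≈ g F.^ i → ζ ^ log u ≈ ζ ^ i
        power-log-cong u i u≈x x≈g^i = powers-agree (log u) i (F.trans (F.sym (g^log u)) (F.trans u≈x x≈g^i))

        power-log-∙ : ∀ u v → ζ ^ log (u FU.∙ v) ≈ ζ ^ log u * ζ ^ log v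
        power-log-∙ u v = trans
          (power-log-cong (u FU.∙ v) (log u ℕ.+ log v) (F.*-cong (g^log u) (g^log v)) (F.sym (F.^-homo-* g (log u) (log v))))
          (^-homo-* ζ (log u) (log v))

        power-log-ε : ζ ^ log FU.ε ≈ 1#
        power-log-ε = power-log-cong FU.ε 0 F.refl F.refl

      -- Sends `g ^ i` to `ζ ^ i`. The exponent chosen by `log` does not matter: two exponents of
      -- the same element differ by a multiple of `n`, and `ζ ^ n ≈ 1#`.
      characterWithValue : Character
      characterWithValue = record
        { ⟦_⟧ = power ∘ log
        ; isGroupHomomorphism = record
            { isMonoidHomomorphism = record
                { isMagmaHomomorphism = record
                    { isRelHomomorphism = record { cong = λ {u} {v} u≈v → power-log-cong u (log v) u≈v (g^log v) }
                    ; homo = power-log-∙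
                    }
                ; ε-homo = power-log-ε
                }
            -- The inverse stored in `power` is a power of `ζ ^ pred n`, not `ζ ^ log (u ⁻¹)`;
            -- uniqueness of inverses identifies the two.
            ; ⁻¹-homo = λ u → inverseˡ-unique (power (log (u FU.⁻¹))) (power (log u))
                (trans (sym (power-log-∙ (u FU.⁻¹) u))
                  (trans (power-log-cong (u FU.⁻¹ FU.∙ u) (log FU.ε) (FU.inverseˡ u) (g^log FU.ε)) power-log-ε))
            }
        }
        where open Algebra.Properties.Group KU.group using (inverseˡ-unique)

      characterWithValue⟨g⟩ : characterWithValue ⟨ g ⟩ ≈ ζ
      characterWithValue⟨g⟩ = begin
        characterWithValue ⟨ g ⟩    ≈⟨ ⟨⟩-≉0 characterWithValue g≉0 ⟩
        ζ ^ log (unit g≉0)          ≈⟨ power-log-cong (unit g≉0) 1 F.refl (F.sym (F.*-identityʳ g)) ⟩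
        ζ * 1#                      ≈⟨ *-identityʳ ζ ⟩
        ζ                           ∎

    -- The character sending g to an mth root of a primitive sixth root of unity w is a
    -- power of T, so w or its inverse is a power of (T ^χ m) ⟨ g ⟩.
    generator-sixth-root : ∀ {T} → IsGenerator T → (6∣n : 6 ∣ n) → IsPrimitiveSixthRoot ((T ^χ ℕ.quotient 6∣n) ⟨ g ⟩)
    generator-sixth-root {T} T-generates 6∣n@(divides m n≡m*6) = from-power (T-generates χ)
      where
      instance
        m≢0 : NonZero m
        m≢0 = nonZero-factor m (≡.subst NonZero n≡m*6 q-1≢0)
          where
          nonZero-factor : ∀ m → NonZero (m ℕ.* 6) → NonZero m
          nonZero-factor (suc _) _ = _

      τ = T ⟨ g ⟩
      t = (T ^χ m) ⟨ g ⟩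
      w = proj₁ primitiveSixthRoot
      w-primitive = proj₂ primitiveSixthRoot
      ζ = proj₁ (nthRoot m w)

      ζ^m≈w : ζ ^ m ≈ w
      ζ^m≈w = proj₂ (nthRoot m w)

      ζ^n≈1 : ζ ^ n ≈ 1#
      ζ^n≈1 = trans (^-congʳ ζ n≡m*6) (trans (sym (^-assocʳ ζ m 6)) (trans (^-congˡ 6 ζ^m≈w) (w⁶≈1 w-primitive)))

      χ : Character
      χ = characterWithValue ζ^n≈1

      t≈τ^m : t ≈ τ ^ m
      t≈τ^m = ⟨⟩-^ T m g≉0

      t⁶≈1 : t ^ 6 ≈ 1#
      t⁶≈1 = trans (^-congˡ 6 t≈τ^m) (trans (^-assocʳ τ m 6) (trans (^-congʳ τ (≡.sym n≡m*6)) (αg^n≈1 (⟨⟩-isMultiplicative T))))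

      t^k : ∀ k → t ^ k ≈ (τ ^ k) ^ m
      t^k k = trans (^-congˡ k t≈τ^m) (^-swap τ m k)

      from-power : ∃[ i ] χ ≈χ (T ^ℤ i) → IsPrimitiveSixthRoot t
      from-power (+ k , χ≈T^k) = primitiveSixthRoot-base w-primitive k t⁶≈1 (begin
        t ^ k         ≈⟨ t^k k ⟩
        (τ ^ k) ^ m   ≈⟨ ^-congˡ m (⟨⟩-^ T k g≉0) ⟨
        (T ^χ k) ⟨ g ⟩ ^ m  ≈⟨ ^-congˡ m (⟨⟩-≈χ {χ} {T ^χ k} χ≈T^k g) ⟨
        χ ⟨ g ⟩ ^ m   ≈⟨ ^-congˡ m (characterWithValue⟨g⟩ ζ^n≈1) ⟩
        ζ ^ m         ≈⟨ ζ^m≈w ⟩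
        w             ∎)
      from-power (-[1+ k ] , χ≈T^-k) = primitiveSixthRoot-base v-primitive (suc k) t⁶≈1 refl
        where
        v = t ^ suc k
        η = T ^χ suc k

        wv≈1 : w * v ≈ 1#
        wv≈1 = begin
          w * v                         ≈⟨ *-cong (sym ζ^m≈w) (t^k (suc k)) ⟩
          ζ ^ m * (τ ^ suc k) ^ m       ≈⟨ ^-distrib-* ζ _ m ⟨
          (ζ * τ ^ suc k) ^ m           ≈⟨ ^-congˡ m (begin
            ζ * τ ^ suc k                 ≈⟨ *-cong (trans (sym (characterWithValue⟨g⟩ ζ^n≈1)) (⟨⟩-≈χ {χ} {η ⁻¹χ} χ≈T^-k g)) (sym (⟨⟩-^ T (suc k) g≉0)) ⟩
            (η ⁻¹χ) ⟨ g ⟩ * η ⟨ g ⟩       ≈⟨ *-congʳ (⟨⟩-⁻¹ η g) ⟩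
            η ⟨ g F.⁻¹ ⟩ * η ⟨ g ⟩        ≈⟨ *-comm _ _ ⟩
            η ⟨ g ⟩ * η ⟨ g F.⁻¹ ⟩        ≈⟨ IsMultiplicative.α-⁻¹ (⟨⟩-isMultiplicative η) g≉0 ⟩
            1#                            ∎) ⟩
          1# ^ m                        ≈⟨ 1^n≈1 m ⟩
          1#                            ∎

        -- The equation `w² - w + 1 = 0` says `w(1 - w) = 1`, so the inverse of `w` is the other
        -- root of the cyclotomic polynomial.
        v≈1-w : v ≈ 1# - w
        v≈1-w = begin
          v                                     ≈⟨ solve 2 (λ w v → v := v :* (w :* w :- w :+ :# 1) :+ w :* v :* (:# 1 :- w)) refl w v ⟩
          v * (w * w - w + 1#) + w * v * (1# - w) ≈⟨ +-cong (trans (*-congˡ w-primitive) (zeroʳ v)) (trans (*-congʳ wv≈1) (*-identityˡ _)) ⟩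
          0# + (1# - w)                         ≈⟨ +-identityˡ _ ⟩
          1# - w                                ∎

        v-primitive : IsPrimitiveSixthRoot v
        v-primitive = begin
          v * v - v + 1#                              ≈⟨ +-congʳ (+-cong (*-cong v≈1-w v≈1-w) (-‿cong v≈1-w)) ⟩
          (1# - w) * (1# - w) - (1# - w) + 1#         ≈⟨ solve 1 (λ w → (:# 1 :- w) :* (:# 1 :- w) :- (:# 1 :- w) :+ :# 1 := w :* w :- w :+ :# 1) refl w ⟩
          w * w - w + 1#                              ≈⟨ w-primitive ⟩
          0#                                          ∎

    -- The value squares to 1, and the value 1 at a generator would make `φ` trivial.
    quadratic⟨g⟩ : ∀ {φ} → IsQuadratic φ → φ ⟨ g ⟩ ≈ - 1#
    quadratic⟨g⟩ {φ} (φ≉ε , φ²≈ε) with x²≈1⇒x≈±1 (begin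
        φ ⟨ g ⟩ * φ ⟨ g ⟩   ≈⟨ ⟨⟩-∙ φ φ g ⟨
        (φ ∙χ φ) ⟨ g ⟩      ≈⟨ ⟨⟩-≈χ {φ ∙χ φ} {ε} φ²≈ε g ⟩
        ε ⟨ g ⟩             ≈⟨ ⟨⟩-ε g≉0 ⟩
        1#                  ∎)
    ... | inj₂ φg≈-1 = φg≈-1
    ... | inj₁ φg≈1  = contradiction (λ u → begin
        value (⟦ φ ⟧ u)     ≈⟨ ⟨⟩-unit φ u ⟨
        φ ⟨ value u ⟩       ≈⟨ determined-by-g (⟨⟩-isMultiplicative φ) (⟨⟩-isMultiplicative ε) (trans φg≈1 (sym (⟨⟩-ε g≉0))) (value u) ⟩
        ε ⟨ value u ⟩       ≈⟨ ⟨⟩-unit ε u ⟩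
        1#                  ∎) φ≉ε

-- Assembly: both sides as multiples of the same sum.

theorem1p3 :
  ∀ {c ℓ k ℓ₁ ℓ₂} (𝔽 : FiniteField c ℓ) (K : AlgebraicallyClosedField₀ k ℓ₁ ℓ₂) →
  let open FiniteField 𝔽 renaming (order to q)
      open Characters 𝔽 K
      module K = AlgebraicallyClosedField₀ K
  in
  ∀ (p : ℕ) → HasCharacteristic p → ¬ (2 ∣ p) →
  q % 6 ≡ 1 →
  ∀ (T φ : Character) → IsGenerator T → IsQuadratic φ →
  ∀ (a b c : Carrier) → a ≉ 0# → b ≉ 0# → c ≉ 0# →
  a ≉ b → b ≉ c → a ≉ c →
  ∀ (h : Carrier) → h ≉ 0# →
  3 · (h ^ 2) + 2 · ((a + b + c) * h) + (a * b + b * c + c * a) ≈ 0# →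
  let d = 3 · h + a + b + c
      e = h ^ 3 + (a + b + c) * h ^ 2 + (a * b + b * c + c * a) * h + a * b * c
  in
  d ≉ 0# →
  ψ₁₁₁ φ a b c K.≈
    (q K.· K.1#) K.* φ ⟨ - (3 · d) ⟩ K.*
    ₂F₁ (T ^χ ((q ℕ.∸ 1) / 6)) (T ^χ ((5 ℕ.* (q ℕ.∸ 1)) / 6)) ε
        (- (((3 ℕ.^ 3) · e) ÷ ((2 ℕ.^ 2) · (d ^ 3))))
theorem1p3 𝔽 K p _ _ q%6≡1 T φ T-generates φ-quadratic a b c _ _ _ a≉b b≉c a≉c h _ critical d≉0 = begin
  ψ₁₁₁ φ a b c                                        ≈⟨ ∑≈sumOver𝔽 _ ⟨
  ∑[ x ] (φ ⟨ x F.+ a ⟩ * φ ⟨ x F.+ b ⟩ * φ ⟨ x F.+ c ⟩)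
                                                      ≈⟨ ∑-cong (λ x → *-cong (*-cong (φ≈α³ _) (φ≈α³ _)) (φ≈α³ _)) ⟩
  ∑[ x ] (φ′ (x F.+ a) * φ′ (x F.+ b) * φ′ (x F.+ c)) ≈⟨ ∑-cong (λ x → trans (φ′.α-* _ _) (*-congʳ (φ′.α-* _ _))) ⟨
  ∑[ x ] φ′ (cubic x)                                 ≈⟨ ∑-substitution affine-cong (S.affine-injective (h F.- s) s≉0)
                                                           (λ eq → φ′.α-cong (F.*-cong (F.*-cong (F.+-congʳ eq) (F.+-congʳ eq)) (F.+-congʳ eq))) ⟨
  ∑[ w ] φ′ (cubic (s F.* w F.+ (h F.- s)))           ≈⟨ ∑-cong (λ w → trans (φ′.α-cong (normalForm w)) (φ′-square* s≉0 _)) ⟩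
  ∑[ w ] φ′ (s F.* (S.D w F.+ shift))                 ≈⟨ ∑-cong (λ w → φ′.α-* s _) ⟩
  ∑[ w ] (φ′ s * φ′ (S.D w F.+ shift))                ≈⟨ ∑-*ˡ (φ′ s) _ ⟩
  φ′ s * (∑[ w ] φ′ (S.D w F.+ shift))                ≈⟨ *-congˡ (∑-hypergeometric X≉0 X≉1) ⟨
  φ′ s * H                                            ≈⟨ coefficient (q K.· 1#) q⁻¹ (φ′ s) H (α -1F) q⁻¹q≈1 α[-1]²≈1 ⟨
  (q K.· 1#) * (φ′ -1F * φ′ s) * (1# * (α -1F * q⁻¹) * H)
                                                      ≈⟨ *-cong (*-congˡ φ⟨-3d⟩) (*-cong (*-cong (⟨⟩-ε X≉0) (*-congʳ Bε⟨-1⟩)) Σ≈H) ⟨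
  (q K.· 1#) * φ ⟨ F.- (3 F.· d) ⟩ * ₂F₁ A B ε X      ∎
  where
  module F where
    open FiniteField 𝔽 public
    open FiniteFieldProperties 𝔽 public
    open IntegerCoefficients commutativeRing public
    open PrimitiveRoots 𝔽 public
    open CubicNormalForm 𝔽 public
  module K = AlgebraicallyClosedField₀ K
  open ValueFieldProperties K
  open Characters 𝔽 K
  open Sums 𝔽 K
  open MultiplicativeFunctions 𝔽 K
  open CharacterProperties 𝔽 K
  open Relation.Binary.Reasoning.Setoid setoid

  q = F.order
  open F.Cubic a b c h using (d; X)
  -1F = F.- F.1#
  shift = F.fromℕ 2 F.- F.fromℕ 4 F.* X

  -- The quotient is stored literally as `(q ∸ 1) / 6`, so that `generator-sixth-root` applies to
  -- `A` itself.
  6∣q-1 : 6 ∣ q ℕ.∸ 1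
  6∣q-1 = divides ((q ℕ.∸ 1) / 6) (≡.sym (ℕ.m/n*n≡m (divides (q / 6) (≡.cong (ℕ._∸ 1)
    (≡.trans (ℕ.m≡m%n+[m/n]*n q 6) (≡.cong (ℕ._+ q / 6 ℕ.* 6) q%6≡1))))))

  root = F.primitiveRoot
  open F.PrimitiveRoot root using (g; g≉0)
  module S = SixthRootsOfUnity 𝔽 root 6∣q-1
  open F.Cubic.CriticalPoint a b c h S.2≉0 S.3≉0 a≉b b≉c a≉c critical d≉0
    using (X≉0; X≉1; scale*3≈d; normalForm) renaming (scale to s; scale≉0 to s≉0)

  A B : Character
  A = T ^χ ((q ℕ.∸ 1) / 6)
  B = T ^χ ((5 ℕ.* (q ℕ.∸ 1)) / 6)

  α = A ⟨_⟩
  α-isMultiplicative = ⟨⟩-isMultiplicative A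
  open IsMultiplicative α-isMultiplicative

  αg-primitive : IsPrimitiveSixthRoot (α g)
  αg-primitive = generator-sixth-root root T-generates 6∣q-1

  open SexticCharacterSums 𝔽 K root 6∣q-1 α-isMultiplicative αg-primitive
    using (φ-isMultiplicative; φ-square; ∑-hypergeometric) renaming (φ to φ′)
  module φ′ = IsMultiplicative φ-isMultiplicative

  φ≈α³ : ∀ x → φ ⟨ x ⟩ ≈ φ′ x
  φ≈α³ = determined-by-g root (⟨⟩-isMultiplicative φ) φ-isMultiplicative
    (trans (quadratic⟨g⟩ root φ-quadratic) (sym (w³≈-1 αg-primitive)))

  -- As 6 divides `q - 1`, the exponent of `B` is five times that of `A`; and `α g ^ 5` is the
  -- inverse of `α g` because `α g ^ 6` is 1.
  B≈α⁻¹ : ∀ x → B ⟨ x ⟩ ≈ α (x F.⁻¹)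
  B≈α⁻¹ = determined-by-g root (⟨⟩-isMultiplicative B) (∘⁻¹-isMultiplicative α-isMultiplicative) (begin
    B ⟨ g ⟩                         ≈⟨ ⟨⟩-^ T ((5 ℕ.* (q ℕ.∸ 1)) / 6) g≉0 ⟩
    T ⟨ g ⟩ ^ ((5 ℕ.* (q ℕ.∸ 1)) / 6)   ≈⟨ ^-congʳ (T ⟨ g ⟩) (≡.trans (ℕ.*-/-assoc 5 6∣q-1) (ℕ.*-comm 5 ((q ℕ.∸ 1) / 6))) ⟩
    T ⟨ g ⟩ ^ ((q ℕ.∸ 1) / 6 ℕ.* 5) ≈⟨ ^-assocʳ (T ⟨ g ⟩) ((q ℕ.∸ 1) / 6) 5 ⟨
    (T ⟨ g ⟩ ^ ((q ℕ.∸ 1) / 6)) ^ 5 ≈⟨ ^-congˡ 5 (⟨⟩-^ T ((q ℕ.∸ 1) / 6) g≉0) ⟨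
    α g ^ 5                         ≈⟨ *-identityʳ _ ⟨
    α g ^ 5 * 1#                    ≈⟨ *-congˡ (α-⁻¹ g≉0) ⟨
    α g ^ 5 * (α g * α (g F.⁻¹))    ≈⟨ solve 2 (λ x y → x :^ 5 :* (x :* y) := x :^ 6 :* y) refl (α g) (α (g F.⁻¹)) ⟩
    α g ^ 6 * α (g F.⁻¹)            ≈⟨ trans (*-congʳ (w⁶≈1 αg-primitive)) (*-identityˡ _) ⟩
    α (g F.⁻¹)                      ∎)

  B⁻¹ε≈α : ∀ x → ((B ⁻¹χ) ∙χ ε) ⟨ x ⟩ ≈ α x
  B⁻¹ε≈α x = begin
    ((B ⁻¹χ) ∙χ ε) ⟨ x ⟩  ≈⟨ ⟨⟩-∙ε (B ⁻¹χ) x ⟩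
    (B ⁻¹χ) ⟨ x ⟩         ≈⟨ ⟨⟩-⁻¹ B x ⟩
    B ⟨ x F.⁻¹ ⟩          ≈⟨ B≈α⁻¹ (x F.⁻¹) ⟩
    α ((x F.⁻¹) F.⁻¹)     ≈⟨ α-cong (F.⁻¹-involutive x) ⟩
    α x                   ∎

  cubic : F.Carrier → F.Carrier
  cubic x = (x F.+ a) F.* (x F.+ b) F.* (x F.+ c)

  affine-cong : (λ w → s F.* w F.+ (h F.- s)) Preserves F._≈_ ⟶ F._≈_
  affine-cong eq = F.+-congʳ (F.*-congˡ eq)

  φ′-square* : ∀ {x} → x F.≉ F.0# → ∀ y → φ′ (x F.* x F.* y) ≈ φ′ y
  φ′-square* {x} x≉0 y = trans (φ′.α-* (x F.* x) y) (trans (*-congʳ (φ-square x≉0)) (*-identityˡ _))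

  φ⟨-3d⟩ : φ ⟨ F.- (3 F.· d) ⟩ ≈ φ′ -1F * φ′ s
  φ⟨-3d⟩ = begin
    φ ⟨ F.- (3 F.· d) ⟩                                       ≈⟨ φ≈α³ _ ⟩
    φ′ (F.- (3 F.· d))                                        ≈⟨ φ′.α-cong -3d≈ ⟩
    φ′ (F.fromℕ 3 F.* F.fromℕ 3 F.* (-1F F.* s))              ≈⟨ φ′-square* S.3≉0 _ ⟩
    φ′ (-1F F.* s)                                            ≈⟨ φ′.α-* -1F s ⟩
    φ′ -1F * φ′ s                                             ∎
    where
    -- Since `d = 3s`, this is `-9s`, and `φ′` ignores the square 9.
    -3d≈ : F.- (3 F.· d) F.≈ F.fromℕ 3 F.* F.fromℕ 3 F.* (-1F F.* s)
    -3d≈ = F.trans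
      (F.-‿cong (F.trans (F.·≈fromℕ* 3 d) (F.*-congˡ (F.sym (scale*3≈d)))))
      (F.solve 1 (λ s → F.:- (F.:# 3 F.:* (s F.:* F.:# 3)) F.:= F.:# 3 F.:* F.:# 3 F.:* ((F.:- F.:# 1) F.:* s)) F.refl s)

  -1²≈1 : -1F F.* -1F F.≈ F.1#
  -1²≈1 = F.solve 0 ((F.:- F.:# 1) F.:* (F.:- F.:# 1) F.:= F.:# 1) F.refl

  α[-1]²≈1 : α -1F * α -1F ≈ 1#
  α[-1]²≈1 = trans (sym (α-* -1F -1F)) (trans (α-cong -1²≈1) α-1)

  Bε⟨-1⟩ : (B ∙χ ε) ⟨ -1F ⟩ ≈ α -1F
  Bε⟨-1⟩ = trans (⟨⟩-∙ε B -1F) (trans (B≈α⁻¹ -1F) (α-cong (F.sym (F.⁻¹-unique -1²≈1))))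

  H = ∑[ y ] (α (y F.⁻¹) * α (F.1# F.- y) * α ((F.1# F.- X F.* y) F.⁻¹))

  Σ≈H : ∑[ y ∈𝔽] (B ⟨ y ⟩ * ((B ⁻¹χ) ∙χ ε) ⟨ F.1# F.- y ⟩ * (A ⁻¹χ) ⟨ F.1# F.- X F.* y ⟩) ≈ H
  Σ≈H = trans (sym (∑≈sumOver𝔽 _))
    (∑-cong (λ y → *-cong (*-cong (B≈α⁻¹ y) (B⁻¹ε≈α (F.1# F.- y))) (⟨⟩-⁻¹ A (F.1# F.- X F.* y))))

  q⁻¹ = K.1/ℕ q {{F.order-nonZero}}

  q⁻¹q≈1 : q⁻¹ * (q K.· 1#) ≈ 1#
  q⁻¹q≈1 = trans (*-congˡ (solve 1 (λ x → x := x :- :# 0) refl (q K.· 1#)))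
    (proj₁ (proj₂ (#⇒invertible (characteristicZero q {{F.order-nonZero}}))))

  -- With `a = α(-1)`, the factor `φ(-1)` is `a ^ 3` and `BC(-1)` is `a`; their product `a ^ 4` is
  -- 1, and `q` cancels the denominator of the series.
  coefficient : ∀ q q⁻¹ s h a → q⁻¹ * q ≈ 1# → a * a ≈ 1# →
                q * (a ^ 3 * s) * (1# * (a * q⁻¹) * h) ≈ s * h
  coefficient q q⁻¹ s h a q⁻¹q≈1 a²≈1 = begin
    q * (a ^ 3 * s) * (1# * (a * q⁻¹) * h)    ≈⟨ solve 5 (λ q i s h a → q :* (a :^ 3 :* s) :* (:# 1 :* (a :* i) :* h)
                                                  := (a :* a) :* (a :* a) :* (i :* q) :* (s :* h)) refl q q⁻¹ s h a ⟩
    (a * a) * (a * a) * (q⁻¹ * q) * (s * h)   ≈⟨ *-congʳ (*-cong (*-cong a²≈1 a²≈1) q⁻¹q≈1) ⟩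
    1# * 1# * 1# * (s * h)                    ≈⟨ solve 1 (λ x → :# 1 :* :# 1 :* :# 1 :* x := x) refl (s * h) ⟩
    s * h                                     ∎
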